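{- The decision problem "Given a positive regular expression $E'$ over the alphabet $\{0,1\}$, does an $(E',E')$-crossword exist?" is m-equivalent to the Halting Problem.
   Context: Regular expressions are built from letters, $\varepsilon$, union, concatenation and Kleene star; a string matches $E$ if it lies in $L(E)$. A $\{0,1\}$-crossword is a nonempty $m\times n$ array ($m,n\ge1$) of symbols $0,1$; an $(E,E)$-crossword is such an array whose every row (read left to right) and every column (read top to bottom) matches $E$. A regular expression is positive if the empty string does not match it. Two decision problems are m-equivalent if each is many-one reducible to the other via a total computable function. The Halting Problem is the set of (encodings of) pairs $(M,w)$ of a Turing machine $M$ and an input $w$ such that $M$ halts on $w$. -}

module Defs where

open import Data.Bool using (Bool; true; false)
open import Data.Nat using (ℕ; zero; suc)
open import Data.Fin using (Fin; toℕ)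
open import Data.List using (List; []; _∷_; _++_; tabulate; concatMap; allFin)
open import Data.Maybe using (Maybe; just; nothing)
open import Data.Product using (Σ; _×_; _,_; proj₁)
open import Relation.Binary.PropositionalEquality using (_≡_)
open import Relation.Nullary using (¬_)
open import Function.Bundles using (_⇔_)

-- Regular expressions over the alphabet {0,1} (0 = false, 1 = true)

data RegExp : Set where
  lit   : Bool → RegExp
  eps   : RegExp
  _∣∣_  : RegExp → RegExp → RegExp
  _··_  : RegExp → RegExp → RegExp
  star  : RegExp → RegExp

data _∈L_ : List Bool → RegExp → Set where
  m-lit   : ∀ b → (b ∷ []) ∈L lit b
  m-eps   : [] ∈L eps
  m-unionˡ : ∀ {w E F} → w ∈L E → w ∈L (E ∣∣ F)
  m-unionʳ : ∀ {w E F} → w ∈L F → w ∈L (E ∣∣ F)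
  m-cat   : ∀ {u v E F} → u ∈L E → v ∈L F → (u ++ v) ∈L (E ·· F)
  m-star0 : ∀ {E} → [] ∈L star E
  m-starS : ∀ {u v E} → u ∈L E → v ∈L star E → (u ++ v) ∈L star E

Positive : RegExp → Set
Positive E = ¬ ([] ∈L E)

PosRegExp : Set
PosRegExp = Σ RegExp Positive

-- An (E,E)-crossword: a nonempty (suc m) × (suc n) array of bits whose
-- rows (left to right) and columns (top to bottom) all match E.
IsCrossword : RegExp → (m n : ℕ) → (Fin (suc m) → Fin (suc n) → Bool) → Set
IsCrossword E m n a =
  ((i : Fin (suc m)) → tabulate (λ j → a i j) ∈L E) ×
  ((j : Fin (suc n)) → tabulate (λ i → a i j) ∈L E)

CrosswordExists : RegExp → Set
CrosswordExists E = Σ ℕ λ m → Σ ℕ λ n →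
  Σ (Fin (suc m) → Fin (suc n) → Bool) λ a → IsCrossword E m n a

CROSSWORD : PosRegExp → Set
CROSSWORD E = CrosswordExists (proj₁ E)

-- Turing machines (single two-way infinite tape, input alphabet {0,1},
-- tape alphabet {blank,0,1}; state zero is the start state; the machine
-- halts when the transition function is undefined).

Sym : Set
Sym = Maybe Bool          -- nothing = blank

data Dir : Set where
  L R : Dir

record TM : Set where
  field
    nStates : ℕ
    δ : Fin (suc nStates) → Sym → Maybe (Fin (suc nStates) × Sym × Dir)
open TM public

record Config (k : ℕ) : Set where
  constructor conf
  field
    state : Fin (suc k)
    left  : List Sym       -- cells left of the head, nearest first
    head  : Sym
    right : List Sym       -- cells right of the head, nearest first
open Config public

move : ∀ {k} → Dir → Fin (suc k) → List Sym → Sym → List Sym → Config k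
move L q []       s r = conf q [] nothing (s ∷ r)
move L q (x ∷ l)  s r = conf q l x (s ∷ r)
move R q l s []       = conf q (s ∷ l) nothing []
move R q l s (x ∷ r)  = conf q (s ∷ l) x r

step : (M : TM) → Config (nStates M) → Maybe (Config (nStates M))
step M (conf q l s r) with δ M q s
... | nothing = nothing
... | just (q' , s' , d) = just (move d q' l s' r)

run : (M : TM) → ℕ → Config (nStates M) → Config (nStates M)
run M zero c = c
run M (suc n) c with step M c
... | nothing = c
... | just c' = run M n c'

Halted : (M : TM) → Config (nStates M) → Set
Halted M c = step M c ≡ nothing

initConf : ∀ {k} → List Bool → Config k
initConf []      = conf Fin.zero [] nothing []
  where import Data.Fin as Fin
initConf (b ∷ w) = conf Fin.zero [] (just b) (Data.List.map just w)
  where import Data.Fin as Fin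
        import Data.List

readOut : List Sym → List Bool
readOut []             = []
readOut (nothing ∷ _)  = []
readOut (just b ∷ xs)  = b ∷ readOut xs

output : ∀ {k} → Config k → List Bool
output c = readOut (head c ∷ right c)

HaltsOn : TM → List Bool → Set
HaltsOn M w = Σ ℕ λ n → Halted M (run M n (initConf w))

HaltsWithOutput : TM → List Bool → List Bool → Set
HaltsWithOutput M w out = Σ ℕ λ n →
  Halted M (run M n (initConf w)) × output (run M n (initConf w)) ≡ out

encℕ : ℕ → List Bool
encℕ zero    = false ∷ []
encℕ (suc n) = true ∷ encℕ n

encWord : List Bool → List Bool
encWord []      = false ∷ []
encWord (b ∷ w) = true ∷ b ∷ encWord w

encRegExp : RegExp → List Bool
encRegExp (lit b)  = false ∷ false ∷ b ∷ []
encRegExp eps      = false ∷ true ∷ false ∷ []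
encRegExp (E ∣∣ F) = false ∷ true ∷ true ∷ encRegExp E ++ encRegExp F
encRegExp (E ·· F) = true ∷ false ∷ false ∷ encRegExp E ++ encRegExp F
encRegExp (star E) = true ∷ false ∷ true ∷ encRegExp E

encSym : Sym → List Bool
encSym nothing  = false ∷ false ∷ []
encSym (just b) = true ∷ b ∷ []

encDir : Dir → List Bool
encDir L = false ∷ []
encDir R = true ∷ []

allSyms : List Sym
allSyms = nothing ∷ just false ∷ just true ∷ []

encEntry : ∀ {k} → Maybe (Fin (suc k) × Sym × Dir) → List Bool
encEntry nothing            = false ∷ []
encEntry (just (q , s , d)) = true ∷ encℕ (toℕ q) ++ encSym s ++ encDir d

encTM : TM → List Bool
encTM M = encℕ (nStates M) ++
  concatMap (λ q → concatMap (λ s → encEntry {nStates M} (δ M q s)) allSyms)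
            (allFin (suc (nStates M)))

encPosRegExp : PosRegExp → List Bool
encPosRegExp E = encRegExp (proj₁ E)

encTMInput : TM × List Bool → List Bool
encTMInput (M , w) = encTM M ++ encWord w

HALT : TM × List Bool → Set
HALT (M , w) = HaltsOn M w

ManyOneReducible : {X Y : Set} (encX : X → List Bool) (encY : Y → List Bool)
                   (A : X → Set) (B : Y → Set) → Set
ManyOneReducible {X} {Y} encX encY A B =
  Σ TM λ T → (x : X) → Σ Y λ y →
    HaltsWithOutput T (encX x) (encY y) × (A x ⇔ B y)

MEquivalent : {X Y : Set} (encX : X → List Bool) (encY : Y → List Bool)
              (A : X → Set) (B : Y → Set) → Set
MEquivalent encX encY A B =
  ManyOneReducible encX encY A B × ManyOneReducible encY encX B A

{-# OPTIONS --safe #-}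
-- Each reduction maps a code w to pre ++ concatMap f w ++ suf, which a small Turing machine computes: all the work is done
-- by two fixed machines that read w.  They come from a functional language on binary trees, compiled, through programs on
-- bit stacks kept on tracks of the tape, to machines that iterate a tree function until it returns the leaf.  One function
-- searches for a crossword by generating words of L(E) from a list of choices and comparing the rows with the transposed
-- columns; the other is a universal Turing machine.
--
-- A run of a machine M becomes a crossword as follows.  A row of even index interleaves the one-hot codes of two
-- consecutive configurations, and a row of odd index repeats the second one in both places; the columns only copy letters
-- downwards, in pairs.  The configurations start and end with the all-zero word, which can only be followed by an initial
-- configuration and only be reached from a halting one, so such an array exists exactly if M halts.  One expression can
-- serve rows and columns because the array is bordered by a 7 × 7 block that is determined up to transposition by the
-- prefixes allowed: the prefix of a line then says whether it is a row or a column and which constraint it has to satisfy.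
module Submission where

open import Data.Bool using (Bool; true; false; if_then_else_; not; _∨_)
open import Data.Bool.Properties using () renaming (_≟_ to _≟ᵇ_)
open import Data.Empty using (⊥; ⊥-elim)
open import Data.Fin as F using (Fin; toℕ; fromℕ<)
open import Data.Fin.Properties as FP using (toℕ-fromℕ<; toℕ<n)
open import Data.List using (List; []; _∷_; _++_; map; concatMap; length; replicate; reverse; drop; foldl; applyUpTo; tabulate; allFin; _ʳ++_)
open import Data.List.Properties as LP using (++-assoc; ++-identityʳ; length-++; length-map; map-++; ∷-injective; ∷-injectiveˡ; ∷-injectiveʳ; unfold-reverse; reverse-++; foldl-++)
open import Data.List.Relation.Unary.All as All using (All; []; _∷_)
open import Data.List.Relation.Unary.All.Properties as AllP using ()
open import Data.List.Relation.Unary.Any as Any using (here; there)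
open import Data.List.Relation.Unary.Any.Properties as AnyP using ()
open import Data.List.Membership.Propositional using (_∈_; find)
open import Data.List.Membership.Propositional.Properties using (∈-++⁺ˡ; ∈-++⁺ʳ; ∈-map⁺; ∈-map⁻; ∈-allFin; ∈-concatMap⁺; ∈-concatMap⁻)
open import Data.Maybe using (Maybe; just; nothing)
open import Data.Maybe.Properties as MaybeP using (just-injective)
open import Data.Nat using (ℕ; zero; suc; _+_; _*_; _∸_; _≤_; _<_; z≤n; s≤s; _⊔_; _<?_; _≟_)
open import Data.Nat.GeneralisedArithmetic using (iterate)
open import Data.Nat.Properties as NP using (≤-refl; ≤-trans; +-assoc; +-comm; +-suc; +-identityʳ; m≤m+n; m≤n+m; m≤m⊔n; m≤n⊔m)
open import Data.Product using (Σ; _×_; _,_; proj₁; proj₂; ∃-syntax)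
open import Data.Product.Properties as ProductP using ()
open import Data.Sum using (_⊎_; inj₁; inj₂)
open import Data.Unit using (⊤; tt)
open import Function using (_∘_; id; case_of_)
open import Function.Bundles using (_⇔_; mk⇔; Equivalence)
open import Relation.Binary.PropositionalEquality using (_≡_; _≢_; refl; sym; trans; cong; cong₂; subst; subst₂; _≗_; module ≡-Reasoning)
open import Relation.Nullary using (¬_; Dec; yes; no; does)
open import Relation.Nullary.Decidable using (True)

open import Defs

-- Deterministic transition systems

-- A reduction has to be an explicit Turing machine, so both are kept to letterwise rewriting. The
-- targets allow this. An instance of the Halting Problem may contain a fixed machine, and then only
-- its input varies. The expression for a universal machine depends on the input only through a
-- product of letters near its end, and prefix notation codes such a product letter by letter. The
-- equivalences are constructive in both directions, so the success of a search has to be extracted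
-- from a halting run of the compiled machine. This is done by counting transitions: every round of
-- the main loop costs at least one. Folds are the only recursion of the tree language, hence each
-- application of the iterated function terminates and all unboundedness sits in the outer
-- iteration. The lines of an array have a fixed length, therefore the space of a computation is
-- guessed in its first row. Zero words at both ends make the boundary condition independent of the
-- machine: it can be imposed by the column expression, which only knows single letters.

data Reach {A : Set} (f : A → Maybe A) : ℕ → A → A → Set where
  done : ∀ {a} → Reach f 0 a a
  next : ∀ {n a b c} → f a ≡ just b → Reach f n b c → Reach f (suc n) a c

Halts : {A : Set} → (A → Maybe A) → A → Set
Halts f a = ∃[ n ] ∃[ b ] Reach f n a b × f b ≡ nothing

reach-trans : ∀ {A : Set} {f : A → Maybe A} {m n a b c} → Reach f m a b → Reach f n b c → Reach f (m + n) a c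
reach-trans done s = s
reach-trans (next e r) s = next e (reach-trans r s)

-- By determinism a halting run extends every other run from the same point. The remainder `k`
-- serves later as a decreasing measure.
halting-suffix : ∀ {A : Set} {f : A → Maybe A} {m n a b c} → Reach f m a b → Reach f n a c → f c ≡ nothing →
                 ∃[ k ] n ≡ m + k × Reach f k b c
halting-suffix done s h = _ , refl , s
halting-suffix (next e r) done h = case trans (sym e) h of λ ()
halting-suffix (next e r) (next e′ s) h with trans (sym e) e′
... | refl with halting-suffix r s h
... | k , refl , s′ = k , refl , s′

module _ {A B : Set} (f : A → Maybe A) (g : B → Maybe B) (_~_ : A → B → Set)
         (fwd : ∀ {a b a′} → a ~ b → f a ≡ just a′ → Σ B λ b′ → g b ≡ just b′ × a′ ~ b′)
         (stop : ∀ {a b} → a ~ b → f a ≡ nothing → g b ≡ nothing) where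

  simulate : ∀ {n a b a′} → a ~ b → Reach f n a a′ → Σ B λ b′ → Reach g n b b′ × a′ ~ b′
  simulate r done = _ , done , r
  simulate r (next e s) with fwd r e
  ... | _ , e′ , r′ with simulate r′ s
  ... | _ , s′ , r″ = _ , next e′ s′ , r″

  simulate-halts : ∀ {a b} → a ~ b → Halts f a → Halts g b
  simulate-halts r (n , a′ , s , h) with simulate r s
  ... | b′ , s′ , r′ = n , b′ , s′ , stop r′ h

run-reach : ∀ M {n c c′} → Reach (step M) n c c′ → run M n c ≡ c′
run-reach M done = refl
run-reach M {c = c} (next e r) with step M c | e
... | just _ | refl = run-reach M r

-- `run` stays put once the machine has halted, so the number of genuine transitions can be smaller
-- than `n`.
reach-run : ∀ M n c → ∃[ k ] Reach (step M) k c (run M n c)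
reach-run M zero c = 0 , done
reach-run M (suc n) c with step M c in e
... | nothing = 0 , done
... | just c′ with reach-run M n c′
... | k , r = suc k , next e r

haltsOn⇒halts : ∀ M w → HaltsOn M w → Halts (step M) (initConf w)
haltsOn⇒halts M w (n , h) with reach-run M n (initConf w)
... | k , r = k , _ , r , h

halts⇒haltsOn : ∀ M w → Halts (step M) (initConf w) → HaltsOn M w
halts⇒haltsOn M w (n , c , r , h) = n , trans (cong (step M) (run-reach M r)) h

-- Structured Turing machine programs

record Tape : Set where
  constructor ⟪_,_,_⟫
  field
    lft : List Sym
    cur : Sym
    rgt : List Sym
open Tape public

shift : Dir → List Sym → Sym → List Sym → Tape
shift L []      s r = ⟪ [] , nothing , s ∷ r ⟫
shift L (x ∷ l) s r = ⟪ l , x , s ∷ r ⟫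
shift R l s []      = ⟪ s ∷ l , nothing , [] ⟫
shift R l s (x ∷ r) = ⟪ s ∷ l , x , r ⟫

act-on : Sym × Dir → Tape → Tape
act-on (s , d) t = shift d (lft t) s (rgt t)

infixr 5 _⨾_

-- Each round of a `while` opens with an action. This gives the loop a state of its own, keeps
-- `entry` well-founded although the body continues with the loop itself, and makes every round cost
-- a transition.
data Prog : Set where
  skip  : Prog
  act   : (Sym → Sym × Dir) → Prog
  _⨾_   : Prog → Prog → Prog
  ifs   : (Sym → Bool) → Prog → Prog → Prog
  while : (Sym → Bool) → (Sym → Sym × Dir) → Prog → Prog

infix 4 _/_⇓_

data _/_⇓_ : Prog → Tape → Tape → Set where
  ⇓skip  : ∀ {t} → skip / t ⇓ t
  ⇓act   : ∀ {f t} → act f / t ⇓ act-on (f (cur t)) t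
  ⇓seq   : ∀ {p q t t′ t″} → p / t ⇓ t′ → q / t′ ⇓ t″ → p ⨾ q / t ⇓ t″
  ⇓ifT   : ∀ {b p q t t′} → b (cur t) ≡ true → p / t ⇓ t′ → ifs b p q / t ⇓ t′
  ⇓ifF   : ∀ {b p q t t′} → b (cur t) ≡ false → q / t ⇓ t′ → ifs b p q / t ⇓ t′
  ⇓stop  : ∀ {b f p t} → b (cur t) ≡ false → while b f p / t ⇓ t
  ⇓again : ∀ {b f p t t′ t″} → b (cur t) ≡ true → p / act-on (f (cur t)) t ⇓ t′ →
           while b f p / t′ ⇓ t″ → while b f p / t ⇓ t″

-- Tests cost no transition: they are resolved inside the row of the preceding state.
Row : Set
Row = Sym → Maybe (ℕ × Sym × Dir)

size : Prog → ℕ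
size skip          = 0
size (act f)       = 1
size (p ⨾ q)       = size p + size q
size (ifs b p q)   = size p + size q
size (while b f p) = suc (size p)

-- entry p o κ is the first transition of p when p is compiled at address o and continues with the row κ.
entry : Prog → ℕ → Row → Row
entry skip          o κ = κ
entry (act f)       o κ = λ s → just (o , f s)
entry (p ⨾ q)       o κ = entry p o (entry q (size p + o) κ)
entry (ifs b p q)   o κ = λ s → if b s then entry p o κ s else entry q (size p + o) κ s
entry (while b f p) o κ = λ s → if b s then just (o , f s) else κ s

-- A state is the situation after an action. The row stored for `act f` is therefore its
-- continuation, while the transition that performs `f` belongs to the state before.
rows : Prog → ℕ → Row → List Row
rows skip          o κ = []
rows (act f)       o κ = κ ∷ []
rows (p ⨾ q)       o κ = rows p o (entry q (size p + o) κ) ++ rows q (size p + o) κ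
rows (ifs b p q)   o κ = rows p o κ ++ rows q (size p + o) κ
rows (while b f p) o κ = let e = entry (while b f p) o κ in entry p (suc o) e ∷ rows p (suc o) e

length-rows : ∀ p o κ → length (rows p o κ) ≡ size p
length-rows skip o κ = refl
length-rows (act f) o κ = refl
length-rows (p ⨾ q) o κ =
  trans (length-++ (rows p o _)) (cong₂ _+_ (length-rows p o _) (length-rows q (size p + o) κ))
length-rows (ifs b p q) o κ =
  trans (length-++ (rows p o κ)) (cong₂ _+_ (length-rows p o κ) (length-rows q (size p + o) κ))
length-rows (while b f p) o κ = cong suc (length-rows p (suc o) _)

haltRow : Row
haltRow _ = nothing

firstRow : List Row → Row
firstRow []      = haltRow
firstRow (r ∷ _) = r

rowAt : List Row → ℕ → Row
rowAt rs q = firstRow (drop q rs)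

stepRows : List Row → ℕ × Tape → Maybe (ℕ × Tape)
stepRows rs (q , t) with rowAt rs q (cur t)
... | nothing       = nothing
... | just (q′ , a) = just (q′ , act-on a t)

stepRows-just : ∀ rs q t {q′ a} → rowAt rs q (cur t) ≡ just (q′ , a) → stepRows rs (q , t) ≡ just (q′ , act-on a t)
stepRows-just rs q t e rewrite e = refl

stepRows-nothing : ∀ rs q t → rowAt rs q (cur t) ≡ nothing → stepRows rs (q , t) ≡ nothing
stepRows-nothing rs q t e rewrite e = refl

Placed : List Row → ℕ → List Row → Set
Placed rs o xs = Σ (List Row) λ ys → drop o rs ≡ xs ++ ys

drop-length-++ : ∀ {A : Set} (xs ys : List A) → drop (length xs) (xs ++ ys) ≡ ys
drop-length-++ []       ys = refl
drop-length-++ (x ∷ xs) ys = drop-length-++ xs ys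

placedˡ : ∀ rs o xs ys → Placed rs o (xs ++ ys) → Placed rs o xs
placedˡ rs o xs ys (zs , e) = ys ++ zs , trans e (++-assoc xs ys zs)

placedʳ : ∀ rs o xs ys n → length xs ≡ n → Placed rs o (xs ++ ys) → Placed rs (n + o) ys
placedʳ rs o xs ys _ refl (zs , e) = zs , (begin
  drop (length xs + o) rs           ≡⟨ cong (λ k → drop k rs) (+-comm (length xs) o) ⟩
  drop (o + length xs) rs           ≡⟨ LP.drop-drop o (length xs) rs ⟨
  drop (length xs) (drop o rs)      ≡⟨ cong (drop (length xs)) (trans e (++-assoc xs ys zs)) ⟩
  drop (length xs) (xs ++ ys ++ zs) ≡⟨ drop-length-++ xs (ys ++ zs) ⟩
  ys ++ zs                          ∎)
  where open ≡-Reasoning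

-- As tests are resolved lazily, a state is only known through its transition on the scanned symbol.
Starts : List Row → Row → ℕ → Tape → Set
Starts rs κ q t = rowAt rs q (cur t) ≡ κ (cur t)

-- Induction on the evaluation. A skipped program or a failed test takes no transition and keeps the
-- state `q`; what is preserved is only that the current row agrees with the continuation on the
-- scanned symbol.
compiled-runs : ∀ rs p o κ {t t′} → p / t ⇓ t′ → Placed rs o (rows p o κ) → ∀ q → Starts rs (entry p o κ) q t →
                ∃[ n ] ∃[ q′ ] Reach (stepRows rs) n (q , t) (q′ , t′) × Starts rs κ q′ t′
compiled-runs rs skip o κ ⇓skip pl q e = 0 , q , done , e
compiled-runs rs (act f) o κ {t} ⇓act (ys , d) q e =
  1 , o , next (stepRows-just rs q t e) done , cong (λ z → firstRow z (cur (act-on (f (cur t)) t))) d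
compiled-runs rs (p ⨾ r) o κ (⇓seq x y) pl q e
  with compiled-runs rs p o _ x (placedˡ rs o _ _ pl) q e
... | n , q′ , s , e′
  with compiled-runs rs r (size p + o) κ y (placedʳ rs o (rows p o _) _ _ (length-rows p o _) pl) q′ e′
... | m , q″ , s′ , e″ = n + m , q″ , reach-trans s s′ , e″
compiled-runs rs (ifs b p r) o κ {t} (⇓ifT c x) pl q e rewrite c =
  compiled-runs rs p o κ x (placedˡ rs o _ _ pl) q e
compiled-runs rs (ifs b p r) o κ {t} (⇓ifF c x) pl q e rewrite c =
  compiled-runs rs r (size p + o) κ x (placedʳ rs o (rows p o κ) _ _ (length-rows p o κ) pl) q e
compiled-runs rs (while b f p) o κ {t} (⇓stop c) pl q e rewrite c = 0 , q , done , e
compiled-runs rs (while b f p) o κ {t} (⇓again c x y) pl@(ys , d) q e rewrite c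
  with compiled-runs rs p (suc o) _ x (placedʳ rs o (_ ∷ []) _ 1 refl pl) o
         (cong (λ z → firstRow z (cur (act-on (f (cur t)) t))) d)
... | n , q′ , s , e′ with compiled-runs rs (while b f p) o κ y pl q′ e′
... | m , q″ , s′ , e″ = suc n + m , q″ , reach-trans (next (stepRows-just rs q t e) s) s′ , e″

-- The Turing machine of a list of rows

-- The machine has one state more than there are rows. The last state has no row and halts, so
-- sending every address beyond the list to it preserves behaviour.
clamp : ∀ n → ℕ → Fin (suc n)
clamp n q with q <? suc n
... | yes q<n = fromℕ< q<n
... | no _    = F.fromℕ n

rowAt-end : ∀ rs q → length rs ≤ q → rowAt rs q ≡ haltRow
rowAt-end []       zero    z≤n = refl
rowAt-end []       (suc q) z≤n = refl
rowAt-end (r ∷ rs) (suc q) (s≤s le) = rowAt-end rs q le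

rowAt-clamp : ∀ rs q → rowAt rs (toℕ (clamp (length rs) q)) ≡ rowAt rs q
rowAt-clamp rs q with q <? suc (length rs)
... | yes q<n = cong (rowAt rs) (toℕ-fromℕ< q<n)
... | no q≮n rewrite FP.toℕ-fromℕ (length rs) =
  trans (rowAt-end rs _ ≤-refl) (sym (rowAt-end rs q (≤-trans (NP.n≤1+n _) (NP.≮⇒≥ q≮n))))

clampState : ∀ n → Maybe (ℕ × Sym × Dir) → Maybe (Fin (suc n) × Sym × Dir)
clampState n nothing        = nothing
clampState n (just (q , a)) = just (clamp n q , a)

machine : List Row → TM
machine rs = record { nStates = length rs ; δ = λ q s → clampState (length rs) (rowAt rs (toℕ q) s) }

-- States are compared by their rows and not by their numbers, because clamping changes the numbers.
data SameConf (rs : List Row) : Config (length rs) → ℕ × Tape → Set where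
  same : ∀ {q q′ l s r} → rowAt rs (toℕ q) ≡ rowAt rs q′ → SameConf rs (conf q l s r) (q′ , ⟪ l , s , r ⟫)

sameConf-move : ∀ rs d {q l s r q′} → rowAt rs (toℕ q) ≡ rowAt rs q′ → SameConf rs (move d q l s r) (q′ , shift d l s r)
sameConf-move rs L {l = []}    e = same e
sameConf-move rs L {l = _ ∷ _} e = same e
sameConf-move rs R {r = []}    e = same e
sameConf-move rs R {r = _ ∷ _} e = same e

machine-fwd : ∀ rs {c x c′} → SameConf rs c x → step (machine rs) c ≡ just c′ →
              ∃[ x′ ] stepRows rs x ≡ just x′ × SameConf rs c′ x′
machine-fwd rs {conf q l s r} {q′ , _} (same e) h rewrite e with rowAt rs q′ s
machine-fwd rs {conf q l s r} {q′ , _} (same e) refl | just (q″ , s′ , d) =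
  _ , refl , sameConf-move rs d (rowAt-clamp rs q″)

machine-stop : ∀ rs {c x} → SameConf rs c x → step (machine rs) c ≡ nothing → stepRows rs x ≡ nothing
machine-stop rs {conf q l s r} {q′ , _} (same e) h rewrite e with rowAt rs q′ s
machine-stop rs {conf q l s r} {q′ , _} (same e) h | nothing = refl

rows-fwd : ∀ rs {x c x′} → SameConf rs c x → stepRows rs x ≡ just x′ →
           ∃[ c′ ] step (machine rs) c ≡ just c′ × SameConf rs c′ x′
rows-fwd rs {q′ , _} {conf q l s r} (same e) h rewrite e with rowAt rs q′ s
rows-fwd rs {q′ , _} {conf q l s r} (same e) refl | just (q″ , s′ , d) =
  _ , refl , sameConf-move rs d (rowAt-clamp rs q″)

rows-stop : ∀ rs {x c} → SameConf rs c x → stepRows rs x ≡ nothing → step (machine rs) c ≡ nothing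
rows-stop rs {q′ , _} {conf q l s r} (same e) h rewrite e with rowAt rs q′ s
rows-stop rs {q′ , _} {conf q l s r} (same e) h | nothing = refl

-- State 0 is an additional start state holding the entry row; the program proper is placed from
-- address 1 on.
compile : Prog → List Row
compile p = entry p 1 haltRow ∷ rows p 1 haltRow

compile-placed : ∀ p → Placed (compile p) 1 (rows p 1 haltRow)
compile-placed p = [] , sym (++-identityʳ _)

tapeConf : ∀ {k} → Tape → Config k
tapeConf ⟪ l , s , r ⟫ = conf F.zero l s r

confTape : ∀ {k} → Config k → Tape
confTape c = ⟪ left c , head c , right c ⟫

sameConf-tape : ∀ rs {c q t} → SameConf rs c (q , t) → confTape c ≡ t
sameConf-tape rs (same _) = refl

compile-halts : ∀ p {t t′} → p / t ⇓ t′ →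
                ∃[ n ] ∃[ c ] Reach (step (machine (compile p))) n (tapeConf t) c ×
                step (machine (compile p)) c ≡ nothing × confTape c ≡ t′
compile-halts p {t} {t′} x with compiled-runs (compile p) p 1 haltRow x (compile-placed p) 0 refl
... | n , q , s , e with simulate (stepRows (compile p)) (step (machine (compile p))) (λ x c → SameConf (compile p) c x)
                          (λ r → rows-fwd (compile p) r) (λ r → rows-stop (compile p) r)
                          {b = tapeConf t} (same refl) s
... | c , s′ , r = n , c , s′ , rows-stop (compile p) r (stepRows-nothing (compile p) q t′ e) ,
                      sameConf-tape (compile p) r

-- The converse of running a compiled program: a halting run of a machine with this loop yields the
-- round in which `final` was reached. Termination of the loop is not assumed; `round` only offers
-- one further round whenever `final` fails.
module _ {X : Set} (final : X → Set) (f : X → X) (Inv : X → Tape → Set) {b : Sym → Bool} {g : Sym → Sym × Dir} {body : Prog}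
         (round : ∀ x t → Inv x t → final x ⊎ (b (cur t) ≡ true × Σ Tape λ t′ → body / act-on (g (cur t)) t ⇓ t′ × Inv (f x) t′))
         (p r : Prog) where

  private
    rs : List Row
    rs = compile (p ⨾ while b g body ⨾ r)

    start : ℕ
    start = size p + 1

    κ κ′ : Row
    κ  = entry r (suc (size body) + start) haltRow
    κ′ = entry (while b g body) start κ

    while-placed : Placed rs start (entry body (suc start) κ′ ∷ rows body (suc start) κ′)
    while-placed = placedˡ rs start _ (rows r (suc (size body) + start) haltRow)
      (placedʳ rs 1 (rows p 1 κ′) _ (size p) (length-rows p 1 κ′) (compile-placed (p ⨾ while b g body ⨾ r)))

  -- A round takes at least one transition, so the number of remaining transitions decreases.
  rounds-terminate : ∀ fuel {n} x q t {c} → n ≤ fuel → Starts rs κ′ q t → Inv x t →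
                     Reach (stepRows rs) n (q , t) c → stepRows rs c ≡ nothing → ∃[ k ] final (iterate f x k)
  rounds-terminate fuel x q t le at-head inv w h with round x t inv
  ... | inj₁ done-here = 0 , done-here
  ... | inj₂ (one , t₁ , runs , inv₁)
    with compiled-runs rs body (suc start) κ′ runs (placedʳ rs start (_ ∷ []) _ 1 refl while-placed) start
           (cong (λ z → firstRow z (cur (act-on (g (cur t)) t))) (proj₂ while-placed))
  ... | m , q₁ , r₁ , starts
    with halting-suffix (next (stepRows-just rs q t (trans at-head (cong (λ z → if z then just (start , g (cur t)) else κ (cur t)) one))) r₁) w h
  rounds-terminate (suc fuel) x q t (s≤s le) at-head inv w h
    | inj₂ (one , t₁ , runs , inv₁) | m , q₁ , r₁ , starts | j , refl , r₂
    with rounds-terminate fuel (f x) q₁ t₁ (≤-trans (m≤n+m j m) le) starts inv₁ r₂ h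
  ... | k , e = suc k , e

  while-terminates : ∀ {x t₀ t₁} → p / t₀ ⇓ t₁ → Inv x t₁ → Halts (step (machine rs)) (tapeConf t₀) → ∃[ k ] final (iterate f x k)
  while-terminates {x} {t₀} {t₁} runs inv hs
    with simulate-halts (step (machine rs)) (stepRows rs) (SameConf rs) (machine-fwd rs) (machine-stop rs) {b = 0 , t₀} (same refl) hs
  ... | n , c , w , h with compiled-runs rs p 1 κ′ runs (placedˡ rs 1 (rows p 1 κ′) _ (compile-placed (p ⨾ while b g body ⨾ r))) 0 refl
  ... | m , q₁ , r₁ , starts with halting-suffix r₁ w h
  ... | j , _ , r₂ = rounds-terminate j x q₁ t₁ ≤-refl starts inv r₂ h

-- Letterwise substitution by a Turing machine

nonblank : Sym → Bool
nonblank nothing  = false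
nonblank (just _) = true

isOne : Sym → Bool
isOne (just true) = true
isOne _           = false

go : Dir → Prog
go d = act (λ s → s , d)

walk : Dir → Prog
walk d = while nonblank (λ s → s , d) skip

atʳ : List Sym → List Sym → Tape
atʳ l []      = ⟪ l , nothing , [] ⟫
atʳ l (x ∷ r) = ⟪ l , x , r ⟫

atˡ : List Sym → List Sym → Tape
atˡ []      r = ⟪ [] , nothing , r ⟫
atˡ (x ∷ l) r = ⟪ l , x , r ⟫

shiftR : ∀ l s r → shift R l s r ≡ atʳ (s ∷ l) r
shiftR l s []      = refl
shiftR l s (x ∷ r) = refl

shiftL : ∀ l s r → shift L l s r ≡ atˡ l (s ∷ r)
shiftL []      s r = refl
shiftL (x ∷ l) s r = refl

move-to : ∀ {f t t′} → act-on (f (cur t)) t ≡ t′ → act f / t ⇓ t′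
move-to refl = ⇓act

BlankFirst : List Sym → Set
BlankFirst y = cur (atʳ [] y) ≡ nothing

stop-walk : ∀ {d t} → cur t ≡ nothing → walk d / t ⇓ t
stop-walk e = ⇓stop (cong nonblank e)

cur-atʳ : ∀ l y → BlankFirst y → cur (atʳ l y) ≡ nothing
cur-atʳ l []      e = refl
cur-atʳ l (x ∷ y) e = e

walkR : ∀ xs l y → BlankFirst y → walk R / atʳ l (map just xs ++ y) ⇓ atʳ (map just xs ʳ++ l) y
walkR [] l y e = stop-walk (cur-atʳ l y e)
walkR (x ∷ xs) l y e = ⇓again refl ⇓skip
  (subst (walk R /_⇓ atʳ (map just xs ʳ++ (just x ∷ l)) y) (sym (shiftR l _ _)) (walkR xs (just x ∷ l) y e))

walkL : ∀ xs l r → walk L / atˡ (map just xs ++ nothing ∷ l) r ⇓ ⟪ l , nothing , map just xs ʳ++ r ⟫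
walkL [] l r = stop-walk refl
walkL (x ∷ xs) l r = ⇓again refl ⇓skip
  (subst (walk L /_⇓ ⟪ l , nothing , map just xs ʳ++ (just x ∷ r) ⟫) (sym (shiftL _ _ _)) (walkL xs l (just x ∷ r)))

emit : List Bool → Prog
emit []      = skip
emit (b ∷ w) = emit w ⨾ act (λ _ → just b , L)

emit-runs : ∀ w r → emit w / ⟪ [] , nothing , r ⟫ ⇓ ⟪ [] , nothing , map just w ++ r ⟫
emit-runs []      r = ⇓skip
emit-runs (b ∷ w) r = ⇓seq (emit-runs w r) ⇓act

rev-just : ∀ (ws : List Bool) (y : List Sym) → map just ws ʳ++ y ≡ map just (reverse ws) ++ y
rev-just ws y = trans (LP.ʳ++-defn (map just ws)) (cong (_++ y) (sym (LP.reverse-map just ws)))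

rev-just′ : ∀ (ws : List Bool) (y : List Sym) → map just (reverse ws) ʳ++ y ≡ map just ws ++ y
rev-just′ ws y = trans (rev-just (reverse ws) y) (cong (λ v → map just v ++ y) (LP.reverse-involutive ws))

-- The output out is built from right to left and stands left of the unread input, separated by a blank;
-- the unread input is consumed from its end and is given as its reversal ws.
atFree : List Bool → List Bool → List Sym → Tape
atFree out ws y = ⟪ [] , nothing , map just out ++ nothing ∷ (map just ws ʳ++ y) ⟫

atEnd : List Bool → List Bool → List Sym → Tape
atEnd out ws z = atˡ (map just ws ++ nothing ∷ (map just out ʳ++ nothing ∷ [])) (nothing ∷ z)

-- The path leads from the blank left of the output across the output, the separating blank and the
-- unread input, then back by one cell to the last unread letter. With no letter left, this cell is
-- the separator, and its blank ends the main loop.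
seek : Prog
seek = go R ⨾ walk R ⨾ go R ⨾ walk R ⨾ go L

seek-runs : ∀ out ws y → BlankFirst y → seek / atFree out ws y ⇓ atEnd out ws (drop 1 y)
seek-runs out ws y e rewrite rev-just ws y =
  ⇓seq (move-to (shiftR _ _ _))
  (⇓seq (walkR out _ _ refl)
  (⇓seq (move-to (shiftR _ _ _))
  (⇓seq (walkR (reverse ws) _ y e)
  (subst (λ l → go L / atʳ l y ⇓ atEnd out ws (drop 1 y)) (sym (rev-just′ ws _)) (move-to (last y e))))))
  where
  last : ∀ y {l} → BlankFirst y → act-on (cur (atʳ l y) , L) (atʳ l y) ≡ atˡ l (nothing ∷ drop 1 y)
  last []      e = shiftL _ _ _
  last (x ∷ y) refl = shiftL _ _ _

-- The scanned letter is erased, the unread input and the output are crossed to the left, and its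
-- image is put in front of the output. Working from the right end of the input keeps the images in
-- order.
substitute : List Bool → Prog
substitute u = act (λ _ → nothing , L) ⨾ walk L ⨾ go L ⨾ walk L ⨾ emit u ⨾ seek

substituteAll : (Bool → List Bool) → Prog
-- A loop has to open with an action; `go L` undoes the move to the right at once.
substituteAll f = while nonblank (λ s → s , R) (go L ⨾ ifs isOne (substitute (f true)) (substitute (f false)))

to-free : ∀ out ws z → walk L / atˡ (map just out ʳ++ nothing ∷ []) (nothing ∷ (map just ws ʳ++ z)) ⇓ atFree out ws z
to-free out ws z rewrite rev-just out (nothing ∷ []) =
  subst (λ r → walk L / atˡ (map just (reverse out) ++ nothing ∷ []) (nothing ∷ (map just ws ʳ++ z)) ⇓ ⟪ [] , nothing , r ⟫)
    (rev-just′ out _) (walkL (reverse out) [] _)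

substitute-runs : ∀ u b out ws z → substitute u / atEnd out (b ∷ ws) z ⇓ atEnd (u ++ out) ws (nothing ∷ z)
substitute-runs u b out ws z =
  ⇓seq (move-to (shiftL _ _ _))
  (⇓seq (walkL ws _ _)
  (⇓seq (move-to (shiftL _ _ _))
  (⇓seq (to-free out ws _)
  (⇓seq (emit-runs u _)
  (subst (λ r → seek / ⟪ [] , nothing , r ⟫ ⇓ atEnd (u ++ out) ws (nothing ∷ z)) (join u)
    (seek-runs (u ++ out) ws (nothing ∷ nothing ∷ z) refl))))))
  where
  join : ∀ u {r} → map just (u ++ out) ++ r ≡ map just u ++ map just out ++ r
  join u {r} = trans (cong (_++ r) (map-++ just u out)) (++-assoc (map just u) (map just out) r)

substituteAll-runs : ∀ f ws out z → ∃[ z′ ] substituteAll f / atEnd out ws z ⇓ atEnd (concatMap f (reverse ws) ++ out) [] z′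
substituteAll-runs f [] out z = z , ⇓stop refl
substituteAll-runs f (b ∷ ws) out z with substituteAll-runs f ws (f b ++ out) (nothing ∷ z)
... | z′ , loop = z′ , ⇓again refl (⇓seq ⇓act (body b)) (subst (λ o → substituteAll f / atEnd (f b ++ out) ws (nothing ∷ z) ⇓ atEnd o [] z′) eq loop)
  where
  body : ∀ b → ifs isOne (substitute (f true)) (substitute (f false)) / atEnd out (b ∷ ws) z ⇓ atEnd (f b ++ out) ws (nothing ∷ z)
  body true  = ⇓ifT refl (substitute-runs (f true) true out ws z)
  body false = ⇓ifF refl (substitute-runs (f false) false out ws z)
  eq : concatMap f (reverse ws) ++ f b ++ out ≡ concatMap f (reverse (b ∷ ws)) ++ out
  eq = begin
    concatMap f (reverse ws) ++ f b ++ out          ≡⟨ cong (λ v → concatMap f (reverse ws) ++ v ++ out) (sym (++-identityʳ (f b))) ⟩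
    concatMap f (reverse ws) ++ (f b ++ []) ++ out  ≡⟨ ++-assoc (concatMap f (reverse ws)) _ out ⟨
    (concatMap f (reverse ws) ++ concatMap f (b ∷ [])) ++ out ≡⟨ cong (_++ out) (LP.concatMap-++ f (reverse ws) (b ∷ [])) ⟨
    concatMap f (reverse ws ++ b ∷ []) ++ out       ≡⟨ cong (λ v → concatMap f v ++ out) (unfold-reverse b ws) ⟨
    concatMap f (reverse (b ∷ ws)) ++ out           ∎
    where open ≡-Reasoning

-- The two moves to the left provide the separator and a free cell. The output begins as `suf`,
-- grows leftwards and receives `pre` last, so the head can end on its first letter, where `output`
-- starts to read.
homomorphism : List Bool → (Bool → List Bool) → List Bool → Prog
homomorphism pre f suf = go L ⨾ go L ⨾ emit suf ⨾ seek ⨾ substituteAll f ⨾ go L ⨾ walk L ⨾ emit pre ⨾ go R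

inputTape : List Bool → Tape
inputTape w = atʳ [] (map just w)

homomorphism-runs : ∀ pre f suf w → ∃[ z ]
  homomorphism pre f suf / inputTape w ⇓ atʳ (nothing ∷ []) (map just (pre ++ concatMap f w ++ suf) ++ nothing ∷ z)
homomorphism-runs pre f suf w with padded w
  where
  padded : ∀ w → ∃[ y ] BlankFirst y × act-on (cur (inputTape w) , L) (inputTape w) ≡ ⟪ [] , nothing , map just w ++ y ⟫
  padded []      = nothing ∷ [] , refl , refl
  padded (b ∷ w) = [] , refl , cong (λ r → ⟪ [] , nothing , just b ∷ r ⟫) (sym (++-identityʳ (map just w)))
... | y , e , eq with substituteAll-runs f (reverse w) suf (drop 1 y)
... | z , loop rewrite LP.reverse-involutive w = nothing ∷ z ,
  ⇓seq (move-to eq)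
  (⇓seq ⇓act
  (⇓seq (emit-runs suf _)
  (⇓seq (subst (λ r → seek / ⟪ [] , nothing , map just suf ++ nothing ∷ r ⟫ ⇓ atEnd suf (reverse w) (drop 1 y)) (rev-just′ w y)
          (seek-runs suf (reverse w) y e))
  (⇓seq loop
  (⇓seq (move-to (shiftL _ _ _))
  (⇓seq (to-free out [] (nothing ∷ z))
  (⇓seq (emit-runs pre _)
  (move-to (trans (shiftR [] nothing (map just pre ++ map just out ++ nothing ∷ nothing ∷ z))
    (cong (atʳ (nothing ∷ [])) (trans (sym (++-assoc (map just pre) (map just out) _))
                           (cong (_++ nothing ∷ nothing ∷ z) (sym (map-++ just pre out))))))))))))))
  where out = concatMap f w ++ suf

readOut-just : ∀ v z → readOut (map just v ++ nothing ∷ z) ≡ v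
readOut-just []      z = refl
readOut-just (b ∷ v) z = cong (b ∷_) (readOut-just v z)

initConf-tape : ∀ {k} w → tapeConf {k} (inputTape w) ≡ initConf w
initConf-tape []      = refl
initConf-tape (b ∷ w) = refl

homTM : List Bool → (Bool → List Bool) → List Bool → TM
homTM pre f suf = machine (compile (homomorphism pre f suf))

output-atʳ : ∀ {k} (c : Config k) l r → confTape c ≡ atʳ l r → output c ≡ readOut r
output-atʳ (conf _ _ _ _) l []      refl = refl
output-atʳ (conf _ _ _ _) l (x ∷ r) refl = refl

homTM-computes : ∀ pre f suf w → HaltsWithOutput (homTM pre f suf) w (pre ++ concatMap f w ++ suf)
homTM-computes pre f suf w with homomorphism-runs pre f suf w
... | z , p with compile-halts (homomorphism pre f suf) p
... | n , c , r , h , t rewrite initConf-tape {nStates (homTM pre f suf)} w =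
  n , trans (cong (step (homTM pre f suf)) ran) h , trans (cong output ran) (trans (output-atʳ c _ _ t) (readOut-just _ z))
  where ran = run-reach (homTM pre f suf) r

-- Stack programs and their execution on a tape divided into tracks

upd : {X : Set} → (ℕ → X) → ℕ → X → ℕ → X
upd σ zero    x zero    = x
upd σ zero    x (suc j) = σ (suc j)
upd σ (suc i) x zero    = σ zero
upd σ (suc i) x (suc j) = upd (σ ∘ suc) i x j

upd-same : ∀ {X : Set} (σ : ℕ → X) i {x} → upd σ i x i ≡ x
upd-same σ zero    = refl
upd-same σ (suc i) = upd-same (σ ∘ suc) i

upd-other : ∀ {X : Set} (σ : ℕ → X) i {x} j → j ≢ i → upd σ i x j ≡ σ j
upd-other σ zero    zero    ne = ⊥-elim (ne refl)
upd-other σ zero    (suc j) ne = refl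
upd-other σ (suc i) zero    ne = refl
upd-other σ (suc i) (suc j) ne = upd-other (σ ∘ suc) i j (ne ∘ cong suc)

-- `loop i c d` pops one bit of stack `i` per round and runs `c` on 0 and `d` on 1 until the stack
-- is empty; `once` performs at most one such round.
data Cmd : Set where
  skipᶜ : Cmd
  push  : ℕ → Bool → Cmd
  _︔_   : Cmd → Cmd → Cmd
  loop  : ℕ → Cmd → Cmd → Cmd
  once  : ℕ → Cmd → Cmd → Cmd

infixr 5 _︔_

Stacks : Set
Stacks = ℕ → List Bool

branch : Bool → Cmd → Cmd → Cmd
branch b c₀ c₁ = if b then c₁ else c₀

infix 4 _⊢_⇒_

data _⊢_⇒_ : Cmd → Stacks → Stacks → Set where
  ⇒skip : ∀ {σ} → skipᶜ ⊢ σ ⇒ σ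
  ⇒push : ∀ {σ i b} → push i b ⊢ σ ⇒ upd σ i (b ∷ σ i)
  ⇒seq  : ∀ {c d σ τ υ} → c ⊢ σ ⇒ τ → d ⊢ τ ⇒ υ → (c ︔ d) ⊢ σ ⇒ υ
  ⇒stop : ∀ {c d σ i} → σ i ≡ [] → loop i c d ⊢ σ ⇒ σ
  ⇒pop  : ∀ {c d σ τ υ i b xs} → σ i ≡ b ∷ xs → branch b c d ⊢ upd σ i xs ⇒ τ → loop i c d ⊢ τ ⇒ υ → loop i c d ⊢ σ ⇒ υ
  ⇒none : ∀ {c d σ i} → σ i ≡ [] → once i c d ⊢ σ ⇒ σ
  ⇒once : ∀ {c d σ τ i b xs} → σ i ≡ b ∷ xs → branch b c d ⊢ upd σ i xs ⇒ τ → once i c d ⊢ σ ⇒ τ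
  -- Stacks are functions and are compared pointwise, so extensionality enters the semantics as a
  -- rule.
  ⇒conv : ∀ {c σ σ′ τ τ′} → σ ≗ σ′ → c ⊢ σ′ ⇒ τ′ → τ′ ≗ τ → c ⊢ σ ⇒ τ

Within : ℕ → Cmd → Set
Within K skipᶜ        = ⊤
Within K (push i b)   = i < K
Within K (c ︔ d)      = Within K c × Within K d
Within K (loop i c d) = i < K × Within K c × Within K d
Within K (once i c d) = i < K × Within K c × Within K d

stackBound : Cmd → ℕ
stackBound skipᶜ        = 0
stackBound (push i b)   = suc i
stackBound (c ︔ d)      = stackBound c ⊔ stackBound d
stackBound (loop i c d) = suc i ⊔ (stackBound c ⊔ stackBound d)
stackBound (once i c d) = suc i ⊔ (stackBound c ⊔ stackBound d)

within : ∀ c {K} → stackBound c ≤ K → Within K c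
within skipᶜ le = tt
within (push i b) le = le
within (c ︔ d) le = within c (≤-trans (m≤m⊔n _ _) le) , within d (≤-trans (m≤n⊔m (stackBound c) _) le)
within (loop i c d) le =
  ≤-trans (m≤m⊔n (suc i) (stackBound c ⊔ stackBound d)) le ,
  within c (≤-trans (≤-trans (m≤m⊔n (stackBound c) _) (m≤n⊔m (suc i) _)) le) ,
  within d (≤-trans (≤-trans (m≤n⊔m (stackBound c) _) (m≤n⊔m (suc i) _)) le)
within (once i c d) le =
  ≤-trans (m≤m⊔n (suc i) (stackBound c ⊔ stackBound d)) le ,
  within c (≤-trans (≤-trans (m≤m⊔n (stackBound c) _) (m≤n⊔m (suc i) _)) le) ,
  within d (≤-trans (≤-trans (m≤n⊔m (stackBound c) _) (m≤n⊔m (suc i) _)) le)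

nth : List Sym → ℕ → Sym
nth []       k       = nothing
nth (x ∷ xs) zero    = x
nth (x ∷ xs) (suc k) = nth xs k

-- The head stands at position p of a tape whose cells 0, 1, 2, … hold A; the cells left of 0 are arbitrary.
record Rep (t : Tape) (p : ℕ) (A : ℕ → Sym) : Set where
  constructor rep
  field
    cur≡ : cur t ≡ A p
    rgt≡ : ∀ k → nth (rgt t) k ≡ A (suc (k + p))
    lft≡ : ∀ k j → j + suc k ≡ p → nth (lft t) k ≡ A j
open Rep public

rep-R : ∀ {t p A} s → Rep t p A → Rep (act-on (s , R) t) (suc p) (upd A p s)
rep-R {⟪ l , c , r ⟫} {p} {A} s h = split r (rgt≡ h)
  where
  later : ∀ k → upd A p s (suc (k + p)) ≡ A (suc (k + p))
  later k = upd-other A p _ λ e → NP.1+n≰n (subst (suc p ≤_) e (s≤s (m≤n+m p k)))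
  left′ : ∀ k j → j + suc k ≡ suc p → nth (s ∷ l) k ≡ upd A p s j
  left′ zero j e with NP.suc-injective (trans (+-comm 1 j) e)
  ... | refl = sym (upd-same A p)
  left′ (suc k) j e = trans (lft≡ h k j e′) (sym (upd-other A p j λ { refl → NP.m+1+n≢m j e′ }))
    where e′ = NP.suc-injective (trans (sym (+-suc j (suc k))) e)
  split : ∀ r → (∀ k → nth r k ≡ A (suc (k + p))) → Rep (shift R l s r) (suc p) (upd A p s)
  split [] q = rep (trans (q 0) (sym (later 0)))
                (λ k → trans (q (suc k)) (trans (sym (later (suc k))) (cong (upd A p s) (cong suc (sym (+-suc k p)))))) left′
  split (x ∷ r) q = rep (trans (q 0) (sym (later 0)))
                (λ k → trans (q (suc k)) (trans (sym (later (suc k))) (cong (upd A p s) (cong suc (sym (+-suc k p)))))) left′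

rep-L : ∀ {t p A} s → Rep t (suc p) A → Rep (act-on (s , L) t) p (upd A (suc p) s)
rep-L {⟪ l , c , r ⟫} {p} {A} s h = split l (lft≡ h)
  where
  earlier : ∀ k j → j + suc k ≡ suc p → upd A (suc p) s j ≡ A j
  earlier k j e = upd-other A (suc p) j λ { refl → NP.m+1+n≢m j e }
  right′ : ∀ k → nth (s ∷ r) k ≡ upd A (suc p) s (suc (k + p))
  right′ zero = sym (upd-same A (suc p))
  right′ (suc k) = trans (rgt≡ h k) (trans (sym (upd-other A (suc p) _ λ e → NP.1+n≰n (subst (suc (suc p) ≤_) e (s≤s (m≤n+m (suc p) k)))))
                                           (cong (upd A (suc p) s) (cong suc (+-suc k p))))
  split : ∀ l → (∀ k j → j + suc k ≡ suc p → nth l k ≡ A j) → Rep (shift L l s r) p (upd A (suc p) s)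
  split [] q = rep (trans (q 0 p (+-comm p 1)) (sym (earlier 0 p (+-comm p 1)))) right′
    λ k j e → trans (q (suc k) j (trans (+-suc j _) (cong suc e))) (sym (earlier (suc k) j (trans (+-suc j _) (cong suc e))))
  split (x ∷ l) q = rep (trans (q 0 p (+-comm p 1)) (sym (earlier 0 p (+-comm p 1)))) right′
    λ k j e → trans (q (suc k) j (trans (+-suc j _) (cong suc e))) (sym (earlier (suc k) j (trans (+-suc j _) (cong suc e))))

rep-≗ : ∀ {t p A B} → Rep t p A → A ≗ B → Rep t p B
rep-≗ h e = rep (trans (cur≡ h) (e _)) (λ k → trans (rgt≡ h k) (e _)) (λ k j q → trans (lft≡ h k j q) (e _))

upd-id : ∀ {X : Set} (A : ℕ → X) p {x} → x ≡ A p → upd A p x ≗ A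
upd-id A zero    refl zero    = refl
upd-id A zero    refl (suc j) = refl
upd-id A (suc p) e    zero    = refl
upd-id A (suc p) e    (suc j) = upd-id (A ∘ suc) p e j

goR-rep : ∀ {t p A} → Rep t p A → Rep (act-on (cur t , R) t) (suc p) A
goR-rep h = rep-≗ (rep-R _ h) (upd-id _ _ (cur≡ h))

goL-rep : ∀ {t p A} → Rep t (suc p) A → Rep (act-on (cur t , L) t) p A
goL-rep h = rep-≗ (rep-L _ h) (upd-id _ _ (cur≡ h))

Run : Prog → Tape → (Tape → Set) → Set
Run p t Q = Σ Tape λ t′ → p / t ⇓ t′ × Q t′

infixl 4 _>>=_

_>>=_ : ∀ {p q t Q Q′} → Run p t Q → (∀ {t′} → Q t′ → Run q t′ Q′) → Run (p ⨾ q) t Q′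
(t′ , x , h) >>= k with k h
... | t″ , y , h′ = t″ , ⇓seq x y , h′

goes : Dir → ℕ → Prog
goes d zero    = skip
goes d (suc n) = go d ⨾ goes d n

goesR : ∀ n {t p p′ A} → p′ ≡ n + p → Rep t p A → Run (goes R n) t λ t′ → Rep t′ p′ A
goesR zero    refl h = _ , ⇓skip , h
goesR (suc n) refl h = (_ , ⇓act , goR-rep h) >>= goesR n (sym (+-suc n _))

goesL : ∀ n {t p p′ A} → p ≡ n + p′ → Rep t p A → Run (goes L n) t λ t′ → Rep t′ p′ A
goesL zero    refl h = _ , ⇓skip , h
goesL (suc n) refl h = (_ , ⇓act , goL-rep h) >>= goesL n refl

isOne-just : ∀ {s} → s ≡ just true → isOne s ≡ true
isOne-just refl = refl

writeR : ∀ s {t p A} → Rep t p A → Run (act (λ _ → s , R)) t λ t′ → Rep t′ (suc p) (upd A p s)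
writeR s h = _ , ⇓act , rep-R s h

writeL : ∀ s {t p A} → Rep t (suc p) A → Run (act (λ _ → s , L)) t λ t′ → Rep t′ p (upd A (suc p) s)
writeL s h = _ , ⇓act , rep-L s h

goR : ∀ {t p A} → Rep t p A → Run (go R) t λ t′ → Rep t′ (suc p) A
goR h = _ , ⇓act , goR-rep h

goL : ∀ {t p A} → Rep t (suc p) A → Run (go L) t λ t′ → Rep t′ p A
goL h = _ , ⇓act , goL-rep h

module _ (K : ℕ) where

  -- Block t occupies the cells o + t * blockSize for o < blockSize.  Cell 0 of a block is just true exactly in block 0;
  -- cells 1 + 2i and 2 + 2i of block t + 1 are the presence flag and the value of the entry of stack i at height t.
  blockWidth blockSize : ℕ
  blockWidth = K + K
  blockSize = suc blockWidth

  flag : ℕ → ℕ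
  flag i = suc (i + i)

  value<size : ∀ {i} → i < K → suc (flag i) < blockSize
  value<size {i} lt = s≤s (subst (_≤ K + K) (cong suc (+-suc i i)) (NP.+-mono-≤ lt lt))

  flag<size : ∀ {i} → i < K → flag i < blockSize
  flag<size lt = ≤-trans (NP.n≤1+n _) (value<size lt)

  -- The offset and the block number are remainder and quotient of the position by `blockSize`.
  cell-injective : ∀ o o′ t t′ → o < blockSize → o′ < blockSize → o + t * blockSize ≡ o′ + t′ * blockSize → o ≡ o′ × t ≡ t′
  cell-injective o o′ t t′ lt lt′ e with offsets
    where
    open import Data.Nat.DivMod using (_%_; [m+kn]%n≡m%n; m<n⇒m%n≡m)
    offsets : o ≡ o′
    offsets = trans (sym (trans ([m+kn]%n≡m%n o t blockSize) (m<n⇒m%n≡m lt)))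
                    (trans (cong (_% blockSize) e) (trans ([m+kn]%n≡m%n o′ t′ blockSize) (m<n⇒m%n≡m lt′)))
  ... | refl = refl , NP.*-cancelʳ-≡ t t′ blockSize (NP.+-cancelˡ-≡ o _ _ e)

  -- The head of the list is the top of the stack and lies in the highest occupied block. Block 0 is
  -- reserved for the home mark, whence the `suc`.
  Filled : (ℕ → Sym) → ℕ → List Bool → Set
  Filled A o []       = ⊤
  Filled A o (b ∷ xs) = A (o + suc (length xs) * blockSize) ≡ just true ×
                        A (suc o + suc (length xs) * blockSize) ≡ just b × Filled A o xs

  -- A free flag is only required to differ from `just true`: the initial tape fills free flags with
  -- 0, popping leaves blanks, and cells never visited are blank as well.
  record Column (A : ℕ → Sym) (o : ℕ) (xs : List Bool) : Set where
    constructor column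
    field
      filled : Filled A o xs
      free   : ∀ t → length xs ≤ t → isOne (A (o + suc t * blockSize)) ≡ false
  open Column

  record Tracks (σ : Stacks) (A : ℕ → Sym) : Set where
    constructor tracks
    field
      home  : A 0 ≡ just true
      marks : ∀ t → isOne (A (suc t * blockSize)) ≡ false
      cols  : ∀ i → i < K → Column A (flag i) (σ i)
  open Tracks

  filled-present : ∀ {A} o xs {t} → Filled A o xs → t < length xs → A (o + suc t * blockSize) ≡ just true
  filled-present o (b ∷ xs) {t} (p , _ , f) (s≤s le) with t ≟ length xs
  ... | yes refl = p
  ... | no ne = filled-present o xs f (NP.≤∧≢⇒< le ne)

  filled-cong : ∀ {A B} o xs → (∀ t → t < length xs → B (o + suc t * blockSize) ≡ A (o + suc t * blockSize)) →
                (∀ t → t < length xs → B (suc o + suc t * blockSize) ≡ A (suc o + suc t * blockSize)) → Filled A o xs → Filled B o xs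
  filled-cong o [] p q f = tt
  filled-cong o (b ∷ xs) p q (x , y , f) =
    trans (p _ ≤-refl) x , trans (q _ ≤-refl) y ,
    filled-cong o xs (λ t lt → p t (≤-trans lt (NP.n≤1+n _))) (λ t lt → q t (≤-trans lt (NP.n≤1+n _))) f

  column-cong : ∀ {A B} o {xs} → (∀ t → B (o + suc t * blockSize) ≡ A (o + suc t * blockSize)) →
                (∀ t → B (suc o + suc t * blockSize) ≡ A (suc o + suc t * blockSize)) → Column A o xs → Column B o xs
  column-cong o {xs} p q (column f g) =
    column (filled-cong o xs (λ t _ → p t) (λ t _ → q t) f) (λ t le → trans (cong isOne (p t)) (g t le))

  tracks-≗ : ∀ {σ τ A} → σ ≗ τ → Tracks σ A → Tracks τ A
  tracks-≗ e (tracks h m c) = tracks h m (λ i lt → subst (Column _ (flag i)) (e i) (c i lt))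

  upd-cell : ∀ (A : ℕ → Sym) o t o′ t′ x → o < blockSize → o′ < blockSize → (o′ ≡ o → t′ ≡ t → ⊥) →
             upd A (o + t * blockSize) x (o′ + t′ * blockSize) ≡ A (o′ + t′ * blockSize)
  upd-cell A o t o′ t′ x lt lt′ ne = upd-other A _ _ λ e → let (a , b) = cell-injective o′ o t′ t lt′ lt e in ne a b

  zero<size : 0 < blockSize
  zero<size = s≤s z≤n

  even≢odd : ∀ i j → i + i ≢ suc (j + j)
  even≢odd (suc i) zero e = case trans (sym (+-suc i i)) (NP.suc-injective e) of λ ()
  even≢odd (suc i) (suc j) e = even≢odd i j
    (NP.suc-injective (NP.suc-injective (trans (cong suc (sym (+-suc i i))) (trans e (cong suc (cong suc (+-suc j j)))))))

  double-injective : ∀ i j → i + i ≡ j + j → i ≡ j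
  double-injective zero zero e = refl
  double-injective (suc i) (suc j) e = cong suc (double-injective i j
    (NP.suc-injective (NP.suc-injective (trans (cong suc (sym (+-suc i i))) (trans e (cong suc (+-suc j j)))))))

  flag≢flag : ∀ {i j} → j ≢ i → flag j ≢ flag i
  flag≢flag ne e = ne (double-injective _ _ (NP.suc-injective e))

  other-column : ∀ {A i j n xs x} → i < K → j < K → j ≢ i → Column A (flag j) xs →
                 Column (upd A (flag i + n * blockSize) x) (flag j) xs
  other-column {A} {i} {j} {n} {x = x} i<K j<K ne =
    column-cong (flag j) (λ t → upd-cell A (flag i) n (flag j) (suc t) x (flag<size i<K) (flag<size j<K) (λ e _ → flag≢flag ne e))
                (λ t → upd-cell A (flag i) n (suc (flag j)) (suc t) x (flag<size i<K) (value<size j<K) (λ e _ → even≢odd i j (sym (NP.suc-injective e))))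

  other-column′ : ∀ {A i j n xs x} → i < K → j < K → j ≢ i → Column A (flag j) xs →
                  Column (upd A (suc (flag i) + n * blockSize) x) (flag j) xs
  other-column′ {A} {i} {j} {n} {x = x} i<K j<K ne =
    column-cong (flag j) (λ t → upd-cell A (suc (flag i)) n (flag j) (suc t) x (value<size i<K) (flag<size j<K) (λ e _ → even≢odd j i (NP.suc-injective e)))
                (λ t → upd-cell A (suc (flag i)) n (suc (flag j)) (suc t) x (value<size i<K) (value<size j<K) (λ e _ → flag≢flag ne (NP.suc-injective e)))

  tracks-push : ∀ {σ A i} b → i < K → Tracks σ A → let p = flag i + suc (length (σ i)) * blockSize in
                Tracks (upd σ i (b ∷ σ i)) (upd (upd A p (just true)) (suc p) (just b))
  tracks-push {σ} {A} {i} b i<K (tracks h m c) = tracks h marks′ cols′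
    where
    n : ℕ
    n = length (σ i)
    A₁ A₂ : ℕ → Sym
    A₁ = upd A (flag i + suc n * blockSize) (just true)
    A₂ = upd A₁ (suc (flag i) + suc n * blockSize) (just b)
    marks′ : ∀ t → isOne (A₂ (suc t * blockSize)) ≡ false
    marks′ t = trans (cong isOne (trans (upd-cell A₁ (suc (flag i)) (suc n) 0 (suc t) (just b) (value<size i<K) zero<size λ ())
                                        (upd-cell A (flag i) (suc n) 0 (suc t) (just true) (flag<size i<K) zero<size λ ()))) (m t)
    same-flag : ∀ t → t ≢ n → A₂ (flag i + suc t * blockSize) ≡ A (flag i + suc t * blockSize)
    same-flag t ne = trans (upd-cell A₁ (suc (flag i)) (suc n) (flag i) (suc t) (just b) (value<size i<K) (flag<size i<K) (λ e _ → NP.1+n≢n (sym e)))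
                           (upd-cell A (flag i) (suc n) (flag i) (suc t) (just true) (flag<size i<K) (flag<size i<K) (λ _ e → ne (NP.suc-injective e)))
    same-value : ∀ t → t ≢ n → A₂ (suc (flag i) + suc t * blockSize) ≡ A (suc (flag i) + suc t * blockSize)
    same-value t ne = trans (upd-cell A₁ (suc (flag i)) (suc n) (suc (flag i)) (suc t) (just b) (value<size i<K) (value<size i<K) (λ _ e → ne (NP.suc-injective e)))
                            (upd-cell A (flag i) (suc n) (suc (flag i)) (suc t) (just true) (flag<size i<K) (value<size i<K) (λ e _ → NP.1+n≢n e))
    own : Column A₂ (flag i) (b ∷ σ i)
    own = column
      (trans (upd-cell A₁ (suc (flag i)) (suc n) (flag i) (suc n) (just b) (value<size i<K) (flag<size i<K) (λ e _ → NP.1+n≢n (sym e))) (upd-same A (flag i + suc n * blockSize)) ,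
       upd-same A₁ (suc (flag i) + suc n * blockSize) ,
       filled-cong (flag i) (σ i) (λ t lt → same-flag t (NP.<⇒≢ lt)) (λ t lt → same-value t (NP.<⇒≢ lt)) (filled (c i i<K)))
      (λ t le → trans (cong isOne (same-flag t (λ e → NP.<⇒≢ le (sym e)))) (free (c i i<K) t (≤-trans (NP.n≤1+n _) le)))
    cols′ : ∀ j → j < K → Column A₂ (flag j) (upd σ i (b ∷ σ i) j)
    cols′ j j<K with j ≟ i
    ... | yes refl rewrite upd-same σ i {b ∷ σ i} = own
    ... | no ne rewrite upd-other σ i {b ∷ σ i} j ne = other-column′ {n = suc n} i<K j<K ne (other-column {n = suc n} i<K j<K ne (c j j<K))

  -- Clearing the flag is enough. The value bit stays behind and is overwritten by the next push to
  -- this height.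
  tracks-pop : ∀ {σ A i b xs} → i < K → σ i ≡ b ∷ xs → Tracks σ A →
               Tracks (upd σ i xs) (upd A (flag i + suc (length xs) * blockSize) nothing)
  tracks-pop {σ} {A} {i} {b} {xs} i<K eq (tracks h m c) = tracks h marks′ cols′
    where
    n : ℕ
    n = length xs
    A₁ : ℕ → Sym
    A₁ = upd A (flag i + suc n * blockSize) nothing
    marks′ : ∀ t → isOne (A₁ (suc t * blockSize)) ≡ false
    marks′ t = trans (cong isOne (upd-cell A (flag i) (suc n) 0 (suc t) nothing (flag<size i<K) zero<size λ ())) (m t)
    same-flag : ∀ t → t ≢ n → A₁ (flag i + suc t * blockSize) ≡ A (flag i + suc t * blockSize)
    same-flag t ne = upd-cell A (flag i) (suc n) (flag i) (suc t) nothing (flag<size i<K) (flag<size i<K) (λ _ e → ne (NP.suc-injective e))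
    same-value : ∀ t → A₁ (suc (flag i) + suc t * blockSize) ≡ A (suc (flag i) + suc t * blockSize)
    same-value t = upd-cell A (flag i) (suc n) (suc (flag i)) (suc t) nothing (flag<size i<K) (value<size i<K) (λ e _ → NP.1+n≢n e)
    old : Column A (flag i) (b ∷ xs)
    old = subst (Column A (flag i)) eq (c i i<K)
    free′ : ∀ t → n ≤ t → isOne (A₁ (flag i + suc t * blockSize)) ≡ false
    free′ t le with t ≟ n
    ... | yes refl = cong isOne (upd-same A (flag i + suc n * blockSize))
    ... | no ne = trans (cong isOne (same-flag t ne)) (free old t (NP.≤∧≢⇒< le (ne ∘ sym)))
    own : Column A₁ (flag i) xs
    own = column (filled-cong (flag i) xs (λ t lt → same-flag t (NP.<⇒≢ lt)) (λ t _ → same-value t) (proj₂ (proj₂ (filled old)))) free′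
    cols′ : ∀ j → j < K → Column A₁ (flag j) (upd σ i xs j)
    cols′ j j<K with j ≟ i
    ... | yes refl rewrite upd-same σ i {xs} = own
    ... | no ne rewrite upd-other σ i {xs} j ne = other-column {n = suc n} i<K j<K ne (c j j<K)

  At : ℕ → Stacks → Tape → Set
  At p σ t = Σ (ℕ → Sym) λ A → Rep t p A × Tracks σ A

  -- A round moves by exactly one block: one cell by the action of the loop and `blockWidth` cells
  -- by its body. Climbing is steered by the flags of one stack, returning by the home mark in cell
  -- 0.
  climb : Prog
  climb = while isOne (λ s → s , R) (goes R blockWidth)

  return : Prog
  return = while (not ∘ isOne) (λ s → s , L) (goes L blockWidth)

  next-block : ∀ o t → o + suc t * blockSize ≡ blockWidth + suc (o + t * blockSize)
  next-block o t = begin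
    o + (blockSize + t * blockSize)         ≡⟨ NP.+-assoc o blockSize _ ⟨
    o + blockSize + t * blockSize           ≡⟨ cong (_+ t * blockSize) (trans (+-comm o blockSize) (sym (+-suc blockWidth o))) ⟩
    blockWidth + suc o + t * blockSize      ≡⟨ NP.+-assoc blockWidth (suc o) _ ⟩
    blockWidth + suc (o + t * blockSize)    ∎
    where open ≡-Reasoning

  climbs : ∀ o xs {A} d n {t} → n + d ≡ length xs → Column A o xs → Rep t (o + suc n * blockSize) A →
           Run climb t λ t′ → Rep t′ (o + suc (length xs) * blockSize) A
  climbs o xs zero n {t} e c h with trans (sym (+-identityʳ n)) e
  ... | refl = t , ⇓stop (trans (cong isOne (cur≡ h)) (free c n ≤-refl)) , h
  climbs o xs (suc d) n e c h with goesR blockWidth (next-block o (suc n)) (goR-rep h)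
  ... | t₁ , x , h₁ with climbs o xs d (suc n) (trans (sym (+-suc n d)) e) c h₁
  ... | t₂ , y , h₂ = t₂ , ⇓again (isOne-just (trans (cur≡ h) (filled-present o xs (filled c) lt))) x y , h₂
    where lt = subst (n <_) e (NP.m<m+n n (s≤s z≤n))

  returns : ∀ {σ A} n {t} → Tracks σ A → Rep t (n * blockSize) A → Run return t (At 0 σ)
  returns zero {t} tr h = t , ⇓stop (cong (not ∘ isOne) (trans (cur≡ h) (home tr))) , (_ , h , tr)
  returns (suc n) tr h with goesL blockWidth refl (goL-rep h)
  ... | t₁ , x , h₁ with returns n tr h₁
  ... | t₂ , y , h₂ = t₂ , ⇓again (trans (cong (not ∘ isOne) (cur≡ h)) (cong not (marks tr n))) x y , h₂

  toStack : ℕ → Prog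
  toStack i = goes R (flag i + blockSize)

  bottom : ℕ → ℕ
  bottom i = flag i + 1 * blockSize

  goes-toStack : ∀ i {σ t} → At 0 σ t → Run (toStack i) t (At (bottom i) σ)
  goes-toStack i (A , h , tr)
    with goesR (flag i + blockSize) (trans (cong (flag i +_) (NP.*-identityˡ blockSize)) (sym (+-identityʳ _))) h
  ... | t′ , x , h′ = t′ , x , (A , h′ , tr)

  pushProg : ℕ → Bool → Prog
  pushProg i b = toStack i ⨾ climb ⨾ act (λ _ → just true , R) ⨾ act (λ _ → just b , L) ⨾ goes L (flag i) ⨾ return

  pushes : ∀ {σ t} i b → i < K → At 0 σ t → Run (pushProg i b) t (At 0 (upd σ i (b ∷ σ i)))
  pushes {σ} i b i<K at = goes-toStack i at >>= λ { (A , h , tr) →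
    climbs (flag i) (σ i) (length (σ i)) 0 refl (cols tr i i<K) h >>= λ h₁ →
    writeR (just true) h₁ >>= λ h₂ →
    writeL (just b) h₂ >>= λ h₃ →
    goesL (flag i) refl h₃ >>= λ h₄ →
    returns (suc (length (σ i))) (tracks-push b i<K tr) h₄ }

  popped : ℕ → Prog → Prog
  popped i c = go L ⨾ act (λ _ → nothing , L) ⨾ goes L (i + i) ⨾ return ⨾ c ⨾ toStack i

  -- The flag in block 1 has been tested and left by one cell, so climbing begins in block 2. It
  -- stops one block above the top entry, whose value is reached by one block down and one cell to
  -- the right.
  loopBody : ℕ → Prog → Prog → Prog
  loopBody i c d = goes R blockWidth ⨾ climb ⨾ goes L blockSize ⨾ go R ⨾ ifs isOne (popped i d) (popped i c)

  loopProg : ℕ → Prog → Prog → Prog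
  loopProg i c d = while isOne (λ s → s , R) (loopBody i c d)

  popped-runs : ∀ {σ τ t i b xs A} c → i < K → σ i ≡ b ∷ xs → Tracks σ A → Rep t (suc (flag i) + suc (length xs) * blockSize) A →
                (∀ {t₁} → At 0 (upd σ i xs) t₁ → Run c t₁ (At 0 τ)) → Run (popped i c) t (At (bottom i) τ)
  popped-runs {i = i} {xs = xs} c i<K eq tr h k =
    goL h >>= λ h₁ →
    writeL nothing h₁ >>= λ h₂ →
    goesL (i + i) refl h₂ >>= λ h₃ →
    returns (suc (length xs)) (tracks-pop i<K eq tr) h₃ >>= λ at →
    k at >>= goes-toStack i

  nonempty-flag : ∀ {σ t i b xs} → i < K → σ i ≡ b ∷ xs → At (bottom i) σ t → isOne (cur t) ≡ true
  nonempty-flag {i = i} {b} {xs} i<K eq (A , h , tr) =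
    isOne-just (trans (cur≡ h) (filled-present (flag i) (b ∷ xs) (filled (subst (Column A (flag i)) eq (cols tr i i<K))) (s≤s z≤n)))

  empty-flag : ∀ {σ t i} → i < K → σ i ≡ [] → At (bottom i) σ t → isOne (cur t) ≡ false
  empty-flag {i = i} i<K eq (A , h , tr) =
    trans (cong isOne (cur≡ h)) (free (subst (Column A (flag i)) eq (cols tr i i<K)) 0 z≤n)

  loopBody-runs : ∀ {σ τ t i b xs} c d → i < K → σ i ≡ b ∷ xs → At (bottom i) σ t →
                  (∀ {t₁} → At 0 (upd σ i xs) t₁ → Run (if b then d else c) t₁ (At 0 τ)) →
                  Run (loopBody i c d) (act-on (cur t , R) t) (At (bottom i) τ)
  loopBody-runs {σ} {τ} {t} {i} {b} {xs} c d i<K eq (A , h , tr) k =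
    goesR blockWidth (next-block (flag i) 1) (goR-rep h) >>= λ h₁ →
    climbs (flag i) (b ∷ xs) (length xs) 1 refl col h₁ >>= λ h₂ →
    goesL blockSize (next-block′ (length xs)) h₂ >>= λ h₃ →
    goR h₃ >>= λ h₄ → choose b k (proj₁ (proj₂ (filled col))) eq h₄
    where
    col : Column A (flag i) (b ∷ xs)
    col = subst (Column A (flag i)) eq (cols tr i i<K)
    next-block′ : ∀ n → flag i + suc (suc n) * blockSize ≡ blockSize + (flag i + suc n * blockSize)
    next-block′ n = trans (next-block (flag i) (suc n)) (+-suc blockWidth _)
    choose : ∀ b → (∀ {t₁} → At 0 (upd σ i xs) t₁ → Run (if b then d else c) t₁ (At 0 τ)) →
             A (suc (flag i) + suc (length xs) * blockSize) ≡ just b → σ i ≡ b ∷ xs →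
             ∀ {t₁} → Rep t₁ (suc (flag i) + suc (length xs) * blockSize) A →
             Run (ifs isOne (popped i d) (popped i c)) t₁ (At (bottom i) τ)
    choose true k v eq h₁ = let (t₂ , x , at) = popped-runs d i<K eq tr h₁ k in
      t₂ , ⇓ifT (cong isOne (trans (cur≡ h₁) v)) x , at
    choose false k v eq h₁ = let (t₂ , x , at) = popped-runs c i<K eq tr h₁ k in
      t₂ , ⇓ifF (cong isOne (trans (cur≡ h₁) v)) x , at

  fromStack : ℕ → Prog
  fromStack i = goes L (flag i) ⨾ return

  goes-fromStack : ∀ i {σ t} → At (bottom i) σ t → Run (fromStack i) t (At 0 σ)
  goes-fromStack i (A , h , tr) = goesL (flag i) refl h >>= returns 1 tr

  prog : Cmd → Prog
  prog skipᶜ        = skip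
  prog (push i b)   = pushProg i b
  prog (c ︔ d)      = prog c ⨾ prog d
  prog (loop i c d) = toStack i ⨾ loopProg i (prog c) (prog d) ⨾ fromStack i
  -- `loopBody` expects the head one cell to the right of the bottom flag; here `go R` replaces the
  -- action of the loop.
  prog (once i c d) = toStack i ⨾ ifs isOne (go R ⨾ loopBody i (prog c) (prog d)) skip ⨾ fromStack i

  prog-branch : ∀ b c d {t Q} → Run (prog (branch b c d)) t Q → Run (if b then prog d else prog c) t Q
  prog-branch true  c d r = r
  prog-branch false c d r = r

  within-branch : ∀ b {c d} → Within K c → Within K d → Within K (branch b c d)
  within-branch true  w w′ = w′
  within-branch false w w′ = w

  prog-runs : ∀ {c σ τ t} → Within K c → c ⊢ σ ⇒ τ → At 0 σ t → Run (prog c) t (At 0 τ)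
  -- Between the rounds of a loop the head rests on the bottom flag of its stack and not at home, so
  -- the rounds need a statement of their own.
  loop-runs : ∀ {i c d σ τ t} → Within K (loop i c d) → loop i c d ⊢ σ ⇒ τ → At (bottom i) σ t →
              Run (loopProg i (prog c) (prog d)) t (At (bottom i) τ)

  prog-runs w ⇒skip at = _ , ⇓skip , at
  prog-runs w (⇒push {i = i} {b}) at = pushes i b w at
  prog-runs (w , w′) (⇒seq x y) at = prog-runs w x at >>= prog-runs w′ y
  prog-runs w (⇒conv e x e′) (A , h , tr) with prog-runs w x (A , h , tracks-≗ e tr)
  ... | t′ , r , (A′ , h′ , tr′) = t′ , r , (A′ , h′ , tracks-≗ e′ tr′)
  prog-runs {loop i c d} w x@(⇒stop _) at = goes-toStack i at >>= λ at₁ → loop-runs w x at₁ >>= goes-fromStack i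
  prog-runs {loop i c d} w x@(⇒pop _ _ _) at = goes-toStack i at >>= λ at₁ → loop-runs w x at₁ >>= goes-fromStack i

  prog-runs {once i c d} (i<K , w) (⇒none e) at = goes-toStack i at >>= λ at₁ →
    (_ , ⇓ifF (empty-flag i<K e at₁) ⇓skip , at₁) >>= goes-fromStack i
  prog-runs {once i c d} (i<K , w , w′) (⇒once {b = b} e x) at = goes-toStack i at >>= λ at₁ →
    (let (t₂ , r , at₂) = loopBody-runs (prog c) (prog d) i<K e at₁ (λ at → prog-branch b c d (prog-runs (within-branch b w w′) x at))
     in t₂ , ⇓ifT (nonempty-flag i<K e at₁) (⇓seq ⇓act r) , at₂) >>= goes-fromStack i

  loop-runs (i<K , w) (⇒stop e) at = _ , ⇓stop (empty-flag i<K e at) , at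
  loop-runs {i} {c} {d} (i<K , w , w′) (⇒pop {b = b} e x y) at =
    let (t₁ , r , at₁) = loopBody-runs (prog c) (prog d) i<K e at (λ at₁ → prog-branch b c d (prog-runs (within-branch b w w′) x at₁))
        (t₂ , s , at₂) = loop-runs {c = c} {d} (i<K , w , w′) y at₁
    in t₂ , ⇓again (nonempty-flag i<K e at) r s , at₂
  loop-runs w (⇒conv e x e′) (A , h , tr) with loop-runs w x (A , h , tracks-≗ e tr)
  ... | t′ , r , (A′ , h′ , tr′) = t′ , r , (A′ , h′ , tracks-≗ e′ tr′)

-- A functional language on binary trees, compiled to stack programs

data Tree : Set where
  leaf : Tree
  node : Tree → Tree → Tree

Env : ℕ → Set
Env n = Fin n → Tree

infixr 5 _◂_

_◂_ : ∀ {n} {X : Set} → X → (Fin n → X) → Fin (suc n) → X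
(x ◂ ρ) F.zero    = x
(x ◂ ρ) (F.suc i) = ρ i

-- Under a binder the new variables come first: head and tail in caseᵗ, element and accumulator in foldᵗ
-- (a left fold along the right spine of a tree read as a list).
data Tm : ℕ → Set where
  var   : ∀ {n} → Fin n → Tm n
  leafᵗ : ∀ {n} → Tm n
  nodeᵗ : ∀ {n} → Tm n → Tm n → Tm n
  caseᵗ : ∀ {n} → Tm n → Tm n → Tm (suc (suc n)) → Tm n
  foldᵗ : ∀ {n} → Tm n → Tm n → Tm (suc (suc n)) → Tm n
  letᵗ  : ∀ {n} → Tm n → Tm (suc n) → Tm n
  ren   : ∀ {k n} → Tm k → (Fin k → Fin n) → Tm n

caseT : {X : Set} → Tree → X → (Tree → Tree → X) → X
caseT leaf       x f = x
caseT (node a b) x f = f a b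

foldT : (Tree → Tree → Tree) → Tree → Tree → Tree
foldT s acc leaf       = acc
foldT s acc (node a b) = foldT s (s a acc) b

-- Folds are the only recursion, so every term denotes a total function.
eval : ∀ {n} → Tm n → Env n → Tree
eval (var i)       ρ = ρ i
eval leafᵗ         ρ = leaf
eval (nodeᵗ e f)   ρ = node (eval e ρ) (eval f ρ)
eval (caseᵗ e f g) ρ = caseT (eval e ρ) (eval f ρ) (λ a b → eval g (a ◂ b ◂ ρ))
eval (foldᵗ l i s) ρ = foldT (λ x acc → eval s (x ◂ acc ◂ ρ)) (eval i ρ) (eval l ρ)
eval (letᵗ e f)    ρ = eval f (eval e ρ ◂ ρ)
eval (ren e r)     ρ = eval e (ρ ∘ r)

-- Preorder code. It is prefix-free: the end of a tree is found by counting the subtrees still open.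
ser : Tree → List Bool
ser leaf       = false ∷ []
ser (node a b) = true ∷ ser a ++ ser b

-- Stack states with a base ρ below level g and an explicit list of stacks from level g on

nthW : List (List Bool) → ℕ → List Bool
nthW []       j       = []
nthW (x ∷ xs) zero    = x
nthW (x ∷ xs) (suc j) = nthW xs j

setW : List (List Bool) → ℕ → List Bool → List (List Bool)
setW []       zero    v = v ∷ []
setW []       (suc i) v = [] ∷ setW [] i v
setW (x ∷ xs) zero    v = v ∷ xs
setW (x ∷ xs) (suc i) v = x ∷ setW xs i v

st : Stacks → ℕ → List (List Bool) → Stacks
st ρ zero    xs j       = nthW xs j
st ρ (suc g) xs zero    = ρ zero
st ρ (suc g) xs (suc j) = st (ρ ∘ suc) g xs j

nthW-set : ∀ xs i v → upd (nthW xs) i v ≗ nthW (setW xs i v)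
nthW-set []       zero    v zero    = refl
nthW-set []       zero    v (suc j) = refl
nthW-set []       (suc i) v zero    = refl
nthW-set []       (suc i) v (suc j) = nthW-set [] i v j
nthW-set (x ∷ xs) zero    v zero    = refl
nthW-set (x ∷ xs) zero    v (suc j) = refl
nthW-set (x ∷ xs) (suc i) v zero    = refl
nthW-set (x ∷ xs) (suc i) v (suc j) = nthW-set xs i v j

st-at : ∀ ρ g xs i → st ρ g xs (g + i) ≡ nthW xs i
st-at ρ zero    xs i = refl
st-at ρ (suc g) xs i = st-at (ρ ∘ suc) g xs i

st-below : ∀ ρ g xs {j} → j < g → st ρ g xs j ≡ ρ j
st-below ρ (suc g) xs {zero}  lt       = refl
st-below ρ (suc g) xs {suc j} (s≤s lt) = st-below (ρ ∘ suc) g xs lt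

st-set : ∀ ρ g xs i v → upd (st ρ g xs) (g + i) v ≗ st ρ g (setW xs i v)
st-set ρ zero    xs i v j       = nthW-set xs i v j
st-set ρ (suc g) xs i v zero    = refl
st-set ρ (suc g) xs i v (suc j) = st-set (ρ ∘ suc) g xs i v j

st-cong : ∀ ρ g {xs ys} → nthW xs ≗ nthW ys → st ρ g xs ≗ st ρ g ys
st-cong ρ zero    e j       = e j
st-cong ρ (suc g) e zero    = refl
st-cong ρ (suc g) e (suc j) = st-cong (ρ ∘ suc) g e j

st-shift : ∀ ρ g xs ys → st (st ρ g xs) (g + length xs) ys ≗ st ρ g (xs ++ ys)
st-shift ρ (suc g) xs ys zero    = refl
st-shift ρ (suc g) xs ys (suc j) = st-shift (ρ ∘ suc) g xs ys j
st-shift ρ zero xs ys = go-on xs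
  where
  go-on : ∀ xs → st (nthW xs) (length xs) ys ≗ nthW (xs ++ ys)
  go-on []       j       = refl
  go-on (x ∷ xs) zero    = refl
  go-on (x ∷ xs) (suc j) = go-on xs j

≗-sym : ∀ {σ τ : Stacks} → σ ≗ τ → τ ≗ σ
≗-sym e j = sym (e j)

conv-to : ∀ {c σ τ τ′} → c ⊢ σ ⇒ τ′ → τ′ ≗ τ → c ⊢ σ ⇒ τ
conv-to x e = ⇒conv (λ _ → refl) x e

conv-from : ∀ {c σ σ′ τ} → σ ≗ σ′ → c ⊢ σ′ ⇒ τ → c ⊢ σ ⇒ τ
conv-from e x = ⇒conv e x (λ _ → refl)

-- A frame rule: for a command working from level `g + length xs` on, the stacks `xs` become part of
-- the untouched base.
shifted : ∀ {c} ρ g xs {ys zs} → c ⊢ st (st ρ g xs) (g + length xs) ys ⇒ st (st ρ g xs) (g + length xs) zs →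
          c ⊢ st ρ g (xs ++ ys) ⇒ st ρ g (xs ++ zs)
shifted ρ g xs {ys} {zs} x = ⇒conv (≗-sym (st-shift ρ g xs ys)) x (st-shift ρ g xs zs)

push-st : ∀ ρ g xs i b → push (g + i) b ⊢ st ρ g xs ⇒ st ρ g (setW xs i (b ∷ nthW xs i))
push-st ρ g xs i b = subst (λ w → push (g + i) b ⊢ st ρ g xs ⇒ st ρ g (setW xs i (b ∷ w))) (st-at ρ g xs i)
                           (conv-to ⇒push (st-set ρ g xs i _))

pop-st : ∀ {c d τ υ b ys} ρ g xs i → nthW xs i ≡ b ∷ ys → branch b c d ⊢ st ρ g (setW xs i ys) ⇒ τ →
         loop (g + i) c d ⊢ τ ⇒ υ → loop (g + i) c d ⊢ st ρ g xs ⇒ υ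
pop-st ρ g xs i e x y = ⇒pop (trans (st-at ρ g xs i) e) (conv-from (st-set ρ g xs i _) x) y

once-st : ∀ {c d τ b ys} ρ g xs i → nthW xs i ≡ b ∷ ys → branch b c d ⊢ st ρ g (setW xs i ys) ⇒ τ →
          once (g + i) c d ⊢ st ρ g xs ⇒ τ
once-st ρ g xs i e x = ⇒once (trans (st-at ρ g xs i) e) (conv-from (st-set ρ g xs i _) x)

stop-st : ∀ {c d} ρ g xs i → nthW xs i ≡ [] → loop (g + i) c d ⊢ st ρ g xs ⇒ st ρ g xs
stop-st ρ g xs i e = ⇒stop (trans (st-at ρ g xs i) e)

-- Pouring, clearing, copying and splitting stacks

pour : ℕ → ℕ → Cmd
pour i j = loop i (push j false) (push j true)

clear : ℕ → Cmd
clear i = loop i skipᶜ skipᶜ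

copy : ℕ → ℕ → ℕ → Cmd
copy i j k = pour i k ︔ loop k (push i false ︔ push j false) (push i true ︔ push j true)

two-cases : ∀ {σ τ : Stacks} i j → (∀ k → k ≢ i → k ≢ j → σ k ≡ τ k) → σ i ≡ τ i → σ j ≡ τ j → σ ≗ τ
two-cases i j other ei ej k with k ≟ i | k ≟ j
... | yes refl | _        = ei
... | no _     | yes refl = ej
... | no k≢i   | no k≢j   = other k k≢i k≢j

pour-runs : ∀ i j → i ≢ j → ∀ w σ → σ i ≡ w → pour i j ⊢ σ ⇒ upd (upd σ i []) j (w ʳ++ σ j)
pour-runs i j i≢j [] σ e = conv-to (⇒stop e) (two-cases i j
  (λ k k≢i k≢j → sym (trans (upd-other _ j k k≢j) (upd-other σ i k k≢i)))
  (trans e (sym (trans (upd-other _ j i i≢j) (upd-same σ i))))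
  (sym (upd-same _ j)))
pour-runs i j i≢j (b ∷ w) σ e = ⇒pop e (step-b b)
  (conv-to (pour-runs i j i≢j w σ₂ (trans (upd-other σ₁ j i i≢j) (upd-same σ i))) (two-cases i j
    (λ k k≢i k≢j → trans (upd-other _ j k k≢j) (trans (upd-other σ₂ i k k≢i) (trans (upd-other σ₁ j k k≢j)
                    (trans (upd-other σ i k k≢i) (sym (trans (upd-other _ j k k≢j) (upd-other σ i k k≢i)))))))
    (trans (upd-other _ j i i≢j) (trans (upd-same σ₂ i) (sym (trans (upd-other _ j i i≢j) (upd-same σ i)))))
    (trans (upd-same _ j) (trans (cong (w ʳ++_) (trans (upd-same σ₁ j) (cong (b ∷_) (upd-other σ i j (i≢j ∘ sym)))))
           (sym (upd-same (upd σ i []) j))))))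
  where
  σ₁ σ₂ : Stacks
  σ₁ = upd σ i w
  σ₂ = upd σ₁ j (b ∷ σ₁ j)
  step-b : ∀ b → branch b (push j false) (push j true) ⊢ σ₁ ⇒ upd σ₁ j (b ∷ σ₁ j)
  step-b true  = ⇒push
  step-b false = ⇒push

pour-st : ∀ ρ g xs i j → i ≢ j → pour (g + i) (g + j) ⊢ st ρ g xs ⇒ st ρ g (setW (setW xs i []) j (nthW xs i ʳ++ nthW xs j))
pour-st ρ g xs i j i≢j =
  subst (λ v → pour (g + i) (g + j) ⊢ st ρ g xs ⇒ st ρ g (setW (setW xs i []) j (nthW xs i ʳ++ v))) (st-at ρ g xs j)
  (conv-to (pour-runs (g + i) (g + j) (i≢j ∘ NP.+-cancelˡ-≡ g i j) (nthW xs i) (st ρ g xs) (st-at ρ g xs i))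
           (λ k → trans (upd-cong (st-set ρ g xs i []) (g + j) k) (st-set ρ g (setW xs i []) j _ k)))
  where
  upd-cong : ∀ {σ τ : Stacks} {v} → σ ≗ τ → ∀ i → upd σ i v ≗ upd τ i v
  upd-cong e zero    zero    = refl
  upd-cong e zero    (suc j) = e (suc j)
  upd-cong e (suc i) zero    = e zero
  upd-cong e (suc i) (suc j) = upd-cong (e ∘ suc) i j

clear-st : ∀ ρ g xs i → clear (g + i) ⊢ st ρ g xs ⇒ st ρ g (setW xs i [])
clear-st ρ g xs i = clears (nthW xs i) (st ρ g xs) (st-at ρ g xs i) (st-set ρ g xs i [])
  where
  clears : ∀ w σ {τ} → σ (g + i) ≡ w → upd σ (g + i) [] ≗ τ → clear (g + i) ⊢ σ ⇒ τ
  clears [] σ e eq = conv-to (⇒stop e) (λ k → trans (sym (upd-id σ (g + i) (sym e) k)) (eq k))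
  clears (b ∷ w) σ e eq = ⇒pop e (skips b) (clears w (upd σ (g + i) w) (upd-same σ (g + i)) λ k → trans (overwrite k) (eq k))
    where
    skips : ∀ b → branch b skipᶜ skipᶜ ⊢ upd σ (g + i) w ⇒ upd σ (g + i) w
    skips true  = ⇒skip
    skips false = ⇒skip
    overwrite : upd (upd σ (g + i) w) (g + i) [] ≗ upd σ (g + i) []
    overwrite = two-cases (g + i) (g + i)
      (λ k ne _ → trans (upd-other _ (g + i) k ne) (trans (upd-other σ (g + i) k ne) (sym (upd-other σ (g + i) k ne))))
      both both
      where both = trans (upd-same _ (g + i)) (sym (upd-same σ (g + i)))

-- Pouring reverses. The contents go to the auxiliary stack `k` and back, this time to both `i` and
-- `j`, and the two reversals cancel.
copy-runs : ∀ i j k → i ≢ j → k ≢ i → k ≢ j → ∀ σ → σ k ≡ [] → copy i j k ⊢ σ ⇒ upd σ j (σ i ++ σ j)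
copy-runs i j k i≢j k≢i k≢j σ ek = ⇒seq (pour-runs i k (k≢i ∘ sym) (σ i) σ refl)
  (backs (σ i ʳ++ σ k) σ′ (upd-same _ k) (λ l l≢i l≢j l≢k → trans (upd-other _ k l l≢k) (trans (upd-other σ i l l≢i) (sym (upd-other σ j l l≢j))))
    (trans (cong ((σ i ʳ++ σ k) ʳ++_) (trans (upd-other _ k i (k≢i ∘ sym)) (upd-same σ i)))
           (trans (double (σ i) ek (++-identityʳ (σ i))) (sym (upd-other σ j i i≢j))))
    (trans (cong ((σ i ʳ++ σ k) ʳ++_) (trans (upd-other _ k j (k≢j ∘ sym)) (upd-other σ i j (i≢j ∘ sym))))
           (trans (double (σ i) ek refl) (sym (upd-same σ j))))
    (trans (upd-other σ j k k≢j) ek))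
  where
  σ′ : Stacks
  σ′ = upd (upd σ i []) k (σ i ʳ++ σ k)
  double : ∀ (w : List Bool) {u v x} → u ≡ [] → w ++ v ≡ x → (w ʳ++ u) ʳ++ v ≡ x
  double w refl e = trans (LP.ʳ++-ʳ++ w) e
  two : ∀ σ b → branch b (push i false ︔ push j false) (push i true ︔ push j true) ⊢ σ ⇒ upd (upd σ i (b ∷ σ i)) j (b ∷ σ j)
  two σ true  = conv-to (⇒seq ⇒push ⇒push) λ l → cong (λ v → upd (upd σ i (true ∷ σ i)) j (true ∷ v) l) (upd-other σ i j (i≢j ∘ sym))
  two σ false = conv-to (⇒seq ⇒push ⇒push) λ l → cong (λ v → upd (upd σ i (false ∷ σ i)) j (false ∷ v) l) (upd-other σ i j (i≢j ∘ sym))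
  backs : ∀ w σ {τ} → σ k ≡ w → (∀ l → l ≢ i → l ≢ j → l ≢ k → σ l ≡ τ l) → w ʳ++ σ i ≡ τ i → w ʳ++ σ j ≡ τ j → τ k ≡ [] →
          loop k (push i false ︔ push j false) (push i true ︔ push j true) ⊢ σ ⇒ τ
  backs [] σ {τ} e other ei ej ek′ = conv-to (⇒stop e) eq
    where
    eq : σ ≗ τ
    eq l with l ≟ i | l ≟ j | l ≟ k
    ... | yes refl | _        | _        = ei
    ... | no _     | yes refl | _        = ej
    ... | no _     | no _     | yes refl = trans e (sym ek′)
    ... | no l≢i   | no l≢j   | no l≢k   = other l l≢i l≢j l≢k
  backs (b ∷ w) σ e other ei ej ek′ = ⇒pop e (two σ₁ b) (backs w σ₂
    (trans (upd-other _ j k k≢j) (trans (upd-other σ₁ i k k≢i) (upd-same σ k)))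
    (λ l l≢i l≢j l≢k → trans (upd-other _ j l l≢j) (trans (upd-other σ₁ i l l≢i) (trans (upd-other σ k l l≢k) (other l l≢i l≢j l≢k))))
    (trans (cong (w ʳ++_) (trans (upd-other _ j i i≢j) (trans (upd-same σ₁ i) (cong (b ∷_) (upd-other σ k i (k≢i ∘ sym)))))) ei)
    (trans (cong (w ʳ++_) (trans (upd-same _ j) (cong (b ∷_) (upd-other σ k j (k≢j ∘ sym))))) ej)
    ek′)
    where
    σ₁ σ₂ : Stacks
    σ₁ = upd σ k w
    σ₂ = upd (upd σ₁ i (b ∷ σ₁ i)) j (b ∷ σ₁ j)

-- Moves the first serialised tree of stack g to stack g + 1.  Stack g + 2 counts the trees still to be read.
split : ℕ → Cmd
split g = push (g + 2) true ︔ splitLoop ︔ pour (g + 3) (g + 1)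
  module Split where
  splitLoop : Cmd
  splitLoop = loop (g + 2) skipᶜ (once (g + 0) (push (g + 3) false) (push (g + 3) true ︔ push (g + 2) true ︔ push (g + 2) true))

-- Reading one tree is only a segment of a longer loop run, hence the continuation style: an
-- arbitrary rest of the run is extended at its front. This form lets the runs for the two subtrees
-- of a node be chained. The bits read pile up in reverse on the last stack.
splitLoop-runs : ∀ ρ g a {w y ds ks τ} → Split.splitLoop g ⊢ st ρ g (w ∷ y ∷ ds ∷ (ser a ʳ++ ks) ∷ []) ⇒ τ →
                 Split.splitLoop g ⊢ st ρ g ((ser a ++ w) ∷ y ∷ (true ∷ ds) ∷ ks ∷ []) ⇒ τ
splitLoop-runs ρ g leaf x = pop-st ρ g _ 2 refl (once-st ρ g _ 0 refl (push-st ρ g _ 3 false)) x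
splitLoop-runs ρ g (node a b) {w} {y} {ds} {ks} {τ} x = pop-st ρ g _ 2 refl
  (once-st ρ g _ 0 refl (⇒seq (push-st ρ g _ 3 true) (⇒seq (push-st ρ g _ 2 true) (push-st ρ g _ 2 true))))
  (subst (λ v → Split.splitLoop g ⊢ st ρ g (v ∷ y ∷ (true ∷ true ∷ ds) ∷ (true ∷ ks) ∷ []) ⇒ τ) (sym (++-assoc (ser a) (ser b) w))
    (splitLoop-runs ρ g a (splitLoop-runs ρ g b
      (subst (λ v → Split.splitLoop g ⊢ st ρ g (w ∷ y ∷ ds ∷ v ∷ []) ⇒ τ) (LP.++-ʳ++ (ser a) {ser b}) x))))

split-runs : ∀ ρ g a w → split g ⊢ st ρ g ((ser a ++ w) ∷ []) ⇒ st ρ g (w ∷ ser a ∷ [])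
split-runs ρ g a w = ⇒seq
  (⇒conv (st-cong ρ g {(ser a ++ w) ∷ []} {(ser a ++ w) ∷ [] ∷ [] ∷ [] ∷ []} pad) (push-st ρ g _ 2 true) (λ _ → refl))
  (⇒seq (splitLoop-runs ρ g a (stop-st ρ g _ 2 refl))
  (conv-to (pour-st ρ g _ 3 1 λ ()) (st-cong ρ g unpad)))
  where
  pad : ∀ {v} → nthW (v ∷ []) ≗ nthW (v ∷ [] ∷ [] ∷ [] ∷ [])
  pad zero = refl
  pad (suc zero) = refl
  pad (suc (suc zero)) = refl
  pad (suc (suc (suc zero))) = refl
  pad (suc (suc (suc (suc _)))) = refl
  unpad : nthW (w ∷ ((ser a ʳ++ []) ʳ++ []) ∷ [] ∷ [] ∷ []) ≗ nthW (w ∷ ser a ∷ [])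
  unpad zero = refl
  unpad (suc zero) = LP.reverse-involutive (ser a)
  unpad (suc (suc zero)) = refl
  unpad (suc (suc (suc zero))) = refl
  unpad (suc (suc (suc (suc _)))) = refl

-- One pour reverses a stack, two restore its order.
transfer : ℕ → ℕ → ℕ → Cmd
transfer i j k = pour i k ︔ pour k j

-- comp e m g leaves the value of e on stack g, with variable i on stack m i < g and all stacks from g on used as scratch.
comp : ∀ {n} → Tm n → (Fin n → ℕ) → ℕ → Cmd
comp (var i)       m g = copy (m i) (g + 0) (g + 1)
comp leafᵗ         m g = push (g + 0) false
comp (nodeᵗ e f)   m g = comp f m g ︔ comp e m (g + 1) ︔ pour (g + 1) (g + 2) ︔ pour (g + 2) (g + 0) ︔ push (g + 0) true
comp (caseᵗ e f h) m g = comp e m g ︔ once (g + 0) (comp f m g)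
  (split g ︔ comp h ((g + 1) ◂ (g + 0) ◂ m) (g + 2) ︔ clear (g + 0) ︔ clear (g + 1) ︔ transfer (g + 2) (g + 0) (g + 3))
comp (foldᵗ l e h) m g = comp e m g ︔ comp l m (g + 1) ︔ loop (g + 1) skipᶜ
  (split (g + 1) ︔ comp h ((g + 2) ◂ (g + 0) ◂ m) (g + 3) ︔ clear (g + 0) ︔ clear (g + 2) ︔ transfer (g + 3) (g + 0) (g + 4))
comp (letᵗ e f)    m g = comp e m g ︔ comp f ((g + 0) ◂ m) (g + 1) ︔ clear (g + 0) ︔ transfer (g + 1) (g + 0) (g + 2)
comp (ren e r)     m g = comp e (m ∘ r) g

-- Correctness of the compiler from terms to stack programs

Holds : ∀ {n} → Stacks → (Fin n → ℕ) → ℕ → Env n → Set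
Holds ρ m g env = ∀ i → m i < g × ρ (m i) ≡ ser (env i)

holds-up : ∀ {n ρ m g env} xs → Holds {n} ρ m g env → Holds (st ρ g xs) m (g + length xs) env
holds-up {ρ = ρ} {g = g} xs h i = ≤-trans (proj₁ (h i)) (m≤m+n g _) , trans (st-below ρ g xs (proj₁ (h i))) (proj₂ (h i))

holds-ext : ∀ {n ρ m g env} xs j {a} → Holds {n} (st ρ g xs) m (g + length xs) env → j < length xs → nthW xs j ≡ ser a →
            Holds (st ρ g xs) ((g + j) ◂ m) (g + length xs) (a ◂ env)
holds-ext {ρ = ρ} {g = g} xs j h lt e F.zero = NP.+-monoʳ-< g lt , trans (st-at ρ g xs j) e
holds-ext xs j h lt e (F.suc i) = h i

st-≡ : ∀ {c} ρ g {xs ys zs} → ys ≡ zs → c ⊢ st ρ g xs ⇒ st ρ g ys → c ⊢ st ρ g xs ⇒ st ρ g zs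
st-≡ ρ g refl x = x

drop-lasts : ∀ xs n → nthW (xs ++ replicate n []) ≗ nthW xs
drop-lasts []       zero    j       = refl
drop-lasts []       (suc n) zero    = refl
drop-lasts []       (suc n) (suc j) = drop-lasts [] n j
drop-lasts (x ∷ xs) n       zero    = refl
drop-lasts (x ∷ xs) n       (suc j) = drop-lasts xs n j

trim : ∀ {c σ} ρ g xs n → c ⊢ σ ⇒ st ρ g (xs ++ replicate n []) → c ⊢ σ ⇒ st ρ g xs
trim ρ g xs n x = conv-to x (st-cong ρ g (drop-lasts xs n))

-- Induction on the term for an arbitrary base `ρ`, since intermediate results are absorbed into the
-- base when a subterm is run at a higher level.
comp-runs : ∀ {n} (e : Tm n) m g ρ env → Holds ρ m g env → comp e m g ⊢ st ρ g [] ⇒ st ρ g (ser (eval e env) ∷ [])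
comp-runs (var i) m g ρ env h =
  conv-to (copy-runs (m i) (g + 0) (g + 1) (below 0) (below 1 ∘ sym) (λ e → case NP.+-cancelˡ-≡ g 1 0 e of λ ())
            (st ρ g []) (st-at ρ g [] 1))
          (λ l → trans (cong (λ v → upd (st ρ g []) (g + 0) v l) value) (st-set ρ g [] 0 _ l))
  where
  below : ∀ k → m i ≢ g + k
  below k e = NP.<⇒≱ (proj₁ (h i)) (subst (g ≤_) (sym e) (m≤m+n g k))
  value : st ρ g [] (m i) ++ st ρ g [] (g + 0) ≡ ser (env i)
  value = trans (cong₂ _++_ (trans (st-below ρ g [] (proj₁ (h i))) (proj₂ (h i))) (st-at ρ g [] 0)) (++-identityʳ _)
comp-runs leafᵗ m g ρ env h = push-st ρ g [] 0 false
-- The right component comes first: in preorder it lies deepest in the stack, below the left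
-- component and the tag.
comp-runs (nodeᵗ e f) m g ρ env h =
  ⇒seq (comp-runs f m g ρ env h)
  (⇒seq (shifted ρ g (vf ∷ []) {[]} (comp-runs e m (g + 1) (st ρ g (vf ∷ [])) env (holds-up (vf ∷ []) h)))
  (⇒seq (pour-st ρ g (vf ∷ ve ∷ []) 1 2 λ ())
  (⇒seq (pour-st ρ g (vf ∷ [] ∷ (ve ʳ++ []) ∷ []) 2 0 λ ())
  (trim ρ g (ser (eval (nodeᵗ e f) env) ∷ []) 2
    (st-≡ ρ g (cong (λ v → (true ∷ v) ∷ [] ∷ [] ∷ []) (LP.ʳ++-ʳ++ ve)) (push-st ρ g (((ve ʳ++ []) ʳ++ vf) ∷ [] ∷ [] ∷ []) 0 true))))))
  where
  ve = ser (eval e env)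
  vf = ser (eval f env)
comp-runs (letᵗ e f) m g ρ env h =
  ⇒seq (comp-runs e m g ρ env h)
  (⇒seq (shifted ρ g (ve ∷ []) {[]} (comp-runs f ((g + 0) ◂ m) (g + 1) (st ρ g (ve ∷ [])) (eval e env ◂ env)
          (holds-ext (ve ∷ []) 0 (holds-up (ve ∷ []) h) (s≤s z≤n) refl)))
  (⇒seq (clear-st ρ g (ve ∷ v ∷ []) 0)
  (trim ρ g (v ∷ []) 2 (st-≡ ρ g (cong (λ v → v ∷ [] ∷ [] ∷ []) (LP.reverse-involutive v))
    (⇒seq (pour-st ρ g ([] ∷ v ∷ []) 1 2 λ ()) (pour-st ρ g ([] ∷ [] ∷ (v ʳ++ []) ∷ []) 2 0 λ ()))))))
  where
  ve = ser (eval e env)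
  v = ser (eval f (eval e env ◂ env))
comp-runs (ren e r) m g ρ env h = comp-runs e (m ∘ r) g ρ (env ∘ r) (h ∘ r)
comp-runs (caseᵗ e f k) m g ρ env h = ⇒seq (comp-runs e m g ρ env h) (once-tag (eval e env))
  where
  once-tag : ∀ t → once (g + 0) (comp f m g)
    (split g ︔ comp k ((g + 1) ◂ (g + 0) ◂ m) (g + 2) ︔ clear (g + 0) ︔ clear (g + 1) ︔ transfer (g + 2) (g + 0) (g + 3))
    ⊢ st ρ g (ser t ∷ []) ⇒ st ρ g (ser (caseT t (eval f env) (λ a b → eval k (a ◂ b ◂ env))) ∷ [])
  once-tag leaf = once-st ρ g (ser leaf ∷ []) 0 refl (conv-from (st-cong ρ g {[] ∷ []} {[]} (drop-lasts [] 1)) (comp-runs f m g ρ env h))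
  once-tag (node a b) = once-st ρ g (ser (node a b) ∷ []) 0 refl
    (⇒seq (split-runs ρ g a (ser b))
    (⇒seq (shifted ρ g xs {[]} (comp-runs k ((g + 1) ◂ (g + 0) ◂ m) (g + 2) (st ρ g xs) (a ◂ b ◂ env)
            (holds-ext xs 1 (holds-ext xs 0 (holds-up xs h) (s≤s z≤n) refl) (s≤s (s≤s z≤n)) refl)))
    (⇒seq (clear-st ρ g (ser b ∷ ser a ∷ v ∷ []) 0)
    (⇒seq (clear-st ρ g ([] ∷ ser a ∷ v ∷ []) 1)
    (trim ρ g (v ∷ []) 3 (st-≡ ρ g (cong (λ v → v ∷ [] ∷ [] ∷ [] ∷ []) (LP.reverse-involutive v))
      (⇒seq (pour-st ρ g ([] ∷ [] ∷ v ∷ []) 2 3 λ ()) (pour-st ρ g ([] ∷ [] ∷ [] ∷ (v ʳ++ []) ∷ []) 3 0 λ ()))))))))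
    where
    xs = ser b ∷ ser a ∷ []
    v = ser (eval k (a ◂ b ◂ env))
comp-runs (foldᵗ l e k) m g ρ env h =
  ⇒seq (comp-runs e m g ρ env h)
  (⇒seq (shifted ρ g (ser (eval e env) ∷ []) {[]} (comp-runs l m (g + 1) (st ρ g (ser (eval e env) ∷ [])) env (holds-up (ser (eval e env) ∷ []) h)))
  (folds (eval l env) (eval e env)))
  where
  stepK : Tree → Tree → Tree
  stepK x acc = eval k (x ◂ acc ◂ env)
  folds : ∀ t acc → loop (g + 1) skipᶜ
    (split (g + 1) ︔ comp k ((g + 2) ◂ (g + 0) ◂ m) (g + 3) ︔ clear (g + 0) ︔ clear (g + 2) ︔ transfer (g + 3) (g + 0) (g + 4))
    ⊢ st ρ g (ser acc ∷ ser t ∷ []) ⇒ st ρ g (ser (foldT stepK acc t) ∷ [])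
  folds leaf acc = pop-st ρ g (ser acc ∷ ser leaf ∷ []) 1 refl ⇒skip
    (trim ρ g (ser acc ∷ []) 1 (stop-st ρ g (ser acc ∷ [] ∷ []) 1 refl))
  folds (node a b) acc = pop-st ρ g (ser acc ∷ ser (node a b) ∷ []) 1 refl
    (⇒seq (shifted ρ g (ser acc ∷ []) {(ser a ++ ser b) ∷ []} (split-runs (st ρ g (ser acc ∷ [])) (g + 1) a (ser b)))
    (⇒seq (shifted ρ g xs {[]} (comp-runs k ((g + 2) ◂ (g + 0) ◂ m) (g + 3) (st ρ g xs) (a ◂ acc ◂ env)
            (holds-ext xs 2 (holds-ext xs 0 (holds-up xs h) (s≤s z≤n) refl) (s≤s (s≤s (s≤s z≤n))) refl)))
    (⇒seq (clear-st ρ g (ser acc ∷ ser b ∷ ser a ∷ v ∷ []) 0)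
    (⇒seq (clear-st ρ g ([] ∷ ser b ∷ ser a ∷ v ∷ []) 2)
    (trim ρ g (v ∷ ser b ∷ []) 3 (st-≡ ρ g (cong (λ v → v ∷ ser b ∷ [] ∷ [] ∷ [] ∷ []) (LP.reverse-involutive v))
      (⇒seq (pour-st ρ g ([] ∷ ser b ∷ [] ∷ v ∷ []) 3 4 λ ()) (pour-st ρ g ([] ∷ ser b ∷ [] ∷ [] ∷ (v ʳ++ []) ∷ []) 4 0 λ ()))))))))
    (folds b (stepK a acc))
    where
    xs = ser acc ∷ ser b ∷ ser a ∷ []
    v = ser (stepK a acc)

-- The machine iterating a function on trees until it returns the leaf

module _ (F : Tm 1) where

  apply : Tree → Tree
  apply t = eval F (λ _ → t)

  -- The loop tests the tag of the root. For the leaf, popping its only bit empties stack 0 and ends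
  -- the loop; for a node, the popped 1 is pushed back before `F` is applied.
  bodyCmd iterCmd : Cmd
  bodyCmd = push 0 true ︔ comp F (λ _ → 0) 1 ︔ clear 0 ︔ transfer 1 0 2
  iterCmd = loop 0 skipᶜ bodyCmd

  noStacks : Stacks
  noStacks _ = []

  holding : Tree → Stacks
  holding t = st noStacks 0 (ser t ∷ [])

  body-runs : ∀ a b → bodyCmd ⊢ st noStacks 0 ((ser a ++ ser b) ∷ []) ⇒ holding (apply (node a b))
  body-runs a b =
    ⇒seq (push-st noStacks 0 ((ser a ++ ser b) ∷ []) 0 true)
    (⇒seq (shifted noStacks 0 (ser (node a b) ∷ []) {[]} (comp-runs F (λ _ → 0) 1 (st noStacks 0 (ser (node a b) ∷ [])) (λ _ → node a b)
            (λ _ → s≤s z≤n , refl)))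
    (⇒seq (clear-st noStacks 0 (ser (node a b) ∷ v ∷ []) 0)
    (trim noStacks 0 (v ∷ []) 2 (st-≡ noStacks 0 {[] ∷ v ∷ []} (cong (λ v → v ∷ [] ∷ [] ∷ []) (LP.reverse-involutive v))
      (⇒seq (pour-st noStacks 0 ([] ∷ v ∷ []) 1 2 λ ()) (pour-st noStacks 0 ([] ∷ [] ∷ (v ʳ++ []) ∷ []) 2 0 λ ()))))))
    where v = ser (apply (node a b))

  iter-runs : ∀ k t → iterate apply t k ≡ leaf → ∃[ τ ] iterCmd ⊢ holding t ⇒ τ
  iter-runs k leaf e = _ , pop-st noStacks 0 (ser leaf ∷ []) 0 refl ⇒skip (stop-st noStacks 0 ([] ∷ []) 0 refl)
  iter-runs (suc k) (node a b) e =
    let (τ , x) = iter-runs k (apply (node a b)) e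
    in τ , pop-st noStacks 0 (ser (node a b) ∷ []) 0 refl (body-runs a b) x

  -- One more than the bound, so that the number is visibly a successor and the cells of stack 0 can
  -- be written out in `block`.
  stacks : ℕ
  stacks = suc (stackBound iterCmd)

  iter-within : Within stacks iterCmd
  iter-within = within iterCmd (NP.n≤1+n _)

  -- This is `prog stacks iterCmd` unfolded, in the shape that `while-terminates` speaks about.
  iterProg : Prog
  iterProg = toStack stacks 0 ⨾ while isOne (λ s → s , R) (loopBody stacks 0 skip (prog stacks bodyCmd)) ⨾ fromStack stacks 0

  iterTM : TM
  iterTM = machine (compile iterProg)

  round : ∀ t s → At stacks (bottom stacks 0) (holding t) s →
          t ≡ leaf ⊎ (isOne (cur s) ≡ true × Run (loopBody stacks 0 skip (prog stacks bodyCmd)) (act-on (cur s , R) s)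
                                                  (At stacks (bottom stacks 0) (holding (apply t))))
  round leaf       s at = inj₁ refl
  round (node a b) s at = inj₂ (nonempty-flag stacks {σ = holding (node a b)} {i = 0} (s≤s z≤n) refl at ,
    loopBody-runs stacks skip (prog stacks bodyCmd) (s≤s z≤n) refl at
      (λ at₀ → prog-runs stacks (proj₂ (proj₂ iter-within)) (conv-from (st-set noStacks 0 (ser (node a b) ∷ []) 0 _) (body-runs a b)) at₀))

  -- The cells in order: no home mark, then flag and value of stack 0, then unset cells for all
  -- other stacks.
  block : Bool → List Bool
  block b = false ∷ true ∷ b ∷ replicate (stackBound iterCmd + stackBound iterCmd) false

  homeBlock : List Bool
  homeBlock = true ∷ replicate (stacks + stacks) false

  tapeWord : List Bool → List Bool
  tapeWord v = homeBlock ++ concatMap block v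

  private
    filler : ℕ
    filler = stackBound iterCmd + stackBound iterCmd

    S : ℕ
    S = blockSize stacks

    S≡ : S ≡ suc (suc (suc filler))
    S≡ = cong suc (cong suc (+-suc _ _))

    -- The accumulator `r` collects the blocks above the current one, because the list starts at the
    -- top of the stack and the tape at its bottom.
    cells : List Bool → List Sym → List Sym
    cells []       r = r
    cells (b ∷ xs) r = cells xs (map just (block b) ++ r)

    length-block : ∀ b → length (map {B = Sym} just (block b)) ≡ S
    length-block b = trans (length-map just (block b)) (trans (cong (λ n → suc (suc (suc n))) (LP.length-replicate filler)) (sym S≡))

    nth-++ : ∀ xs ys n → nth (xs ++ ys) (length xs + n) ≡ nth ys n
    nth-++ []       ys n = refl
    nth-++ (x ∷ xs) ys n = nth-++ xs ys n

    skip-block : ∀ xs r o t → length xs ≡ S → nth (xs ++ r) (o + suc t * S) ≡ nth r (o + t * S)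
    skip-block xs r o t e = trans (cong (nth (xs ++ r)) (trans (sym (NP.+-assoc o S _)) (trans (cong (_+ t * S) (trans (+-comm o S) (cong (_+ o) (sym e))))
                                  (NP.+-assoc (length xs) o _)))) (nth-++ xs r _)

    skip-cells : ∀ xs r o t → nth (cells xs r) (o + (length xs + t) * S) ≡ nth r (o + t * S)
    skip-cells []       r o t = refl
    skip-cells (b ∷ xs) r o t = trans (cong (λ n → nth (cells xs (map just (block b) ++ r)) (o + n * S)) (sym (+-suc (length xs) t)))
      (trans (skip-cells xs _ o (suc t)) (skip-block (map just (block b)) r o t (length-block b)))

    nth-padding : ∀ n r k → k < n → nth (map just (replicate n false) ++ r) k ≡ just false
    nth-padding (suc n) r zero    lt       = refl
    nth-padding (suc n) r (suc k) (s≤s lt) = nth-padding n r k lt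

    no-flag : ∀ o → (∀ b r → isOne (nth (map just (block b) ++ r) o) ≡ false) → ∀ xs r → (∀ t → isOne (nth r (o + t * S)) ≡ false) →
              ∀ t → isOne (nth (cells xs r) (o + t * S)) ≡ false
    no-flag o in-block []       r rest t = rest t
    no-flag o in-block (b ∷ xs) r rest t = no-flag o in-block xs (map just (block b) ++ r) at-block t
      where
      at-block : ∀ t → isOne (nth (map just (block b) ++ r) (o + t * S)) ≡ false
      at-block zero    = trans (cong (λ n → isOne (nth (map just (block b) ++ r) n)) (+-identityʳ o)) (in-block b r)
      at-block (suc t) = trans (cong isOne (skip-block (map just (block b)) r o t (length-block b))) (rest t)

    tape-cells : List Bool → List Sym
    tape-cells xs = map just homeBlock ++ cells xs []

    in-blocks : ∀ xs o t → nth (tape-cells xs) (o + suc t * S) ≡ nth (cells xs []) (o + t * S)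
    in-blocks xs o t = skip-block (map just homeBlock) (cells xs []) o t
      (trans (length-map just homeBlock) (cong suc (LP.length-replicate (stacks + stacks))))

    fill : ∀ xs r A → (∀ o t → A (o + suc t * S) ≡ nth (cells xs r) (o + t * S)) → Filled stacks A 1 xs
    fill []       r A eq = tt
    fill (b ∷ xs) r A eq = top 1 , top 2 , fill xs (map just (block b) ++ r) A eq
      where
      top : ∀ o → A (o + suc (length xs) * S) ≡ nth (map just (block b) ++ r) (o + 0)
      top o = trans (eq o (length xs)) (trans (cong (λ n → nth (cells xs (map just (block b) ++ r)) (o + n * S)) (sym (+-identityʳ (length xs))))
                                              (skip-cells xs (map just (block b) ++ r) o 0))

    tape-tracks : ∀ xs → Tracks stacks (st noStacks 0 (xs ∷ [])) (nth (tape-cells xs))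
    tape-tracks xs = tracks refl (λ t → absent 0 (λ _ _ → refl) t) columns
      where
      absent : ∀ o → (∀ b r → isOne (nth (map just (block b) ++ r) o) ≡ false) → ∀ t → isOne (nth (tape-cells xs) (o + suc t * S)) ≡ false
      absent o h t = trans (cong isOne (in-blocks xs o t)) (no-flag o h xs [] (λ _ → refl) t)
      columns : ∀ i → i < stacks → Column stacks (nth (tape-cells xs)) (flag stacks i) (st noStacks 0 (xs ∷ []) i)
      columns zero lt = column (fill xs [] (nth (tape-cells xs)) (in-blocks xs)) λ t le →
        trans (cong isOne (in-blocks xs 1 t)) (cong isOne (beyond t le))
        where
        beyond : ∀ t → length xs ≤ t → nth (cells xs []) (1 + t * S) ≡ nothing
        beyond t le = trans (cong (λ n → nth (cells xs []) (1 + n * S)) (sym (NP.m+[n∸m]≡n le))) (skip-cells xs [] 1 (t ∸ length xs))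
      columns (suc i) (s≤s lt) = column tt λ t _ → absent (flag stacks (suc i)) in-block t
        where
        in-block : ∀ b r → isOne (nth (map just (block b) ++ r) (flag stacks (suc i))) ≡ false
        in-block b r rewrite +-suc i i = cong isOne (nth-padding filler r (i + i) (NP.+-mono-< lt lt))

    cells-concat : ∀ xs r → cells xs r ≡ map just (concatMap block (reverse xs)) ++ r
    cells-concat []       r = refl
    cells-concat (b ∷ xs) r = begin
      cells xs (map just (block b) ++ r)                                   ≡⟨ cells-concat xs _ ⟩
      map just (concatMap block (reverse xs)) ++ map just (block b) ++ r   ≡⟨ ++-assoc (map just (concatMap block (reverse xs))) _ r ⟨
      (map just (concatMap block (reverse xs)) ++ map just (block b)) ++ r ≡⟨ cong (_++ r) (map-++ just (concatMap block (reverse xs)) _) ⟨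
      map just (concatMap block (reverse xs) ++ block b) ++ r
        ≡⟨ cong (λ v → map just (concatMap block (reverse xs) ++ v) ++ r) (sym (++-identityʳ (block b))) ⟩
      map just (concatMap block (reverse xs) ++ concatMap block (b ∷ [])) ++ r
        ≡⟨ cong (λ v → map just v ++ r) (LP.concatMap-++ block (reverse xs) (b ∷ [])) ⟨
      map just (concatMap block (reverse xs ++ b ∷ [])) ++ r
        ≡⟨ cong (λ v → map just (concatMap block v) ++ r) (unfold-reverse b xs) ⟨
      map just (concatMap block (reverse (b ∷ xs))) ++ r                   ∎
      where open ≡-Reasoning

    tape-word : ∀ xs → map just (tapeWord (reverse xs)) ≡ tape-cells xs
    tape-word xs = trans (map-++ just homeBlock _) (cong (map just homeBlock ++_) (trans (sym (++-identityʳ _)) (sym (cells-concat xs []))))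

    input-rep : ∀ w → Rep (inputTape w) 0 (nth (map just w))
    input-rep []      = rep refl (λ _ → refl) (λ k j e → case trans (sym (+-suc j k)) e of λ ())
    input-rep (b ∷ w) = rep refl (λ k → cong (nth (map just w)) (sym (+-identityʳ k))) (λ k j e → case trans (sym (+-suc j k)) e of λ ())

    initial : ∀ xs → At stacks 0 (st noStacks 0 (xs ∷ [])) (inputTape (tapeWord (reverse xs)))
    initial xs = _ , subst (λ r → Rep (inputTape (tapeWord (reverse xs))) 0 (nth r)) (tape-word xs) (input-rep (tapeWord (reverse xs))) , tape-tracks xs

  -- The top of stack 0 lies in the last block, so the serialisation is written in reverse.
  treeWord : Tree → List Bool
  treeWord t = tapeWord (reverse (ser t))

  iterTM-halts : ∀ k t → iterate apply t k ≡ leaf → HaltsOn iterTM (treeWord t)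
  iterTM-halts k t e =
    let (τ , x) = iter-runs k t e
        (t′ , runs , _) = prog-runs stacks iter-within x (initial (ser t))
        (n , c , r , h , _) = compile-halts iterProg runs
    in halts⇒haltsOn iterTM (treeWord t) (n , c , subst (λ c₀ → Reach (step iterTM) n c₀ c) (initConf-tape (treeWord t)) r , h)

  iterTM-halts⁻¹ : ∀ t → HaltsOn iterTM (treeWord t) → ∃[ k ] iterate apply t k ≡ leaf
  iterTM-halts⁻¹ t hw =
    let (s₁ , runs , at₁) = goes-toStack stacks 0 (initial (ser t))
    in while-terminates (_≡ leaf) apply (λ t → At stacks (bottom stacks 0) (holding t))
         {isOne} {λ s → s , R} {loopBody stacks 0 skip (prog stacks bodyCmd)} round
         (toStack stacks 0) (fromStack stacks 0) runs at₁
         (subst (Halts (step iterTM)) (sym (initConf-tape (treeWord t))) (haltsOn⇒halts iterTM (treeWord t) hw))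

-- Words of arrays and regular expressions

word : {X : Set} → ℕ → (ℕ → X) → List X
word n f = applyUpTo f n

dbl : ℕ → ℕ
dbl zero    = zero
dbl (suc n) = suc (suc (dbl n))

dbl< : ∀ {s n} → s < n → dbl s < dbl n
dbl< {zero}  (s≤s lt) = s≤s z≤n
dbl< {suc s} (s≤s lt) = s≤s (s≤s (dbl< lt))

suc-dbl< : ∀ {s n} → s < n → suc (dbl s) < dbl n
suc-dbl< {zero}  (s≤s lt) = s≤s (s≤s z≤n)
suc-dbl< {suc s} (s≤s lt) = s≤s (s≤s (suc-dbl< lt))

dbl-injective : ∀ {m n} → dbl m ≡ dbl n → m ≡ n
dbl-injective {zero}  {zero}  e = refl
dbl-injective {suc m} {suc n} e = cong suc (dbl-injective (NP.suc-injective (NP.suc-injective e)))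

++-split : ∀ {u v p t : List Bool} → length u ≡ length p → u ++ v ≡ p ++ t → u ≡ p × v ≡ t
++-split {[]}    {p = []}    l e = refl , e
++-split {x ∷ u} {p = y ∷ p} l e with ++-split {u} {p = p} (NP.suc-injective l) (∷-injectiveʳ e)
... | refl , e′ = cong (_∷ u) (∷-injectiveˡ e) , e′

length-word : ∀ {X : Set} n (f : ℕ → X) → length (word n f) ≡ n
length-word n f = LP.length-applyUpTo f n

word-cong : ∀ {X : Set} n {f g : ℕ → X} → (∀ k → k < n → f k ≡ g k) → word n f ≡ word n g
word-cong zero    e = refl
word-cong (suc n) e = cong₂ _∷_ (e 0 (s≤s z≤n)) (word-cong n (λ k lt → e (suc k) (s≤s lt)))

word-injective : ∀ {X : Set} n {f g : ℕ → X} → word n f ≡ word n g → ∀ k → k < n → f k ≡ g k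
word-injective (suc n) e zero    lt       = ∷-injectiveˡ e
word-injective (suc n) e (suc k) (s≤s lt) = word-injective n (∷-injectiveʳ e) k lt

all-word : ∀ {X : Set} {P : X → Set} n {f} → (∀ k → k < n → P (f k)) → All P (word n f)
all-word n {f} h = AllP.applyUpTo⁺₁ f n (h _)

nthB : List Bool → ℕ → Bool
nthB []       k       = false
nthB (b ∷ bs) zero    = b
nthB (b ∷ bs) (suc k) = nthB bs k

nthB-word : ∀ n f k → k < n → nthB (word n f) k ≡ f k
nthB-word (suc n) f zero    lt       = refl
nthB-word (suc n) f (suc k) (s≤s lt) = nthB-word n (f ∘ suc) k lt

word-nthB : ∀ w → word (length w) (nthB w) ≡ w
word-nthB []      = refl
word-nthB (b ∷ w) = cong (b ∷_) (word-nthB w)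

-- Arrays are functions on all pairs of naturals of which only a corner counts; cutting off the
-- frame is then a mere shift of indices.
IsArray : RegExp → ℕ → ℕ → (ℕ → ℕ → Bool) → Set
IsArray E m n a = (∀ i → i < m → word n (a i) ∈L E) × (∀ j → j < n → word m (λ i → a i j) ∈L E)

tabulate-word : ∀ {X : Set} n (f : ℕ → X) → tabulate {n = n} (f ∘ toℕ) ≡ word n f
tabulate-word zero    f = refl
tabulate-word (suc n) f = cong (f 0 ∷_) (tabulate-word n (f ∘ suc))

clamp-toℕ : ∀ n (i : Fin (suc n)) → clamp n (toℕ i) ≡ i
clamp-toℕ n i with toℕ i <? suc n
... | yes lt = FP.fromℕ<-toℕ i lt
... | no ¬lt = ⊥-elim (¬lt (toℕ<n i))

crossword⇒array : ∀ {E} → CrosswordExists E → ∃[ m ] ∃[ n ] ∃[ a ] IsArray E (suc m) (suc n) a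
crossword⇒array {E} (m , n , a , rs , cs) = m , n , (λ i j → a (clamp m i) (clamp n j)) ,
  (λ i lt → subst (_∈L E) (trans (LP.tabulate-cong (λ j → cong (a (clamp m i)) (sym (clamp-toℕ n j)))) (tabulate-word (suc n) (λ j → a (clamp m i) (clamp n j)))) (rs (clamp m i))) ,
  (λ j lt → subst (_∈L E) (trans (LP.tabulate-cong (λ i → cong (λ z → a z (clamp n j)) (sym (clamp-toℕ m i)))) (tabulate-word (suc m) (λ i → a (clamp m i) (clamp n j)))) (cs (clamp n j)))

array⇒crossword : ∀ {E} m n a → IsArray E (suc m) (suc n) a → CrosswordExists E
array⇒crossword {E} m n a (rs , cs) = m , n , (λ i j → a (toℕ i) (toℕ j)) ,
  (λ i → subst (_∈L E) (sym (tabulate-word (suc n) (a (toℕ i)))) (rs (toℕ i) (toℕ<n i))) ,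
  (λ j → subst (_∈L E) (sym (tabulate-word (suc m) (λ i → a i (toℕ j)))) (cs (toℕ j) (toℕ<n j)))

lits : List Bool → RegExp
lits []      = eps
lits (b ∷ w) = lit b ·· lits w

-- The last alternative is kept apart because it will carry the part depending on the input, which
-- thereby comes last in the code.
alt : List RegExp → RegExp → RegExp
alt []       E = E
alt (F ∷ Fs) E = F ∣∣ alt Fs E

lits-match : ∀ w → w ∈L lits w
lits-match []      = m-eps
lits-match (b ∷ w) = m-cat (m-lit b) (lits-match w)

lits-only : ∀ v {w} → w ∈L lits v → w ≡ v
lits-only []      m-eps = refl
lits-only (b ∷ v) (m-cat (m-lit _) x) = cong (b ∷_) (lits-only v x)

alt-any : ∀ {w Fs E F} → F ∈ Fs → w ∈L F → w ∈L alt Fs E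
alt-any (here refl) x = m-unionˡ x
alt-any (there i)   x = m-unionʳ (alt-any i x)

alt-last : ∀ {w} Fs {E} → w ∈L E → w ∈L alt Fs E
alt-last []       x = x
alt-last (F ∷ Fs) x = m-unionʳ (alt-last Fs x)

alt-inv : ∀ {w} Fs {E} → w ∈L alt Fs E → (∃[ F ] F ∈ Fs × w ∈L F) ⊎ w ∈L E
alt-inv []       x = inj₂ x
alt-inv (F ∷ Fs) (m-unionˡ x) = inj₁ (F , here refl , x)
alt-inv (F ∷ Fs) (m-unionʳ x) with alt-inv Fs x
... | inj₁ (G , i , y) = inj₁ (G , there i , y)
... | inj₂ y = inj₂ y

cat-inv : ∀ {w E F} → w ∈L (E ·· F) → ∃[ u ] ∃[ v ] w ≡ u ++ v × u ∈L E × v ∈L F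
cat-inv (m-cat x y) = _ , _ , refl , x , y

module _ (Q : Bool → Bool → Set) {X : RegExp} (two : ∀ {w} → w ∈L X → ∃[ a ] ∃[ b ] w ≡ a ∷ b ∷ [] × Q a b) where

  star₂-inv : ∀ {w} n f → w ∈L star X → w ≡ word n f →
              ∃[ N ] n ≡ dbl N × (∀ s → s < N → Q (f (dbl s)) (f (suc (dbl s))))
  star₂-inv zero    f m-star0 e = 0 , refl , λ _ ()
  star₂-inv (suc n) f m-star0 ()
  star₂-inv n f (m-starS x y) e with two x
  star₂-inv (suc zero) f (m-starS x y) () | a , b , refl , q
  star₂-inv (suc (suc n)) f (m-starS x y) e | a , b , refl , q
    with star₂-inv n (f ∘ suc ∘ suc) y (∷-injectiveʳ (∷-injectiveʳ e))
  ... | N , refl , h = suc N , refl , λ where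
    zero    lt       → subst₂ Q (∷-injectiveˡ e) (∷-injectiveˡ (∷-injectiveʳ e)) q
    (suc s) (s≤s lt) → h s lt

star₂ : ∀ {X} N f → (∀ s → s < N → (f (dbl s) ∷ f (suc (dbl s)) ∷ []) ∈L X) → word (dbl N) f ∈L star X
star₂ zero    f h = m-star0
star₂ (suc N) f h = m-starS (h 0 (s≤s z≤n)) (star₂ N (f ∘ suc ∘ suc) (λ s lt → h (suc s) (s≤s lt)))

pairs : RegExp
pairs = star (lits (false ∷ false ∷ []) ∣∣ lits (true ∷ true ∷ []))

two-equal : ∀ {w} → w ∈L (lits (false ∷ false ∷ []) ∣∣ lits (true ∷ true ∷ [])) → ∃[ a ] ∃[ b ] w ≡ a ∷ b ∷ [] × a ≡ b
two-equal (m-unionˡ x) = _ , _ , lits-only _ x , refl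
two-equal (m-unionʳ x) = _ , _ , lits-only _ x , refl

pairs-inv : ∀ n f → word n f ∈L pairs → ∃[ N ] n ≡ dbl N × (∀ s → s < N → f (dbl s) ≡ f (suc (dbl s)))
pairs-inv n f x = star₂-inv _≡_ two-equal n f x refl

pairs-match : ∀ N f → (∀ s → s < N → f (dbl s) ≡ f (suc (dbl s))) → word (dbl N) f ∈L pairs
pairs-match N f h = star₂ N f (λ s lt → equal (h s lt))
  where
  equal : ∀ {a b} → a ≡ b → (a ∷ b ∷ []) ∈L (lits (false ∷ false ∷ []) ∣∣ lits (true ∷ true ∷ []))
  equal {false} refl = m-unionˡ (lits-match _)
  equal {true}  refl = m-unionʳ (lits-match _)

-- Used as the tail of every line through the frame: at least one repetition forces the region
-- outside the frame to be nonempty, and of even length.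
plus : Bool → Bool → RegExp
plus a b = lits (a ∷ b ∷ []) ·· star (lits (a ∷ b ∷ []))

plus-inv : ∀ a b n f → word n f ∈L plus a b → ∃[ N ] n ≡ dbl (suc N) × (∀ s → s < suc N → f (dbl s) ≡ a × f (suc (dbl s)) ≡ b)
plus-inv a b n f (x) with cat-inv x
... | u , v , e , y , z with lits-only _ y
plus-inv a b zero f x | _ , v , () , y , z | refl
plus-inv a b (suc zero) f x | _ , v , () , y , z | refl
plus-inv a b (suc (suc n)) f x | _ , v , e , y , z | refl
  with star₂-inv (λ c d → c ≡ a × d ≡ b) (λ m → a , b , lits-only _ m , refl , refl) n (f ∘ suc ∘ suc) z (sym (∷-injectiveʳ (∷-injectiveʳ e)))
... | N , refl , h = N , refl , λ where
  zero    lt       → ∷-injectiveˡ e , ∷-injectiveˡ (∷-injectiveʳ e)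
  (suc s) (s≤s lt) → h s lt

plus-match : ∀ a b N f → (∀ s → s < suc N → f (dbl s) ≡ a × f (suc (dbl s)) ≡ b) → word (dbl (suc N)) f ∈L plus a b
plus-match a b N f h = m-cat (pair 0 (s≤s z≤n)) (star₂ N (f ∘ suc ∘ suc) (λ s lt → pair (suc s) (s≤s lt)))
  where
  pair : ∀ s → s < suc N → (f (dbl s) ∷ f (suc (dbl s)) ∷ []) ∈L lits (a ∷ b ∷ [])
  pair s lt = subst₂ (λ c d → (c ∷ d ∷ []) ∈L lits (a ∷ b ∷ [])) (sym (proj₁ (h s lt))) (sym (proj₂ (h s lt))) (lits-match _)

-- The frame

pattern O = false
pattern I = true

-- Rows and columns of a crossword are told apart by their first seven letters: up to transposition, frame is the
-- only 7 × 7 array with all rows and columns among the prefixes below (found by computer search).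
frame frameᵀ : List (List Bool)
frame = (O ∷ I ∷ O ∷ O ∷ I ∷ O ∷ I ∷ [])
      ∷ (I ∷ O ∷ I ∷ I ∷ O ∷ O ∷ O ∷ [])
      ∷ (O ∷ I ∷ O ∷ O ∷ O ∷ O ∷ O ∷ [])
      ∷ (O ∷ I ∷ O ∷ I ∷ O ∷ I ∷ I ∷ [])
      ∷ (I ∷ O ∷ O ∷ O ∷ I ∷ O ∷ I ∷ [])
      ∷ (O ∷ O ∷ O ∷ I ∷ I ∷ I ∷ I ∷ [])
      ∷ (I ∷ O ∷ O ∷ I ∷ O ∷ O ∷ I ∷ []) ∷ []

rowPrefix pairPrefix colPrefix : List Bool
rowPrefix  = O ∷ I ∷ O ∷ I ∷ I ∷ O ∷ O ∷ []
pairPrefix = I ∷ O ∷ O ∷ I ∷ O ∷ O ∷ O ∷ []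
colPrefix  = O ∷ I ∷ O ∷ I ∷ O ∷ O ∷ I ∷ []

fr : ℕ → ℕ → Bool
fr i j = nthB (nthW frame i) j

frameᵀ = word 7 (λ j → word 7 (λ i → fr i j))

-- The main rows alternate between rowPrefix and pairPrefix, the main columns between colPrefix and pairPrefix.
borders : List (List Bool × RegExp)
borders = map (λ i → nthW frame i , plus (nthB colPrefix i) (nthB pairPrefix i)) (word 7 id)
       ++ map (λ j → nthW frameᵀ j , plus (nthB rowPrefix j) (nthB pairPrefix j)) (4 ∷ 5 ∷ 6 ∷ [])

prefixes : List (List Bool)
prefixes = rowPrefix ∷ pairPrefix ∷ colPrefix ∷ map proj₁ borders

colOf : ℕ → List (List Bool) → List Bool
colOf j = map (λ r → nthB r j)

isPrefix : List Bool → List Bool → Bool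
isPrefix []      _       = true
isPrefix (b ∷ v) []      = false
isPrefix (b ∷ v) (c ∷ w) = if does (b ≟ᵇ c) then isPrefix v w else false

allᵇ anyᵇ : {X : Set} → (X → Bool) → List X → Bool
allᵇ p []       = true
allᵇ p (x ∷ xs) = if p x then allᵇ p xs else false
anyᵇ p []       = false
anyᵇ p (x ∷ xs) = if p x then true else anyᵇ p xs

consistent : List (List Bool) → Bool
consistent rows = allᵇ (λ j → anyᵇ (isPrefix (colOf j rows)) prefixes) (word 7 id)

_≟ᴸ_ : (u v : List (List Bool)) → Dec (u ≡ v)
_≟ᴸ_ = LP.≡-dec (LP.≡-dec _≟ᵇ_)

-- Backtracking over the rows. There are 13 prefixes and hence 13 to the power 7 choices;
-- `consistent` cuts a branch as soon as some column no longer begins an allowed prefix, which makes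
-- `frame-unique` checkable by evaluation.
onlyFrames : ℕ → List (List Bool) → Bool
onlyFrames zero    rows = if consistent rows then (does (rows ≟ᴸ frame) ∨ does (rows ≟ᴸ frameᵀ)) else true
onlyFrames (suc k) rows = if consistent rows then allᵇ (λ p → onlyFrames k (rows ++ p ∷ [])) prefixes else true

allᵇ-∈ : ∀ {X : Set} (p : X → Bool) {xs x} → allᵇ p xs ≡ true → x ∈ xs → p x ≡ true
allᵇ-∈ p {y ∷ ys} e i with p y in py
allᵇ-∈ p {y ∷ ys} e (here refl) | true = py
allᵇ-∈ p {y ∷ ys} e (there i)   | true = allᵇ-∈ p e i

allᵇ-intro : ∀ {X : Set} (p : X → Bool) {xs} → All (λ x → p x ≡ true) xs → allᵇ p xs ≡ true
allᵇ-intro p [] = refl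
allᵇ-intro p (e ∷ es) rewrite e = allᵇ-intro p es

anyᵇ-intro : ∀ {X : Set} (p : X → Bool) {xs x} → x ∈ xs → p x ≡ true → anyᵇ p xs ≡ true
anyᵇ-intro p (here refl) e rewrite e = refl
anyᵇ-intro p {y ∷ ys} (there i) e with p y
... | true  = refl
... | false = anyᵇ-intro p i e

isPrefix-++ : ∀ u v → isPrefix u (u ++ v) ≡ true
isPrefix-++ []      v = refl
isPrefix-++ (O ∷ u) v = isPrefix-++ u v
isPrefix-++ (I ∷ u) v = isPrefix-++ u v

consistent-++ : ∀ rows rest → (∀ j → j < 7 → colOf j (rows ++ rest) ∈ prefixes) → consistent rows ≡ true
consistent-++ rows rest h = allᵇ-intro (λ j → anyᵇ (isPrefix (colOf j rows)) prefixes) (all-word 7 {id} λ j lt →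
  anyᵇ-intro (isPrefix (colOf j rows)) (h j lt)
    (trans (cong (isPrefix (colOf j rows)) (map-++ _ rows rest)) (isPrefix-++ (colOf j rows) _)))

onlyFrames-sound : ∀ k rows rest → length rest ≡ k → All (_∈ prefixes) rest → (∀ j → j < 7 → colOf j (rows ++ rest) ∈ prefixes) →
                   onlyFrames k rows ≡ true → rows ++ rest ≡ frame ⊎ rows ++ rest ≡ frameᵀ
onlyFrames-sound zero rows [] refl [] h e rewrite consistent-++ rows [] h | ++-identityʳ rows with rows ≟ᴸ frame | rows ≟ᴸ frameᵀ
... | yes eq | _      = inj₁ eq
... | no _   | yes eq = inj₂ eq
... | no _   | no _   = case e of λ ()
onlyFrames-sound (suc k) rows (p ∷ rest) refl (i ∷ is) h e rewrite consistent-++ rows (p ∷ rest) h =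
  subst (λ z → z ≡ frame ⊎ z ≡ frameᵀ) (++-assoc rows (p ∷ []) rest)
    (onlyFrames-sound k (rows ++ p ∷ []) rest refl is (λ j lt → subst (λ z → colOf j z ∈ prefixes) (sym (++-assoc rows (p ∷ []) rest)) (h j lt))
      (allᵇ-∈ (λ p → onlyFrames k (rows ++ p ∷ [])) e i))

frame-unique : onlyFrames 7 [] ≡ true
frame-unique = refl

below7 : {P : ℕ → Set} → P 0 → P 1 → P 2 → P 3 → P 4 → P 5 → P 6 → ∀ i → i < 7 → P i
below7 a b c d e f g 0 _ = a
below7 a b c d e f g 1 _ = b
below7 a b c d e f g 2 _ = c
below7 a b c d e f g 3 _ = d
below7 a b c d e f g 4 _ = e
below7 a b c d e f g 5 _ = f
below7 a b c d e f g 6 _ = g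
below7 a b c d e f g (suc (suc (suc (suc (suc (suc (suc _))))))) (s≤s (s≤s (s≤s (s≤s (s≤s (s≤s (s≤s ())))))))

Framed : (ℕ → ℕ → Bool) → Set
Framed a = ∀ i → i < 7 → word 7 (a i) ≡ nthW frame i

block-framed : ∀ a → (∀ i → i < 7 → word 7 (a i) ∈ prefixes) → (∀ j → j < 7 → word 7 (λ i → a i j) ∈ prefixes) →
               Framed a ⊎ Framed (λ i j → a j i)
block-framed a hr hc with onlyFrames-sound 7 [] (word 7 (λ i → word 7 (a i))) refl (all-word 7 hr)
  (λ j lt → subst (_∈ prefixes) (sym (trans (LP.map-applyUpTo (λ i → word 7 (a i)) (λ r → nthB r j) 7) (word-cong 7 (λ i _ → nthB-word 7 (a i) j lt)))) (hc j lt)) frame-unique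
... | inj₁ e = inj₁ (word-injective 7 {λ i → word 7 (a i)} {nthW frame} e)
... | inj₂ e = inj₂ λ i lt → trans (word-cong 7 (λ j lt′ → entryᵀ i j lt lt′)) (below7 {λ i → word 7 (λ j → nthB (nthW frameᵀ j) i) ≡ nthW frame i}
                 refl refl refl refl refl refl refl i lt)
  where
  entryᵀ : ∀ i j → i < 7 → j < 7 → a j i ≡ nthB (nthW frameᵀ j) i
  entryᵀ i j lt lt′ = trans (sym (nthB-word 7 (a j) i lt)) (cong (λ w → nthB w i)
    (trans (word-injective 7 {λ i → word 7 (a i)} {λ j → word 7 (λ i → fr i j)} e j lt′) (below7 {λ j → word 7 (λ i → fr i j) ≡ nthW frameᵀ j} refl refl refl refl refl refl refl j lt′)))

alternating : {X : Set} → X → X → ℕ → X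
alternating x y zero          = x
alternating x y (suc zero)    = y
alternating x y (suc (suc k)) = alternating x y k

alternating-dbl : ∀ {X : Set} (x y : X) s → alternating x y (dbl s) ≡ x × alternating x y (suc (dbl s)) ≡ y
alternating-dbl x y zero    = refl , refl
alternating-dbl x y (suc s) = alternating-dbl x y s

prepend : {X : Set} → ℕ → (ℕ → X) → (ℕ → X) → ℕ → X
prepend zero    p f k       = f k
prepend (suc n) p f zero    = p 0
prepend (suc n) p f (suc k) = prepend n (p ∘ suc) f k

data View : ℕ → ℕ → Set where
  border : ∀ {n i} → i < 7 → View n i
  even   : ∀ {n s} → s < n → View n (7 + dbl s)
  odd    : ∀ {n s} → s < n → View n (7 + suc (dbl s))

view : ∀ n i → i < 7 + dbl n → View n i
view n i lt with i <? 7
... | yes i<7 = border i<7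
... | no i≮7 = subst (View n) (NP.m+[n∸m]≡n (NP.≮⇒≥ i≮7)) (outer n (i ∸ 7) (NP.+-cancelˡ-< 7 _ _ (subst (_< 7 + dbl n) (sym (NP.m+[n∸m]≡n (NP.≮⇒≥ i≮7))) lt)))
  where
  half : ∀ n k → k < dbl n → (∃[ s ] s < n × k ≡ dbl s) ⊎ (∃[ s ] s < n × k ≡ suc (dbl s))
  half (suc n) zero lt = inj₁ (0 , s≤s z≤n , refl)
  half (suc n) (suc zero) lt = inj₂ (0 , s≤s z≤n , refl)
  half (suc n) (suc (suc k)) (s≤s (s≤s lt)) with half n k lt
  ... | inj₁ (s , l , refl) = inj₁ (suc s , s≤s l , refl)
  ... | inj₂ (s , l , refl) = inj₂ (suc s , s≤s l , refl)
  outer : ∀ n k → k < dbl n → View n (7 + k)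
  outer n k lt with half n k lt
  ... | inj₁ (s , l , refl) = even l
  ... | inj₂ (s , l , refl) = odd l

-- The crossword expression and its framed arrays

guarded : List Bool × RegExp → RegExp
guarded (p , E) = lits p ·· E

module _ (H A : RegExp) where

  components : List (List Bool × RegExp)
  components = (pairPrefix , pairs) ∷ (colPrefix , A) ∷ borders

  crosswordRx : RegExp
  crosswordRx = alt (map guarded components) (lits rowPrefix ·· H)

  -- The prefixes are distinct, so the prefix of a line determines the expression for its remainder.
  -- Written as a lookup, this holds by evaluation in each case.
  tailRx : List (List Bool × RegExp) → List Bool → Maybe RegExp
  -- The default is meant for `rowPrefix`, which is not among the components.
  tailRx []             w = just H
  tailRx ((p , E) ∷ cs) w = if does (LP.≡-dec _≟ᵇ_ p w) then just E else tailRx cs w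

  tail-of : List Bool → Maybe RegExp
  tail-of = tailRx components

  components-tails : All (λ (p , E) → length p ≡ 7 × p ∈ prefixes × tail-of p ≡ just E) components
  components-tails =
    (refl , there (here refl) , refl) ∷ (refl , there (there (here refl)) , refl) ∷
    All.tabulate λ {x} i → let (a , b) = All.lookup table i in a , there (there (there (∈-map⁺ proj₁ i))) , b
    where
    table : All (λ (p , E) → length p ≡ 7 × tail-of p ≡ just E) borders
    table = (refl , refl) ∷ (refl , refl) ∷ (refl , refl) ∷ (refl , refl) ∷ (refl , refl) ∷ (refl , refl) ∷ (refl , refl) ∷
            (refl , refl) ∷ (refl , refl) ∷ (refl , refl) ∷ []

  crosswordRx-inv : ∀ {w} → w ∈L crosswordRx → ∃[ p ] ∃[ t ] ∃[ E ] w ≡ p ++ t × length p ≡ 7 × p ∈ prefixes × tail-of p ≡ just E × t ∈L E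
  crosswordRx-inv x with alt-inv (map guarded components) x
  ... | inj₂ y with cat-inv y
  ... | u , v , e , m , m′ with lits-only rowPrefix m
  ... | refl = rowPrefix , v , H , e , refl , here refl , refl , m′
  crosswordRx-inv x | inj₁ (F , i , y) with ∈-map⁻ guarded i
  ... | (p , E) , i′ , refl with cat-inv y
  ... | u , v , e , m , m′ with lits-only p m | All.lookup components-tails i′
  ... | refl | len , pre , tl = p , v , E , e , len , pre , tl , m′

  crosswordRx-positive : Positive crosswordRx
  crosswordRx-positive x with crosswordRx-inv x
  ... | [] , t , E , e , () , _
  ... | _ ∷ _ , t , E , () , _

  crosswordRx-length : ∀ {w} → w ∈L crosswordRx → 7 ≤ length w
  crosswordRx-length x with crosswordRx-inv x
  ... | p , t , E , refl , len , _ = subst (_≤ length (p ++ t)) len (subst (length p ≤_) (sym (length-++ p)) (m≤m+n (length p) (length t)))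

  word-tail : ∀ n f → word (7 + n) f ∈L crosswordRx →
              word 7 f ∈ prefixes × (∀ {E} → tail-of (word 7 f) ≡ just E → word n (λ k → f (7 + k)) ∈L E)
  word-tail n f x with crosswordRx-inv x
  ... | p , t , E , e , len , pre , tl , y with ++-split {word 7 f} {word n (λ k → f (7 + k))} {p} {t} (sym len) e
  ... | refl , refl = pre , λ tl′ → subst (word n (λ k → f (7 + k)) ∈L_) (just-injective (trans (sym tl) tl′)) y

  word-match : ∀ n f {p E} → (p , E) ∈ components → word 7 f ≡ p → word n (λ k → f (7 + k)) ∈L E → word (7 + n) f ∈L crosswordRx
  word-match n f {p} {E} i refl x = alt-any (∈-map⁺ guarded i) (m-cat (lits-match (word 7 f)) x)

  word-match-H : ∀ n f → word 7 f ≡ rowPrefix → word n (λ k → f (7 + k)) ∈L H → word (7 + n) f ∈L crosswordRx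
  word-match-H n f e x = subst (λ p → (p ++ word n (λ k → f (7 + k))) ∈L crosswordRx) (sym e)
    (alt-last (map guarded components) (m-cat (lits-match rowPrefix) x))

  -- The part of the crossword outside the frame has 2T rows and 2N columns.
  record Main (T N : ℕ) (d : ℕ → ℕ → Bool) : Set where
    constructor main
    field
      row-H : ∀ s → s < T → word (dbl N) (d (dbl s)) ∈L H
      row-C : ∀ s → s < T → word (dbl N) (d (suc (dbl s))) ∈L pairs
      col-A : ∀ s → s < N → word (dbl T) (λ i → d i (dbl s)) ∈L A
      col-C : ∀ s → s < N → word (dbl T) (λ i → d i (suc (dbl s))) ∈L pairs
  open Main public

  MainExists : Set
  MainExists = ∃[ T ] ∃[ N ] ∃[ d ] Main (suc T) (suc N) d

  row-tails : ∀ i → i < 7 → tail-of (nthW frame i) ≡ just (plus (nthB colPrefix i) (nthB pairPrefix i))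
  row-tails = below7 refl refl refl refl refl refl refl

  col-tails : ∀ j → j < 7 → tail-of (nthW frameᵀ j) ≡ just (plus (nthB rowPrefix j) (nthB pairPrefix j))
  col-tails = below7 refl refl refl refl refl refl refl

  framed-cols : ∀ a → Framed a → ∀ j → j < 7 → word 7 (λ i → a i j) ≡ nthW frameᵀ j
  framed-cols a h j lt = trans (word-cong 7 (λ i lt′ → trans (sym (nthB-word 7 (a i) j lt)) (cong (λ w → nthB w j) (h i lt′))))
    (below7 {λ j → word 7 (λ i → fr i j) ≡ nthW frameᵀ j} refl refl refl refl refl refl refl j lt)

  -- The tails of the seven border rows, read downwards, are the prefixes of the columns outside the
  -- frame, and conversely for the border columns. As these tails repeat two letters, the prefixes
  -- of the main rows and columns alternate, which fixes the constraint on each of them.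
  framed⇒main : ∀ {m n} a → Framed a → IsArray crosswordRx (7 + m) (7 + n) a → MainExists
  framed⇒main {m} {n} a h (rs , cs) with plus-inv (nthB colPrefix 0) (nthB pairPrefix 0) n _ (row-plus 0 (s≤s z≤n))
                                         | plus-inv (nthB rowPrefix 0) (nthB pairPrefix 0) m _ (col-plus 0 (s≤s z≤n))
    where
    row-plus : ∀ i → i < 7 → word n (λ k → a i (7 + k)) ∈L plus (nthB colPrefix i) (nthB pairPrefix i)
    row-plus i lt = proj₂ (word-tail n (a i) (rs i (≤-trans lt (m≤m+n 7 m)))) (trans (cong tail-of (h i lt)) (row-tails i lt))
    col-plus : ∀ j → j < 7 → word m (λ k → a (7 + k) j) ∈L plus (nthB rowPrefix j) (nthB pairPrefix j)
    col-plus j lt = proj₂ (word-tail m (λ i → a i j) (cs j (≤-trans lt (m≤m+n 7 n)))) (trans (cong tail-of (framed-cols a h j lt)) (col-tails j lt))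
  ... | N , refl , _ | T , refl , _ = T , N , (λ i j → a (7 + i) (7 + j)) , main
    (λ s lt → proj₂ (word-tail _ (a (7 + dbl s)) (rs _ (NP.+-monoʳ-< 7 (dbl< lt)))) (cong tail-of (row-prefix s lt)))
    (λ s lt → proj₂ (word-tail _ (a (7 + suc (dbl s))) (rs _ (NP.+-monoʳ-< 7 (suc-dbl< lt)))) (cong tail-of (row-prefix′ s lt)))
    (λ s lt → proj₂ (word-tail _ (λ i → a i (7 + dbl s)) (cs _ (NP.+-monoʳ-< 7 (dbl< lt)))) (cong tail-of (col-prefix s lt)))
    (λ s lt → proj₂ (word-tail _ (λ i → a i (7 + suc (dbl s))) (cs _ (NP.+-monoʳ-< 7 (suc-dbl< lt)))) (cong tail-of (col-prefix′ s lt)))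
    where
    row-values : ∀ i → i < 7 → ∀ s → s < suc N → a i (7 + dbl s) ≡ nthB colPrefix i × a i (7 + suc (dbl s)) ≡ nthB pairPrefix i
    row-values i lt s lt′ with plus-inv (nthB colPrefix i) (nthB pairPrefix i) (dbl (suc N)) (λ k → a i (7 + k))
      (proj₂ (word-tail _ (a i) (rs i (≤-trans lt (m≤m+n 7 _)))) (trans (cong tail-of (h i lt)) (row-tails i lt)))
    ... | N′ , e , v with dbl-injective {suc N} {suc N′} e
    ... | refl = v s lt′
    col-values : ∀ j → j < 7 → ∀ s → s < suc T → a (7 + dbl s) j ≡ nthB rowPrefix j × a (7 + suc (dbl s)) j ≡ nthB pairPrefix j
    col-values j lt s lt′ with plus-inv (nthB rowPrefix j) (nthB pairPrefix j) (dbl (suc T)) (λ k → a (7 + k) j)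
      (proj₂ (word-tail _ (λ i → a i j) (cs j (≤-trans lt (m≤m+n 7 _)))) (trans (cong tail-of (framed-cols a h j lt)) (col-tails j lt)))
    ... | T′ , e , v with dbl-injective {suc T} {suc T′} e
    ... | refl = v s lt′
    row-prefix : ∀ s → s < suc T → word 7 (a (7 + dbl s)) ≡ rowPrefix
    row-prefix s lt = word-cong 7 {g = nthB rowPrefix} (λ j lt′ → proj₁ (col-values j lt′ s lt))
    row-prefix′ : ∀ s → s < suc T → word 7 (a (7 + suc (dbl s))) ≡ pairPrefix
    row-prefix′ s lt = word-cong 7 {g = nthB pairPrefix} (λ j lt′ → proj₂ (col-values j lt′ s lt))
    col-prefix : ∀ s → s < suc N → word 7 (λ i → a i (7 + dbl s)) ≡ colPrefix
    col-prefix s lt = word-cong 7 {g = nthB colPrefix} (λ j lt′ → proj₁ (row-values j lt′ s lt))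
    col-prefix′ : ∀ s → s < suc N → word 7 (λ i → a i (7 + suc (dbl s))) ≡ pairPrefix
    col-prefix′ s lt = word-cong 7 {g = nthB pairPrefix} (λ j lt′ → proj₂ (row-values j lt′ s lt))

  crossword⇒main : CrosswordExists crosswordRx → MainExists
  crossword⇒main x with crossword⇒array x
  ... | m , n , a , rs , cs with NP.m+[n∸m]≡n (long (suc n) (a 0) (rs 0 (s≤s z≤n))) | NP.m+[n∸m]≡n (long (suc m) (λ i → a i 0) (cs 0 (s≤s z≤n)))
    where
    long : ∀ n f → word n f ∈L crosswordRx → 7 ≤ n
    long n f y = subst (7 ≤_) (length-word n f) (crosswordRx-length y)
  ... | en | em with subst₂ (λ m n → IsArray crosswordRx m n a) (sym em) (sym en) (rs , cs)
  ... | rs′ , cs′ with block-framed a (λ i lt → proj₁ (word-tail _ (a i) (rs′ i (≤-trans lt (m≤m+n 7 _)))))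
                                      (λ j lt → proj₁ (word-tail _ (λ i → a i j) (cs′ j (≤-trans lt (m≤m+n 7 _)))))
  ... | inj₁ h = framed⇒main a h (rs′ , cs′)
  -- Rows and columns obey the same expression, so the transposed array is a crossword too.
  ... | inj₂ h = framed⇒main (λ i j → a j i) h (cs′ , rs′)

  framedArray : (ℕ → ℕ → Bool) → ℕ → ℕ → Bool
  framedArray d = prepend 7 (λ i → prepend 7 (fr i) (alternating (nthB colPrefix i) (nthB pairPrefix i)))
                            (λ k → prepend 7 (nthB (alternating rowPrefix pairPrefix k)) (d k))

  frame∈ : ∀ i → i < 7 → (nthW frame i , plus (nthB colPrefix i) (nthB pairPrefix i)) ∈ components
  frame∈ = below7 (there (there (here refl))) (there (there (there (here refl)))) (there (there (there (there (here refl)))))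
    (there (there (there (there (there (here refl)))))) (there (there (there (there (there (there (here refl)))))))
    (there (there (there (there (there (there (there (here refl)))))))) (there (there (there (there (there (there (there (there (here refl)))))))))

  -- The first four columns of the frame equal its first four rows, and `rowPrefix` and `colPrefix`
  -- share their first four letters, so these columns are found among the row entries. Columns 4 to
  -- 6 have entries of their own.
  frameᵀ∈ : ∀ j → j < 7 → (nthW frameᵀ j , plus (nthB rowPrefix j) (nthB pairPrefix j)) ∈ components
  frameᵀ∈ = below7 (there (there (here refl))) (there (there (there (here refl)))) (there (there (there (there (here refl)))))
    (there (there (there (there (there (here refl)))))) (there (there (there (there (there (there (there (there (there (here refl))))))))))
    (there (there (there (there (there (there (there (there (there (there (here refl)))))))))))
    (there (there (there (there (there (there (there (there (there (there (there (here refl))))))))))))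

  main⇒crossword : MainExists → CrosswordExists crosswordRx
  main⇒crossword (T , N , d , m) = array⇒crossword (6 + dbl (suc T)) (6 + dbl (suc N)) a
    ((λ i lt → row i (view (suc T) i lt)) , (λ j lt → col j (view (suc N) j lt)))
    where
    a : ℕ → ℕ → Bool
    a = framedArray d
    row : ∀ i → View (suc T) i → word (7 + dbl (suc N)) (a i) ∈L crosswordRx
    row i (border lt) = word-match (dbl (suc N)) (a i) (frame∈ i lt)
      (below7 {λ i → word 7 (a i) ≡ nthW frame i} refl refl refl refl refl refl refl i lt)
      (plus-match _ _ N (λ k → a i (7 + k)) λ s _ → values s i lt)
      where
      values : ∀ s i → i < 7 → a i (7 + dbl s) ≡ nthB colPrefix i × a i (7 + suc (dbl s)) ≡ nthB pairPrefix i
      values s = below7 (alternating-dbl _ _ s) (alternating-dbl _ _ s) (alternating-dbl _ _ s) (alternating-dbl _ _ s)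
                        (alternating-dbl _ _ s) (alternating-dbl _ _ s) (alternating-dbl _ _ s)
    row _ (even {s = s} lt) = word-match-H (dbl (suc N)) (a (7 + dbl s))
      (cong (λ p → word 7 (nthB p)) (proj₁ (alternating-dbl rowPrefix pairPrefix s))) (row-H m s lt)
    row _ (odd {s = s} lt) = word-match (dbl (suc N)) (a (7 + suc (dbl s))) (here refl)
      (cong (λ p → word 7 (nthB p)) (proj₂ (alternating-dbl rowPrefix pairPrefix s))) (row-C m s lt)
    col : ∀ j → View (suc N) j → word (7 + dbl (suc T)) (λ i → a i j) ∈L crosswordRx
    col j (border lt) = word-match (dbl (suc T)) (λ i → a i j) (frameᵀ∈ j lt)
      (below7 {λ j → word 7 (λ i → a i j) ≡ nthW frameᵀ j} refl refl refl refl refl refl refl j lt)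
      (plus-match _ _ T (λ k → a (7 + k) j) λ s _ → values s j lt)
      where
      value : ∀ s j → nthB (alternating rowPrefix pairPrefix (dbl s)) j ≡ nthB rowPrefix j ×
                      nthB (alternating rowPrefix pairPrefix (suc (dbl s))) j ≡ nthB pairPrefix j
      value s j = cong (λ p → nthB p j) (proj₁ (alternating-dbl rowPrefix pairPrefix s)) ,
                  cong (λ p → nthB p j) (proj₂ (alternating-dbl rowPrefix pairPrefix s))
      values : ∀ s j → j < 7 → a (7 + dbl s) j ≡ nthB rowPrefix j × a (7 + suc (dbl s)) j ≡ nthB pairPrefix j
      values s = below7 (value s 0) (value s 1) (value s 2) (value s 3) (value s 4) (value s 5) (value s 6)
    col _ (even {s = s} lt) = word-match (dbl (suc T)) (λ i → a i (7 + dbl s)) (there (here refl))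
      (word-cong 7 {g = nthB colPrefix} (λ i → prefix i)) (col-A m s lt)
      where
      prefix : ∀ i → i < 7 → a i (7 + dbl s) ≡ nthB colPrefix i
      prefix = below7 (alt₁ 0) (alt₁ 1) (alt₁ 2) (alt₁ 3) (alt₁ 4) (alt₁ 5) (alt₁ 6)
        where alt₁ = λ i → proj₁ (alternating-dbl (nthB colPrefix i) (nthB pairPrefix i) s)
    col _ (odd {s = s} lt) = word-match (dbl (suc T)) (λ i → a i (7 + suc (dbl s))) (here refl)
      (word-cong 7 {g = nthB pairPrefix} (λ i → prefix i)) (col-C m s lt)
      where
      prefix : ∀ i → i < 7 → a i (7 + suc (dbl s)) ≡ nthB pairPrefix i
      prefix = below7 (alt₂ 0) (alt₂ 1) (alt₂ 2) (alt₂ 3) (alt₂ 4) (alt₂ 5) (alt₂ 6)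
        where alt₂ = λ i → proj₂ (alternating-dbl (nthB colPrefix i) (nthB pairPrefix i) s)

-- Main regions as cycles of words

-- The pairing is shifted by one against `pairs`: in these columns row `2s+1` is copied to row
-- `2s+2`, while the other columns copy row `2s` to row `2s+1`. The two outer zeros are the boundary
-- condition.
colRx : RegExp
colRx = lits (O ∷ []) ·· (pairs ·· lits (O ∷ []))

word-snoc : ∀ {X : Set} n (f : ℕ → X) → word (suc n) f ≡ word n f ++ f n ∷ []
word-snoc n f = sym (LP.applyUpTo-∷ʳ f n)

colRx-inv : ∀ T f → word (dbl (suc T)) f ∈L colRx →
            f 0 ≡ O × f (suc (dbl T)) ≡ O × (∀ s → s < T → f (suc (dbl s)) ≡ f (dbl (suc s)))
colRx-inv T f x with cat-inv x
... | u , v , e , y , z with lits-only _ y | cat-inv z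
... | refl | u′ , v′ , refl , y′ , z′ with lits-only _ z′
... | refl with LP.∷ʳ-injective _ u′ (trans (sym (word-snoc (dbl T) (f ∘ suc))) (∷-injectiveʳ e))
... | refl , last with pairs-inv (dbl T) (f ∘ suc) y′
... | N , eN , h with dbl-injective {T} {N} eN
... | refl = ∷-injectiveˡ e , last , h

colRx-match : ∀ T f → f 0 ≡ O → f (suc (dbl T)) ≡ O → (∀ s → s < T → f (suc (dbl s)) ≡ f (dbl (suc s))) → word (dbl (suc T)) f ∈L colRx
colRx-match T f e e′ h = subst (_∈L colRx)
  (cong₂ _∷_ (sym e) (trans (cong (λ b → word (dbl T) (f ∘ suc) ++ b ∷ []) (sym e′)) (sym (word-snoc (dbl T) (f ∘ suc)))))
  (m-cat (lits-match (O ∷ [])) (m-cat (pairs-match T (f ∘ suc) h) (lits-match (O ∷ []))))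

il : {X : Set} → (ℕ → X) → (ℕ → X) → ℕ → X
il x y zero          = x 0
il x y (suc zero)    = y 0
il x y (suc (suc k)) = il (x ∘ suc) (y ∘ suc) k

il-dbl : ∀ {X : Set} (x y : ℕ → X) q → il x y (dbl q) ≡ x q × il x y (suc (dbl q)) ≡ y q
il-dbl x y zero    = refl , refl
il-dbl x y (suc q) = il-dbl (x ∘ suc) (y ∘ suc) q

word-dbl : ∀ {X : Set} n (f : ℕ → X) x y → (∀ q → q < n → f (dbl q) ≡ x q) → (∀ q → q < n → f (suc (dbl q)) ≡ y q) →
           word (dbl n) f ≡ word (dbl n) (il x y)
word-dbl zero    f x y h h′ = refl
word-dbl (suc n) f x y h h′ = cong₂ _∷_ (h 0 (s≤s z≤n)) (cong₂ _∷_ (h′ 0 (s≤s z≤n))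
  (word-dbl n (f ∘ suc ∘ suc) (x ∘ suc) (y ∘ suc) (λ q lt → h (suc q) (s≤s lt)) (λ q lt → h′ (suc q) (s≤s lt))))

record Cycle (H : RegExp) (T N : ℕ) (y : ℕ → ℕ → Bool) : Set where
  constructor cycle
  field
    first : ∀ q → q < N → y 0 q ≡ O
    final : ∀ q → q < N → y T q ≡ O
    links : ∀ s → s < T → word (dbl N) (il (y s) (y (suc s))) ∈L H
open Cycle public

main⇒cycle : ∀ {H} T N d → Main H colRx (suc T) (suc N) d → ∃[ y ] Cycle H (suc T) (suc N) y
main⇒cycle {H} T N d m = y ,
  cycle (λ q lt → proj₁ (colA q lt)) (λ q lt → proj₁ (proj₂ (colA q lt)))
        (λ s lt → subst (_∈L H) (word-dbl (suc N) (d (dbl s)) (y s) (y (suc s)) (even-part s lt) (odd-part s lt)) (row-H m s lt))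
  where
  y : ℕ → ℕ → Bool
  y zero    q = d 0 (dbl q)
  -- The word is taken from the odd row, where it stands twice.
  y (suc s) q = d (suc (dbl s)) (dbl q)
  colA : ∀ q → q < suc N → d 0 (dbl q) ≡ O × d (suc (dbl T)) (dbl q) ≡ O × (∀ s → s < T → d (suc (dbl s)) (dbl q) ≡ d (dbl (suc s)) (dbl q))
  colA q lt = colRx-inv T (λ i → d i (dbl q)) (col-A m q lt)
  even-part : ∀ s → s < suc T → ∀ q → q < suc N → d (dbl s) (dbl q) ≡ y s q
  even-part zero    _        q lt = refl
  even-part (suc s) (s≤s l)  q lt = sym (proj₂ (proj₂ (colA q lt)) s l)
  odd-part : ∀ s → s < suc T → ∀ q → q < suc N → d (dbl s) (suc (dbl q)) ≡ y (suc s) q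
  odd-part s l q lt with pairs-inv (dbl (suc T)) (λ i → d i (suc (dbl q))) (col-C m q lt) | pairs-inv (dbl (suc N)) (d (suc (dbl s))) (row-C m s l)
  ... | T′ , e , h | N′ , e′ , h′ with dbl-injective {suc T} {T′} e | dbl-injective {suc N} {N′} e′
  -- Down the odd column from row `2s` to row `2s+1`, then along the pair in that row to the even
  -- column.
  ... | refl | refl = trans (h s l) (sym (h′ q lt))

rowsOf : (ℕ → ℕ → Bool) → ℕ → ℕ → Bool
rowsOf y zero          = il (y 0) (y 1)
rowsOf y (suc zero)    = il (y 1) (y 1)
rowsOf y (suc (suc i)) = rowsOf (y ∘ suc) i

rowsOf-dbl : ∀ y s → rowsOf y (dbl s) ≡ il (y s) (y (suc s)) × rowsOf y (suc (dbl s)) ≡ il (y (suc s)) (y (suc s))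
rowsOf-dbl y zero    = refl , refl
rowsOf-dbl y (suc s) = rowsOf-dbl (y ∘ suc) s

cycle⇒main : ∀ {H} T N y → Cycle H (suc T) (suc N) y → Main H colRx (suc T) (suc N) (rowsOf y)
cycle⇒main {H} T N y c = main
  (λ s lt → subst (λ f → word (dbl (suc N)) f ∈L H) (sym (proj₁ (rowsOf-dbl y s))) (links c s lt))
  (λ s lt → subst (λ f → word (dbl (suc N)) f ∈L pairs) (sym (proj₂ (rowsOf-dbl y s)))
              (pairs-match (suc N) (il (y (suc s)) (y (suc s))) (λ q _ → trans (proj₁ (il-dbl _ _ q)) (sym (proj₂ (il-dbl _ (y (suc s)) q))))))
  (λ q lt → colRx-match T (λ i → rowsOf y i (dbl q)) (trans (proj₁ (ev q 0)) (first c q lt)) (trans (proj₁ (od q T)) (final c q lt))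
              (λ s _ → trans (proj₁ (od q s)) (sym (proj₁ (ev q (suc s))))))
  (λ q lt → pairs-match (suc T) (λ i → rowsOf y i (suc (dbl q))) (λ s _ → trans (proj₂ (ev q s)) (sym (proj₂ (od q s)))))
  where
  ev : ∀ q s → rowsOf y (dbl s) (dbl q) ≡ y s q × rowsOf y (dbl s) (suc (dbl q)) ≡ y (suc s) q
  ev q s rewrite proj₁ (rowsOf-dbl y s) = il-dbl (y s) (y (suc s)) q
  od : ∀ q s → rowsOf y (suc (dbl s)) (dbl q) ≡ y (suc s) q × rowsOf y (suc (dbl s)) (suc (dbl q)) ≡ y (suc s) q
  od q s rewrite proj₂ (rowsOf-dbl y s) = il-dbl (y (suc s)) (y (suc s)) q

ilL : List Bool → List Bool → List Bool
ilL (x ∷ xs) (y ∷ ys) = x ∷ y ∷ ilL xs ys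
ilL _        _        = []

word-il : ∀ n x y → word (dbl n) (il x y) ≡ ilL (word n x) (word n y)
word-il zero    x y = refl
word-il (suc n) x y = cong (λ w → x 0 ∷ y 0 ∷ w) (word-il n (x ∘ suc) (y ∘ suc))

ilL-++ : ∀ a b {a′ b′} → length a ≡ length b → ilL (a ++ a′) (b ++ b′) ≡ ilL a b ++ ilL a′ b′
ilL-++ []      []      e = refl
ilL-++ (x ∷ a) (y ∷ b) e = cong (λ w → x ∷ y ∷ w) (ilL-++ a b (NP.suc-injective e))

ilL-injective : ∀ a b a′ b′ → length a ≡ length b → length a′ ≡ length b′ → ilL a b ≡ ilL a′ b′ → a ≡ a′ × b ≡ b′
ilL-injective []      []      []        []        _ _ e = refl , refl
ilL-injective []      []      []        (_ ∷ _)   _ () e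
ilL-injective []      []      (_ ∷ _)   []        _ () e
ilL-injective (x ∷ a) (y ∷ b) (x′ ∷ a′) (y′ ∷ b′) l l′ e
  with ilL-injective a b a′ b′ (NP.suc-injective l) (NP.suc-injective l′) (∷-injectiveʳ (∷-injectiveʳ e))
... | e₁ , e₂ = cong₂ _∷_ (∷-injectiveˡ e) e₁ , cong₂ _∷_ (∷-injectiveˡ (∷-injectiveʳ e)) e₂

∈-concatMap : ∀ {X Y : Set} (f : X → List Y) {xs x y} → x ∈ xs → y ∈ f x → y ∈ concatMap f xs
∈-concatMap f i j = ∈-concatMap⁺ f (Any.map (λ { refl → j }) i)

map-agree : ∀ {X Y : Set} {f g : X → Y} {xs x} → map f xs ≡ map g xs → x ∈ xs → f x ≡ g x
map-agree e (here refl) = ∷-injectiveˡ e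
map-agree e (there i)   = map-agree (∷-injectiveʳ e) i

∈-allSyms : ∀ s → s ∈ allSyms
∈-allSyms nothing      = here refl
∈-allSyms (just false) = there (here refl)
∈-allSyms (just true)  = there (there (here refl))

-- Turing machine computations as cycles

module _ (M : TM) where

  States : Set
  States = Fin (suc (nStates M))

  -- A cell of a configuration: a tape symbol, carrying the state if the head is there.
  Cell : Set
  Cell = Maybe States × Sym

  Letter : Set
  Letter = Maybe Cell

  pattern Z = nothing
  pattern cell s = just (nothing , s)
  pattern hd q s = just (just q , s)

  _≟ᶜ_ : (c d : Cell) → Dec (c ≡ d)
  _≟ᶜ_ = ProductP.≡-dec (MaybeP.≡-dec FP._≟_) (MaybeP.≡-dec _≟ᵇ_)

  marked : Maybe States → List Cell
  marked m = map (m ,_) allSyms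

  cellsOf : List Cell
  cellsOf = concatMap marked (nothing ∷ map just (allFin (suc (nStates M))))

  ∈-cellsOf : ∀ c → c ∈ cellsOf
  ∈-cellsOf (nothing , s) = ∈-concatMap marked {nothing ∷ map just (allFin (suc (nStates M)))} (here refl) (∈-map⁺ (nothing ,_) (∈-allSyms s))
  ∈-cellsOf (just q  , s) = ∈-concatMap marked {nothing ∷ map just (allFin (suc (nStates M)))} (there (∈-map⁺ just (∈-allFin q))) (∈-map⁺ (just q ,_) (∈-allSyms s))

  -- `Z` marks a place without a cell and differs from a cell with a blank symbol. As the only
  -- letter coded by zeros alone, it makes a zero line a word of `Z` of any length.
  code : Letter → List Bool
  code nothing  = map (λ _ → O) cellsOf
  code (just c) = map (λ d → does (c ≟ᶜ d)) cellsOf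

  codes : List Letter → List Bool
  codes = concatMap code

  length-code : ∀ a → length (code a) ≡ length cellsOf
  length-code nothing  = length-map _ cellsOf
  length-code (just c) = length-map _ cellsOf

  does-refl : ∀ c → does (c ≟ᶜ c) ≡ true
  does-refl c with c ≟ᶜ c
  ... | yes _ = refl
  ... | no ne = ⊥-elim (ne refl)

  code-injective : ∀ a b → code a ≡ code b → a ≡ b
  code-injective nothing  nothing  e = refl
  code-injective nothing  (just d) e = case trans (map-agree e (∈-cellsOf d)) (does-refl d) of λ ()
  code-injective (just c) nothing  e = case trans (sym (map-agree e (∈-cellsOf c))) (does-refl c) of λ ()
  code-injective (just c) (just d) e with d ≟ᶜ c | trans (sym (map-agree e (∈-cellsOf c))) (does-refl c)
  ... | yes refl | _ = refl

  codes-injective : ∀ xs ys → codes xs ≡ codes ys → xs ≡ ys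
  codes-injective [] [] e = refl
  codes-injective [] (nothing ∷ ys) ()
  codes-injective [] (just c ∷ ys) ()
  codes-injective (nothing ∷ xs) [] ()
  codes-injective (just c ∷ xs) [] ()
  codes-injective (x ∷ xs) (y ∷ ys) e with ++-split {code x} {p = code y} (trans (length-code x) (sym (length-code y))) e
  ... | e₁ , e₂ = cong₂ _∷_ (code-injective x y e₁) (codes-injective xs ys e₂)

  length-codes : ∀ xs → length (codes xs) ≡ length xs * length cellsOf
  length-codes []       = refl
  length-codes (x ∷ xs) = trans (length-++ (code x)) (cong₂ _+_ (length-code x) (length-codes xs))

  Blank : List Letter → Set
  Blank = All (_≡ Z)

  blank-codes : ∀ {xs} → Blank xs → All (_≡ O) (codes xs)
  blank-codes [] = []
  blank-codes (refl ∷ bs) = AllP.++⁺ (zeros cellsOf) (blank-codes bs)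
    where
    zeros : ∀ {X : Set} (xs : List X) → All (_≡ O) (map (λ _ → O) xs)
    zeros []       = []
    zeros (x ∷ xs) = refl ∷ zeros xs

  blank-codes⁻¹ : ∀ xs → All (_≡ O) (codes xs) → Blank xs
  blank-codes⁻¹ [] h = []
  blank-codes⁻¹ (nothing ∷ xs) h = refl ∷ blank-codes⁻¹ xs (AllP.++⁻ʳ (code nothing) h)
  blank-codes⁻¹ (just c ∷ xs) h = case trans (sym (All.lookup (AllP.++⁻ˡ (code (just c)) h) (subst (_∈ code (just c)) (does-refl c) (∈-map⁺ (λ d → does (c ≟ᶜ d)) (∈-cellsOf c))))) refl of λ ()

  Pairs : Set
  Pairs = List (Letter × Letter)

  bits : Pairs → List Bool
  bits []             = []
  bits ((a , b) ∷ ps) = ilL (code a) (code b) ++ bits ps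

  upper lower : Pairs → List Letter
  upper = map proj₁
  lower = map proj₂

  bits-il : ∀ ps → bits ps ≡ ilL (codes (upper ps)) (codes (lower ps))
  bits-il []             = refl
  bits-il ((a , b) ∷ ps) = trans (cong (ilL (code a) (code b) ++_) (bits-il ps))
                                 (sym (ilL-++ (code a) (code b) (trans (length-code a) (sym (length-code b)))))

  bits-++ : ∀ ps qs → bits (ps ++ qs) ≡ bits ps ++ bits qs
  bits-++ []             qs = refl
  bits-++ ((a , b) ∷ ps) qs = trans (cong (ilL (code a) (code b) ++_) (bits-++ ps qs)) (sym (++-assoc (ilL (code a) (code b)) _ _))

  length-codes-pairs : ∀ ps → length (codes (upper ps)) ≡ length (codes (lower ps))
  length-codes-pairs ps = trans (length-codes (upper ps)) (trans (cong (_* length cellsOf) (trans (length-map proj₁ ps) (sym (length-map proj₂ ps))))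
                                                                 (sym (length-codes (lower ps))))

  -- The change of a cell away from the head in the row of a move, of a halt and of the start.
  keep wipe fill-in : Sym → Letter × Letter
  keep s    = cell s , cell s
  wipe s    = cell s , Z
  fill-in s = Z , cell s

  -- The two cells touched by a move; `t` is the symbol of the cell entered, which must already be
  -- present in the row.
  window : States → Sym → States × Sym × Dir → Sym → Pairs
  window q s (q′ , s′ , R) t = (hd q s , cell s′) ∷ (cell t , hd q′ t) ∷ []
  window q s (q′ , s′ , L) t = (cell t , hd q′ t) ∷ (hd q s , cell s′) ∷ []

  anySym : (Sym → Letter × Letter) → RegExp
  anySym g = lits (bits (g nothing ∷ [])) ∣∣ (lits (bits (g (just false) ∷ [])) ∣∣ lits (bits (g (just true) ∷ [])))

  surrounded : (Sym → Letter × Letter) → Pairs → RegExp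
  surrounded g ps = star (anySym g) ·· (lits (bits ps) ·· star (anySym g))

  -- The start row may supply any number of blank cells on either side: this is where the space of
  -- the computation is guessed.
  blankRx : RegExp
  blankRx = star (lits (bits (fill-in nothing ∷ [])))

  inputRx : List Bool → RegExp
  inputRx []       = blankRx
  inputRx (b ∷ xs) = lits (bits (fill-in (just b) ∷ [])) ·· inputRx xs

  -- The first input symbol can be fixed, as all inputs in question begin with the home mark 1. The
  -- rest of the input is then a plain product of letters.
  start : Letter × Letter
  start = Z , hd F.zero (just true)

  initRx : List Bool → RegExp
  initRx xs = blankRx ·· (lits (bits (start ∷ [])) ·· inputRx xs)

  ruleRxs : States → Sym → Maybe (States × Sym × Dir) → List RegExp
  ruleRxs q s nothing  = surrounded wipe ((hd q s , Z) ∷ []) ∷ []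
  ruleRxs q s (just a) = map (λ t → surrounded keep (window q s a t)) allSyms

  stateRxs : States → List RegExp
  stateRxs q = concatMap (λ s → ruleRxs q s (δ M q s)) allSyms

  machineRxs : List RegExp
  machineRxs = concatMap stateRxs (allFin (suc (nStates M)))

  -- The input word is true ∷ xs.
  rowRx : List Bool → RegExp
  rowRx xs = alt machineRxs (initRx xs)

  data RowOf (xs : List Bool) : Pairs → Set where
    initial : ∀ i j → RowOf xs (replicate i (fill-in nothing) ++ start ∷ map (fill-in ∘ just) xs ++ replicate j (fill-in nothing))
    moved   : ∀ {q s a} t l r → δ M q s ≡ just a → RowOf xs (map keep l ++ window q s a t ++ map keep r)
    halted  : ∀ {q s} l r → δ M q s ≡ nothing → RowOf xs (map wipe l ++ (hd q s , Z) ∷ map wipe r)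

  star-anySym-inv : ∀ g {w} → w ∈L star (anySym g) → ∃[ ss ] w ≡ bits (map g ss)
  star-anySym-inv g m-star0 = [] , refl
  star-anySym-inv g (m-starS {u} {v} x y) with one x | star-anySym-inv g y
    where
    one : ∀ {u} → u ∈L anySym g → ∃[ s ] u ≡ bits (g s ∷ [])
    one (m-unionˡ z) = nothing , lits-only _ z
    one (m-unionʳ (m-unionˡ z)) = just false , lits-only _ z
    one (m-unionʳ (m-unionʳ z)) = just true , lits-only _ z
  ... | s , refl | ss , refl = s ∷ ss , sym (bits-++ (g s ∷ []) (map g ss))

  star-anySym : ∀ g ss → bits (map g ss) ∈L star (anySym g)
  star-anySym g []       = m-star0
  star-anySym g (s ∷ ss) = subst (_∈L star (anySym g)) (sym (bits-++ (g s ∷ []) (map g ss))) (m-starS (one s) (star-anySym g ss))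
    where
    one : ∀ s → bits (g s ∷ []) ∈L anySym g
    one nothing      = m-unionˡ (lits-match _)
    one (just false) = m-unionʳ (m-unionˡ (lits-match _))
    one (just true)  = m-unionʳ (m-unionʳ (lits-match _))

  surrounded-inv : ∀ g ps {w} → w ∈L surrounded g ps → ∃[ l ] ∃[ r ] w ≡ bits (map g l ++ ps ++ map g r)
  surrounded-inv g ps x with cat-inv x
  ... | _ , _ , refl , y , z with cat-inv z
  ... | _ , _ , refl , y′ , z′ with star-anySym-inv g y | lits-only (bits ps) y′ | star-anySym-inv g z′
  ... | l , refl | refl | r , refl = l , r , sym (trans (bits-++ (map g l) _) (cong (bits (map g l) ++_) (bits-++ ps (map g r))))

  surrounded-match : ∀ g ps l r → bits (map g l ++ ps ++ map g r) ∈L surrounded g ps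
  surrounded-match g ps l r = subst (_∈L surrounded g ps) (sym (trans (bits-++ (map g l) _) (cong (bits (map g l) ++_) (bits-++ ps (map g r)))))
    (m-cat (star-anySym g l) (m-cat (lits-match (bits ps)) (star-anySym g r)))

  blankRx-inv : ∀ {w} → w ∈L blankRx → ∃[ i ] w ≡ bits (replicate i (fill-in nothing))
  blankRx-inv m-star0 = 0 , refl
  blankRx-inv (m-starS x y) with lits-only _ x | blankRx-inv y
  ... | refl | i , refl = suc i , sym (bits-++ (fill-in nothing ∷ []) (replicate i (fill-in nothing)))

  blankRx-match : ∀ i → bits (replicate i (fill-in nothing)) ∈L blankRx
  blankRx-match zero    = m-star0
  blankRx-match (suc i) = subst (_∈L blankRx) (sym (bits-++ (fill-in nothing ∷ []) (replicate i (fill-in nothing)))) (m-starS (lits-match _) (blankRx-match i))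

  inputRx-inv : ∀ xs {w} → w ∈L inputRx xs → ∃[ j ] w ≡ bits (map (fill-in ∘ just) xs ++ replicate j (fill-in nothing))
  inputRx-inv []       x = blankRx-inv x
  inputRx-inv (b ∷ xs) x with cat-inv x
  ... | _ , _ , refl , y , z with lits-only _ y | inputRx-inv xs z
  ... | refl | j , refl = j , sym (bits-++ (fill-in (just b) ∷ []) (map (fill-in ∘ just) xs ++ replicate j (fill-in nothing)))

  inputRx-match : ∀ xs j → bits (map (fill-in ∘ just) xs ++ replicate j (fill-in nothing)) ∈L inputRx xs
  inputRx-match []       j = blankRx-match j
  inputRx-match (b ∷ xs) j = subst (_∈L inputRx (b ∷ xs)) (sym (bits-++ (fill-in (just b) ∷ []) (map (fill-in ∘ just) xs ++ replicate j (fill-in nothing)))) (m-cat (lits-match _) (inputRx-match xs j))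

  initial-bits : ∀ i ps → bits (replicate i (fill-in nothing) ++ start ∷ ps) ≡ bits (replicate i (fill-in nothing)) ++ bits (start ∷ []) ++ bits ps
  initial-bits i ps = trans (bits-++ (replicate i (fill-in nothing)) (start ∷ ps)) (cong (bits (replicate i (fill-in nothing)) ++_) (bits-++ (start ∷ []) ps))

  rowRx-inv : ∀ xs {w} → w ∈L rowRx xs → ∃[ ps ] RowOf xs ps × w ≡ bits ps
  rowRx-inv xs x with alt-inv machineRxs x
  rowRx-inv xs x | inj₂ y with cat-inv y
  ... | _ , _ , refl , y₁ , z with cat-inv z
  ... | _ , _ , refl , y₂ , y₃ with blankRx-inv y₁ | lits-only _ y₂ | inputRx-inv xs y₃
  ... | i , refl | refl | j , refl = _ , initial i j , sym (initial-bits i (map (fill-in ∘ just) xs ++ replicate j (fill-in nothing)))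
  rowRx-inv xs x | inj₁ (E , i , y) with find (∈-concatMap⁻ stateRxs {xs = allFin (suc (nStates M))} i)
  ... | q , _ , i′ with find (∈-concatMap⁻ (λ s → ruleRxs q s (δ M q s)) {xs = allSyms} i′)
  ... | s , _ , i″ = rule (δ M q s) refl i″
    where
    rule : ∀ a → δ M q s ≡ a → E ∈ ruleRxs q s a → ∃[ ps ] RowOf xs ps × _ ≡ bits ps
    rule nothing e (here refl) with surrounded-inv wipe _ y
    ... | l , r , eq = _ , halted l r e , eq
    rule (just a) e k with ∈-map⁻ (λ t → surrounded keep (window q s a t)) k
    ... | t , _ , refl with surrounded-inv keep (window q s a t) y
    ... | l , r , eq = _ , moved t l r e , eq

  rowRx-match : ∀ xs {ps} → RowOf xs ps → bits ps ∈L rowRx xs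
  rowRx-match xs (initial i j) = alt-last machineRxs (subst (_∈L initRx xs) (sym (initial-bits i (map (fill-in ∘ just) xs ++ replicate j (fill-in nothing))))
    (m-cat (blankRx-match i) (m-cat (lits-match (bits (start ∷ []))) (inputRx-match xs j))))
  rowRx-match xs (moved {q} {s} {a} t l r e) = alt-any {Fs = machineRxs}
    (∈-concatMap stateRxs (∈-allFin q) (∈-concatMap (λ s → ruleRxs q s (δ M q s)) (∈-allSyms s) (subst (λ m → surrounded keep (window q s a t) ∈ ruleRxs q s m) (sym e) (∈-map⁺ (λ t → surrounded keep (window q s a t)) (∈-allSyms t)))))
    (surrounded-match keep (window q s a t) l r)
  rowRx-match xs (halted {q} {s} l r e) = alt-any {Fs = machineRxs}
    (∈-concatMap stateRxs (∈-allFin q) (∈-concatMap (λ s → ruleRxs q s (δ M q s)) (∈-allSyms s) (subst (λ m → surrounded wipe ((hd q s , Z) ∷ []) ∈ ruleRxs q s m) (sym e) (here refl))))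
    (surrounded-match wipe ((hd q s , Z) ∷ []) l r)

  data Path (xs : List Bool) : ℕ → List Letter → List Letter → Set where
    stay : ∀ {x} → Path xs 0 x x
    link : ∀ {n x z} ps → RowOf xs ps → x ≡ upper ps → Path xs n (lower ps) z → Path xs (suc n) x z

  link-letters : ∀ xs N (x y : ℕ → Bool) → word (dbl N) (il x y) ∈L rowRx xs → ∃[ ps ] RowOf xs ps × codes (upper ps) ≡ word N x × codes (lower ps) ≡ word N y
  link-letters xs N x y m with rowRx-inv xs m
  ... | ps , r , e with ilL-injective (codes (upper ps)) (codes (lower ps)) (word N x) (word N y) (length-codes-pairs ps)
                          (trans (length-word N x) (sym (length-word N y))) (trans (sym (bits-il ps)) (trans (sym e) (word-il N x y)))
  ... | e₁ , e₂ = ps , r , e₁ , e₂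

  -- Neighbouring rows share a bit word, and by injectivity of `codes` they share the word of
  -- letters as well.
  links⇒path : ∀ xs N T (y : ℕ → ℕ → Bool) x → codes x ≡ word N (y 0) → (∀ s → s < T → word (dbl N) (il (y s) (y (suc s))) ∈L rowRx xs) →
               ∃[ z ] Path xs T x z × codes z ≡ word N (y T)
  links⇒path xs N zero    y x e h = x , stay , e
  links⇒path xs N (suc T) y x e h with link-letters xs N (y 0) (y 1) (h 0 (s≤s z≤n))
  ... | ps , r , e₁ , e₂ with links⇒path xs N T (y ∘ suc) (lower ps) e₂ (λ s lt → h (suc s) (s≤s lt))
  ... | z , p , e′ = z , link ps r (codes-injective x (upper ps) (trans e (sym e₁))) p , e′

  path⇒links : ∀ xs N T {x z} → Path xs T x z → length (codes x) ≡ N →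
               Σ (ℕ → ℕ → Bool) λ y → word N (y 0) ≡ codes x × word N (y T) ≡ codes z × (∀ s → s < T → word (dbl N) (il (y s) (y (suc s))) ∈L rowRx xs)
  path⇒links xs N zero {x} stay refl = (λ _ → nthB (codes x)) , word-nthB (codes x) , word-nthB (codes x) , λ _ ()
  path⇒links xs N (suc T) (link ps r refl p) e with path⇒links xs N T p (trans (sym (length-codes-pairs ps)) e)
  ... | y , e₀ , e₁ , h = y′ , first-word , e₁ , λ where
      zero    lt       → subst (_∈L rowRx xs) (trans (bits-il ps) (trans (sym (cong₂ ilL first-word e₀)) (sym (word-il N (y′ 0) (y 0))))) (rowRx-match xs r)
      (suc s) (s≤s lt) → h s lt
    where
    y′ : ℕ → ℕ → Bool
    y′ zero    = nthB (codes (upper ps))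
    y′ (suc s) = y s
    first-word : word N (y′ 0) ≡ codes (upper ps)
    first-word = trans (cong (λ n → word n (y′ 0)) (sym e)) (word-nthB (codes (upper ps)))

  BlankCycle : List Bool → Set
  BlankCycle xs = ∃[ T ] ∃[ x ] ∃[ z ] Path xs (suc T) x z × Blank x × Blank z × x ≢ []

  main⇒blankCycle : ∀ xs → MainExists (rowRx xs) colRx → BlankCycle xs
  main⇒blankCycle xs (T , N , d , m) with main⇒cycle T N d m
  ... | y , c with link-letters xs (suc N) (y 0) (y 1) (links c 0 (s≤s z≤n))
  ... | ps , r , e , _ with links⇒path xs (suc N) (suc T) y (upper ps) e (links c)
  ... | z , p , e′ = T , upper ps , z , p ,
        blank-codes⁻¹ _ (subst (All (_≡ O)) (sym e) (all-word (suc N) {y 0} (first c))) ,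
        blank-codes⁻¹ z (subst (All (_≡ O)) (sym e′) (all-word (suc N) {y (suc T)} (final c))) ,
        λ empty → case trans (sym (cong codes empty)) e of λ ()

  blankCycle⇒main : ∀ xs → BlankCycle xs → MainExists (rowRx xs) colRx
  blankCycle⇒main xs (T , x , z , p , bx , bz , ne) with long x ne
    where
    long : ∀ x → x ≢ [] → ∃[ N ] length (codes x) ≡ suc N
    long [] ne = ⊥-elim (ne refl)
    long (nothing ∷ x) ne = _ , refl
    long (just _ ∷ x) ne = _ , refl
  ... | N , e with path⇒links xs (suc N) (suc T) p e
  ... | y , e₀ , e₁ , h = T , N , rowsOf y , cycle⇒main T N y (cycle
        (λ q lt → trans (sym (nthB-word (suc N) (y 0) q lt)) (zero-at (word (suc N) (y 0)) q (subst (All (_≡ O)) (sym e₀) (blank-codes bx))))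
        (λ q lt → trans (sym (nthB-word (suc N) (y (suc T)) q lt)) (zero-at (word (suc N) (y (suc T))) q (subst (All (_≡ O)) (sym e₁) (blank-codes bz))))
        h)
    where
    zero-at : ∀ w k → All (_≡ O) w → nthB w k ≡ O
    zero-at []      k       h        = refl
    zero-at (b ∷ w) zero    (e ∷ _)  = e
    zero-at (b ∷ w) (suc k) (_ ∷ es) = zero-at w k es

-- Paths of configuration rows and Turing machine runs

module _ (M : TM) (xs : List Bool) where

  private
    St : Set
    St = States M

    Ltr : Set
    Ltr = Letter M

  cells : List Sym → List Ltr
  cells = map (λ s → cell s)

  -- ra and b are the stored cells left and right of the head, nearest first.
  row : List Sym → St → Sym → List Sym → List Ltr
  row ra q s b = cells (reverse ra) ++ hd q s ∷ cells b

  -- A row stores a fixed stretch of tape, a configuration only the cells it has lists for. They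
  -- agree when missing cells are read as blanks.
  data Sim : List Sym → St → Sym → List Sym → Config (nStates M) → Set where
    sim : ∀ {ra q s b l r} → (∀ k → nth l k ≡ nth ra k) → (∀ k → nth r k ≡ nth b k) → Sim ra q s b (conf q l s r)

  sim-R : ∀ {ra q b t l r s′} → (∀ k → nth l k ≡ nth ra k) → (∀ k → nth r k ≡ nth (t ∷ b) k) → Sim (s′ ∷ ra) q t b (move R q l s′ r)
  sim-R {r = []} h h′ with h′ 0
  ... | refl = sim (λ { zero → refl ; (suc k) → h k }) (λ k → h′ (suc k))
  sim-R {r = x ∷ r} h h′ with h′ 0
  ... | refl = sim (λ { zero → refl ; (suc k) → h k }) (λ k → h′ (suc k))

  sim-L : ∀ {ra q b t l r s′} → (∀ k → nth l k ≡ nth (t ∷ ra) k) → (∀ k → nth r k ≡ nth b k) → Sim ra q t (s′ ∷ b) (move L q l s′ r)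
  sim-L {l = []} h h′ with h 0
  ... | refl = sim (λ k → h (suc k)) (λ { zero → refl ; (suc k) → h′ k })
  sim-L {l = x ∷ l} h h′ with h 0
  ... | refl = sim (λ k → h (suc k)) (λ { zero → refl ; (suc k) → h′ k })

  -- A word with a single head decomposes in one way only, so the rule used in a row acts on the
  -- actual configuration.
  head-unique : ∀ a {q s b} a′ {q′ s′ b′} → cells a ++ hd q s ∷ cells b ≡ cells a′ ++ hd q′ s′ ∷ cells b′ →
                a ≡ a′ × q ≡ q′ × s ≡ s′ × b ≡ b′
  head-unique [] {b = b} [] {b′ = b′} e with ∷-injective e
  ... | refl , e′ = refl , refl , refl , cells-injective b b′ e′
    where
    cells-injective : ∀ b b′ → cells b ≡ cells b′ → b ≡ b′
    cells-injective [] [] e = refl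
    cells-injective (x ∷ b) (y ∷ b′) e with ∷-injective e
    ... | refl , e′ = cong (x ∷_) (cells-injective b b′ e′)
  head-unique (x ∷ a) (y ∷ a′) e with ∷-injective e
  ... | refl , e′ with head-unique a a′ e′
  ... | refl , rest = refl , rest
  head-unique [] (y ∷ a′) ()
  head-unique (x ∷ a) [] ()

  row-not-blank : ∀ a q s b → ¬ All (_≡ Z) (cells a ++ hd q s ∷ cells b)
  row-not-blank []      q s b (() ∷ _)
  row-not-blank (x ∷ a) q s b (() ∷ _)

  initial-blank : ∀ i j → Blank M (upper M (replicate i (fill-in M nothing) ++ start M ∷ map (fill-in M ∘ just) xs ++ replicate j (fill-in M nothing)))
  initial-blank (suc i) j = refl ∷ initial-blank i j
  initial-blank zero    j = refl ∷ input xs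
    where
    padding : ∀ j → Blank M (upper M (replicate j (fill-in M nothing)))
    padding zero    = []
    padding (suc j) = refl ∷ padding j
    input : ∀ w → Blank M (upper M (map (fill-in M ∘ just) w ++ replicate j (fill-in M nothing)))
    input []      = padding j
    input (b ∷ w) = refl ∷ input w

  around : (proj : Letter M × Letter M → Ltr) (g : Sym → Letter M × Letter M) → (∀ s → proj (g s) ≡ cell s) → ∀ l ps r →
           map proj (map g l ++ ps ++ map g r) ≡ cells l ++ map proj ps ++ cells r
  around proj g h l ps r = trans (map-++ proj (map g l) _) (cong₂ _++_ (plain l) (trans (map-++ proj ps _) (cong (map proj ps ++_) (plain r))))
    where
    plain : ∀ l → map proj (map g l) ≡ cells l
    plain []      = refl
    plain (s ∷ l) = cong₂ _∷_ (h s) (plain l)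

  cells-snoc : ∀ l t r → cells l ++ cell t ∷ r ≡ cells (l ++ t ∷ []) ++ r
  cells-snoc []      t r = refl
  cells-snoc (s ∷ l) t r = cong (cell s ∷_) (cells-snoc l t r)

  step-just : ∀ {q s q′ s′ d l r} → δ M q s ≡ just (q′ , s′ , d) → step M (conf q l s r) ≡ just (move d q′ l s′ r)
  step-just e rewrite e = refl

  step-nothing : ∀ {q s l r} → δ M q s ≡ nothing → step M (conf q l s r) ≡ nothing
  step-nothing e rewrite e = refl

  halts-step : ∀ {c c′} → step M c ≡ just c′ → Halts (step M) c′ → Halts (step M) c
  halts-step e (n , c″ , r , h) = suc n , c″ , next e r , h

  -- A word with a head cannot be followed by the start row, whose upper word is blank; so each row
  -- makes the move of the machine until a halting row occurs. One must occur, since the moves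
  -- preserve the head and the last word is blank.
  path-halts : ∀ {n x z} → Path M xs n x z → ∀ {ra q s b c} → x ≡ row ra q s b → Blank M z → Sim ra q s b c → Halts (step M) c
  path-halts stay {ra} {q} {s} {b} refl bz _ = ⊥-elim (row-not-blank (reverse ra) q s b bz)
  path-halts (link _ (initial i j) e p) {ra} {q} {s} {b} e′ bz _ =
    ⊥-elim (row-not-blank (reverse ra) q s b (subst (Blank M) (trans (sym e) e′) (initial-blank i j)))
  path-halts (link _ (halted {q₀} {s₀} l r δ≡) e p) {ra} {q} {s} {b} e′ bz (sim _ _)
    with head-unique l (reverse ra) (trans (sym (around proj₁ (wipe M) (λ _ → refl) l ((hd q₀ s₀ , Z) ∷ []) r)) (trans (sym e) e′))
  ... | _ , refl , refl , _ = 0 , _ , done , step-nothing δ≡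
  path-halts (link _ (moved {q₀} {s₀} {q′ , s′ , R} t l r δ≡) e p) {ra} {q} {s} {b} e′ bz (sim h h′)
    with head-unique l (reverse ra) (trans (sym (around proj₁ (keep M) (λ _ → refl) l (window M q₀ s₀ (q′ , s′ , R) t) r)) (trans (sym e) e′))
  ... | refl , refl , refl , refl = halts-step (step-just δ≡)
    (path-halts p (trans (around proj₂ (keep M) (λ _ → refl) l (window M q s (q′ , s′ , R) t) r)
                  (trans (cells-snoc l s′ _) (cong (λ a → cells a ++ hd q′ t ∷ cells r) (sym (unfold-reverse s′ ra)))))
                bz (sim-R {ra = ra} h h′))
  path-halts (link _ (moved {q₀} {s₀} {q′ , s′ , L} t l r δ≡) e p) {ra} {q} {s} {b} e′ bz (sim {l = lf} h h′)
    with head-unique (l ++ t ∷ []) (reverse ra) (trans (sym (cells-snoc l t _))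
           (trans (sym (around proj₁ (keep M) (λ _ → refl) l (window M q₀ s₀ (q′ , s′ , L) t) r)) (trans (sym e) e′)))
  ... | e₁ , refl , refl , refl = halts-step (step-just δ≡)
    (path-halts p (trans (around proj₂ (keep M) (λ _ → refl) l (window M q s (q′ , s′ , L) t) r)
                         (cong (λ a → cells a ++ hd q′ t ∷ cells (s′ ∷ r)) (sym (LP.reverse-involutive l))))
                bz (sim-L {ra = reverse l} {t = t} (subst (λ a → ∀ k → nth lf k ≡ nth a k) ra≡ h) h′))
    where
    ra≡ : ra ≡ t ∷ reverse l
    ra≡ = trans (sym (LP.reverse-involutive ra)) (trans (cong reverse (sym e₁)) (reverse-++ l (t ∷ [])))

  -- A move uses up at most one stored cell on one side, so `n` cells on both sides suffice for `n`
  -- moves.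
  run-path : ∀ {n c c′} → Reach (step M) n c c′ → step M c′ ≡ nothing → ∀ {ra q s b} → Sim ra q s b c → n ≤ length ra → n ≤ length b →
             ∃[ z ] Path M xs (suc n) (row ra q s b) z × Blank M z
  run-path done h {ra} {q} {s} {b} (sim {l = lf} {rt} _ _) le le′ = lower M ps , link ps (halted (reverse ra) b (no-move h))
      (sym (around proj₁ (wipe M) (λ _ → refl) (reverse ra) ((hd q s , Z) ∷ []) b)) stay , wiped (reverse ra)
    where
    ps = map (wipe M) (reverse ra) ++ (hd q s , Z) ∷ map (wipe M) b
    no-move : step M (conf q lf s rt) ≡ nothing → δ M q s ≡ nothing
    no-move e with δ M q s
    ... | nothing = refl
    wiped : ∀ a → Blank M (lower M (map (wipe M) a ++ (hd q s , Z) ∷ map (wipe M) b))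
    wiped (_ ∷ a) = refl ∷ wiped a
    wiped [] = refl ∷ right-part b
      where
      right-part : ∀ b → Blank M (lower M (map (wipe M) b))
      right-part []      = []
      right-part (_ ∷ b) = refl ∷ right-part b
  run-path (next {n = n} e r) h {ra} {q} {s} {b} (sim {l = lf} {rt} hl hr) le le′ = by-move (δ M q s) refl ra le hl b le′ hr
    where
    by-move : ∀ a → δ M q s ≡ a → ∀ ra → suc n ≤ length ra → (∀ k → nth lf k ≡ nth ra k) → ∀ b → suc n ≤ length b → (∀ k → nth rt k ≡ nth b k) →
              ∃[ z ] Path M xs (suc (suc n)) (row ra q s b) z × Blank M z
    by-move nothing d = case trans (sym (step-nothing d)) e of λ ()
    by-move (just (q′ , s′ , R)) d ra le hl (t ∷ b′) (s≤s le″) hr =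
      let (z , p , bz) = run-path (subst (λ c → Reach (step M) n c _) (just-injective (trans (sym e) (step-just d))) r) h {s′ ∷ ra} {q′} {t} {b′}
                           (sim-R {ra = ra} hl hr) (≤-trans (NP.n≤1+n _) (≤-trans le (NP.n≤1+n _))) le″
      in z , link _ (moved t (reverse ra) b′ d) (sym (around proj₁ (keep M) (λ _ → refl) (reverse ra) (window M q s (q′ , s′ , R) t) b′))
               (subst (λ x → Path M xs (suc n) x z) (sym (trans (around proj₂ (keep M) (λ _ → refl) (reverse ra) (window M q s (q′ , s′ , R) t) b′)
                 (trans (cells-snoc (reverse ra) s′ _) (cong (λ a → cells a ++ hd q′ t ∷ cells b′) (sym (unfold-reverse s′ ra)))))) p) , bz
    by-move (just (q′ , s′ , L)) d (t ∷ ra′) (s≤s le″) hl b le′ hr =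
      let (z , p , bz) = run-path (subst (λ c → Reach (step M) n c _) (just-injective (trans (sym e) (step-just d))) r) h {ra′} {q′} {t} {s′ ∷ b}
                           (sim-L {ra = ra′} hl hr) le″ (≤-trans (NP.n≤1+n _) (≤-trans le′ (NP.n≤1+n _)))
      in z , link _ (moved t (reverse ra′) b d)
               (sym (trans (around proj₁ (keep M) (λ _ → refl) (reverse ra′) (window M q s (q′ , s′ , L) t) b)
                    (trans (cells-snoc (reverse ra′) t _) (cong (λ a → cells a ++ hd q s ∷ cells b) (sym (unfold-reverse t ra′))))))
               (subst (λ x → Path M xs (suc n) x z) (sym (around proj₂ (keep M) (λ _ → refl) (reverse ra′) (window M q s (q′ , s′ , L) t) b)) p) , bz

  nth-blanks : ∀ i k → nth (replicate i nothing) k ≡ nothing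
  nth-blanks zero    k       = refl
  nth-blanks (suc i) zero    = refl
  nth-blanks (suc i) (suc k) = nth-blanks i k

  nth-padded : ∀ w j k → nth (map just w) k ≡ nth (map just w ++ replicate j nothing) k
  nth-padded []      j k       = sym (nth-blanks j k)
  nth-padded (b ∷ w) j zero    = refl
  nth-padded (b ∷ w) j (suc k) = nth-padded w j k

  reverse-replicate : ∀ {X : Set} n (x : X) → reverse (replicate n x) ≡ replicate n x
  reverse-replicate zero    x = refl
  reverse-replicate (suc n) x = trans (unfold-reverse x (replicate n x)) (trans (cong (_++ x ∷ []) (reverse-replicate n x)) (snoc n))
    where
    snoc : ∀ n → replicate n x ++ x ∷ [] ≡ replicate (suc n) x
    snoc zero    = refl
    snoc (suc n) = cong (x ∷_) (snoc n)

  initial-row : ∀ i j → lower M (replicate i (fill-in M nothing) ++ start M ∷ map (fill-in M ∘ just) xs ++ replicate j (fill-in M nothing)) ≡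
                        row (replicate i nothing) F.zero (just true) (map just xs ++ replicate j nothing)
  initial-row i j = trans (left-part i) (cong (λ a → cells a ++ hd F.zero (just true) ∷ cells (map just xs ++ replicate j nothing)) (sym (reverse-replicate i nothing)))
    where
    padding : ∀ j → lower M (replicate j (fill-in M nothing)) ≡ cells (replicate j nothing)
    padding zero    = refl
    padding (suc j) = cong (cell nothing ∷_) (padding j)
    input : ∀ w → lower M (map (fill-in M ∘ just) w ++ replicate j (fill-in M nothing)) ≡ cells (map just w ++ replicate j nothing)
    input []      = padding j
    input (b ∷ w) = cong (cell (just b) ∷_) (input w)
    left-part : ∀ i → lower M (replicate i (fill-in M nothing) ++ start M ∷ map (fill-in M ∘ just) xs ++ replicate j (fill-in M nothing)) ≡
                      cells (replicate i nothing) ++ hd F.zero (just true) ∷ cells (map just xs ++ replicate j nothing)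
    left-part zero    = cong (hd F.zero (just true) ∷_) (input xs)
    left-part (suc i) = cong (cell nothing ∷_) (left-part i)

  initial-sim : ∀ i j → Sim (replicate i nothing) F.zero (just true) (map just xs ++ replicate j nothing) (initConf (true ∷ xs))
  initial-sim i j = sim (λ k → sym (nth-blanks i k)) (nth-padded xs j)

  upper-not-blank : ∀ (g : Sym → Letter M × Letter M) l p r → (∀ s → proj₁ (g s) ≢ Z) → proj₁ p ≢ Z → ¬ Blank M (upper M (map g l ++ p ∷ r))
  upper-not-blank g []      p r h ne (e ∷ _) = ne e
  upper-not-blank g (s ∷ l) p r h ne (e ∷ _) = h s e

  -- The first word is blank, whereas the upper word of a move or a halt contains the head; hence
  -- the path must open with the start row.
  blankCycle⇒halts : BlankCycle M xs → HaltsOn M (true ∷ xs)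
  blankCycle⇒halts (T , x , z , link _ (initial i j) refl p , bx , bz , ne) =
    halts⇒haltsOn M (true ∷ xs) (path-halts p (initial-row i j) bz (initial-sim i j))
  blankCycle⇒halts (T , x , z , link _ (halted l r _) refl p , bx , bz , ne) =
    ⊥-elim (upper-not-blank (wipe M) l _ (map (wipe M) r) (λ _ ()) (λ ()) bx)
  blankCycle⇒halts (T , x , z , link _ (moved {q} {s} {q′ , s′ , R} t l r _) refl p , bx , bz , ne) =
    ⊥-elim (upper-not-blank (keep M) l _ ((cell t , hd q′ t) ∷ map (keep M) r) (λ _ ()) (λ ()) bx)
  blankCycle⇒halts (T , x , z , link _ (moved {q} {s} {q′ , s′ , L} t l r _) refl p , bx , bz , ne) =
    ⊥-elim (upper-not-blank (keep M) l _ ((hd q s , cell s′) ∷ map (keep M) r) (λ _ ()) (λ ()) bx)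

  halts⇒blankCycle : HaltsOn M (true ∷ xs) → BlankCycle M xs
  halts⇒blankCycle hw with haltsOn⇒halts M (true ∷ xs) hw
  -- As many blanks on each side as there are moves.
  ... | n , c , r , h with run-path r h (initial-sim n n) (NP.≤-reflexive (sym (LP.length-replicate n)))
                            (subst (n ≤_) (sym (length-++ (map just xs))) (subst (λ m → n ≤ length (map just xs) + m) (sym (LP.length-replicate n)) (m≤n+m n _)))
  ... | z , p , bz = suc n , _ , z , link _ (initial n n) refl (subst (λ x → Path M xs (suc n) x z) (sym (initial-row n n)) p) , initial-blank n n , bz ,
                     not-empty n
    where
    not-empty : ∀ i {ps} → upper M (replicate i (fill-in M nothing) ++ start M ∷ ps) ≢ []
    not-empty zero    ()
    not-empty (suc i) ()

  machineRx : RegExp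
  machineRx = crosswordRx (rowRx M xs) colRx

  crossword⇔halts : CrosswordExists machineRx ⇔ HaltsOn M (true ∷ xs)
  crossword⇔halts = mk⇔ (λ x → blankCycle⇒halts (main⇒blankCycle M xs (crossword⇒main (rowRx M xs) colRx x)))
                        (λ h → main⇒crossword (rowRx M xs) colRx (blankCycle⇒main M xs (halts⇒blankCycle h)))

-- The code of the crossword expression as a letterwise substitution

module _ (M : TM) where

  altPrefix : List RegExp → List Bool
  altPrefix []       = []
  altPrefix (E ∷ Es) = false ∷ true ∷ true ∷ encRegExp E ++ altPrefix Es

  enc-alt : ∀ Es E → encRegExp (alt Es E) ≡ altPrefix Es ++ encRegExp E
  enc-alt []       E = refl
  enc-alt (F ∷ Es) E = cong (λ v → false ∷ true ∷ true ∷ v)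
    (trans (cong (encRegExp F ++_) (enc-alt Es E)) (sym (++-assoc (encRegExp F) (altPrefix Es) (encRegExp E))))

  catPrefix : RegExp → List Bool
  catPrefix E = true ∷ false ∷ false ∷ encRegExp E

  letterCode : Bool → List Bool
  letterCode b = catPrefix (lits (bits M (fill-in M (just b) ∷ [])))

  -- In prefix notation a product nested to the right is coded by a sequence of independent blocks,
  -- one for each letter.
  enc-input : ∀ xs → encRegExp (inputRx M xs) ≡ concatMap letterCode xs ++ encRegExp (blankRx M)
  enc-input []       = refl
  enc-input (b ∷ xs) = trans (cong (letterCode b ++_) (enc-input xs)) (sym (++-assoc (letterCode b) (concatMap letterCode xs) (encRegExp (blankRx M))))

  rxPrefix : List Bool
  rxPrefix = altPrefix (map guarded (components colRx colRx)) ++ catPrefix (lits rowPrefix) ++ altPrefix (machineRxs M) ++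
             catPrefix (blankRx M) ++ catPrefix (lits (bits M (start M ∷ [])))

  enc-machineRx : ∀ xs → encRegExp (machineRx M xs) ≡ rxPrefix ++ concatMap letterCode xs ++ encRegExp (blankRx M)
  enc-machineRx xs = begin
    encRegExp (machineRx M xs)                              ≡⟨ enc-alt (map guarded (components colRx colRx)) (lits rowPrefix ·· rowRx M xs) ⟩
    a ++ b ++ encRegExp (rowRx M xs)                        ≡⟨ cong (λ v → a ++ b ++ v) (enc-alt (machineRxs M) (initRx M xs)) ⟩
    a ++ b ++ c ++ d ++ e ++ encRegExp (inputRx M xs)       ≡⟨ cong (λ v → a ++ b ++ c ++ d ++ e ++ v) (enc-input xs) ⟩
    a ++ b ++ c ++ d ++ e ++ f                              ≡⟨ cong (λ v → a ++ b ++ c ++ v) (++-assoc d e f) ⟨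
    a ++ b ++ c ++ (d ++ e) ++ f                            ≡⟨ cong (λ v → a ++ b ++ v) (++-assoc c (d ++ e) f) ⟨
    a ++ b ++ (c ++ d ++ e) ++ f                            ≡⟨ cong (a ++_) (++-assoc b (c ++ d ++ e) f) ⟨
    a ++ (b ++ c ++ d ++ e) ++ f                            ≡⟨ ++-assoc a (b ++ c ++ d ++ e) f ⟨
    rxPrefix ++ f                                           ∎
    where
    open ≡-Reasoning
    a b c d e f : List Bool
    a = altPrefix (map guarded (components colRx colRx))
    b = catPrefix (lits rowPrefix)
    c = altPrefix (machineRxs M)
    d = catPrefix (blankRx M)
    e = catPrefix (lits (bits M (start M ∷ [])))
    f = concatMap letterCode xs ++ encRegExp (blankRx M)

-- Encodings of data as trees

v : ∀ {n} m {m<n : True (m <? n)} → Tm n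
v m {m<n} = var (F.#_ m {m<n = m<n})

bitT : Bool → Tree
bitT false = leaf
bitT true  = node leaf leaf

listT : {X : Set} → (X → Tree) → List X → Tree
listT enc []       = leaf
listT enc (x ∷ xs) = node (enc x) (listT enc xs)

bitsT : List Bool → Tree
bitsT = listT bitT

wordsT : List (List Bool) → Tree
wordsT = listT bitsT

foldT-listT : ∀ {X Y : Set} {enc : X → Tree} {encY : Y → Tree} {f : Y → X → Y} (g : Tree → Tree → Tree) →
              (∀ x y → g (enc x) (encY y) ≡ encY (f y x)) → ∀ y xs → foldT g (encY y) (listT enc xs) ≡ encY (foldl f y xs)
foldT-listT g h y []       = refl
foldT-listT {enc = enc} {encY} {f} g h y (x ∷ xs) rewrite h x y = foldT-listT g h (f y x) xs

first₂ : ∀ {n} → Fin 2 → Fin (2 + n)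
first₂ F.zero    = F.zero
first₂ (F.suc _) = F.suc F.zero

call₁ : ∀ {n} → Tm 1 → Tm n → Tm n
call₁ f e = letᵗ e (ren f (λ _ → F.zero))

swap₂ : ∀ {n} → Fin 2 → Fin (2 + n)
swap₂ F.zero    = F.suc F.zero
swap₂ (F.suc _) = F.zero

call₂ : ∀ {n} → Tm 2 → Tm n → Tm n → Tm n
call₂ f a b = letᵗ a (letᵗ (ren b F.suc) (ren f swap₂))

inc : List Bool → List Bool
inc []           = false ∷ []
inc (false ∷ bs) = true ∷ bs
inc (true ∷ bs)  = false ∷ inc bs

-- Bijective base 2 with digits 1 and 2, least significant first. Every bit list has its own number
-- and `inc` is the successor, so counting from the empty list meets all lists.
rank : List Bool → ℕ
rank []           = 0
rank (false ∷ bs) = 1 + (rank bs + rank bs)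
rank (true ∷ bs)  = 2 + (rank bs + rank bs)

rank-inc : ∀ bs → rank (inc bs) ≡ suc (rank bs)
rank-inc []           = refl
rank-inc (false ∷ bs) = refl
rank-inc (true ∷ bs)  rewrite rank-inc bs = cong (suc ∘ suc) (+-suc (rank bs) (rank bs))

rank-injective : ∀ bs cs → rank bs ≡ rank cs → bs ≡ cs
rank-injective [] [] e = refl
rank-injective [] (false ∷ cs) ()
rank-injective [] (true ∷ cs) ()
rank-injective (false ∷ bs) [] ()
rank-injective (true ∷ bs) [] ()
-- The argument 0 instantiates the number of stacks, the parameter under which the arithmetic of
-- doubles was proved.
rank-injective (false ∷ bs) (false ∷ cs) e = cong (false ∷_) (rank-injective bs cs (double-injective 0 _ _ (NP.suc-injective e)))
rank-injective (true ∷ bs) (true ∷ cs) e = cong (true ∷_) (rank-injective bs cs (double-injective 0 _ _ (NP.suc-injective (NP.suc-injective e))))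
rank-injective (false ∷ bs) (true ∷ cs) e = ⊥-elim (even≢odd 0 (rank bs) (rank cs) (NP.suc-injective e))
rank-injective (true ∷ bs) (false ∷ cs) e = ⊥-elim (even≢odd 0 (rank cs) (rank bs) (sym (NP.suc-injective e)))

reverseᵗ : Tm 1
reverseᵗ = foldᵗ (v 0) leafᵗ (nodeᵗ (v 0) (v 1))

reverse-eval : ∀ {X : Set} (enc : X → Tree) xs ρ → ρ F.zero ≡ listT enc xs → eval reverseᵗ ρ ≡ listT enc (reverse xs)
reverse-eval enc xs ρ e rewrite e = foldT-listT {enc = enc} {encY = listT enc} {f = λ ys x → x ∷ ys} _ (λ x y → refl) [] xs

-- The state of the increment is the carry and the reversed output.
incStep : Bool × List Bool → Bool → Bool × List Bool
incStep (true , out)  false = false , true ∷ out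
incStep (true , out)  true  = true , false ∷ out
incStep (false , out) b     = false , b ∷ out

incStepᵗ : Tm 3
incStepᵗ = caseᵗ (v 1) leafᵗ (caseᵗ (v 0) (nodeᵗ leafᵗ (nodeᵗ (v 2) (v 1)))
  (caseᵗ (v 4) (nodeᵗ leafᵗ (nodeᵗ (nodeᵗ leafᵗ leafᵗ) (v 3))) (nodeᵗ (nodeᵗ leafᵗ leafᵗ) (nodeᵗ leafᵗ (v 5)))))

incᵗ : Tm 1
incᵗ = caseᵗ (foldᵗ (v 0) (nodeᵗ (nodeᵗ leafᵗ leafᵗ) leafᵗ) incStepᵗ) leafᵗ
  (caseᵗ (v 0) (call₁ reverseᵗ (v 1)) (call₁ reverseᵗ (nodeᵗ leafᵗ (v 3))))

carryT : Bool × List Bool → Tree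
carryT (c , out) = node (bitT c) (bitsT out)

inc-fold : ∀ c out bs → let (c′ , out′) = foldl incStep (c , out) bs in
           reverse (if c′ then false ∷ out′ else out′) ≡ out ʳ++ (if c then inc bs else bs)
inc-fold true  out [] = trans (LP.ʳ++-defn (false ∷ out)) (++-identityʳ _)
inc-fold false out [] = refl
inc-fold true  out (false ∷ bs) = inc-fold false (true ∷ out) bs
inc-fold true  out (true ∷ bs)  = inc-fold true (false ∷ out) bs
inc-fold false out (b ∷ bs)     = inc-fold false (b ∷ out) bs

inc-eval : ∀ bs ρ → ρ F.zero ≡ bitsT bs → eval incᵗ ρ ≡ bitsT (inc bs)
inc-eval bs ρ e rewrite e
  | foldT-listT {enc = bitT} {encY = carryT} {f = incStep} (λ x acc → eval incStepᵗ (x ◂ acc ◂ ρ))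
      (λ { false (true , out) → refl ; true (true , out) → refl ; b (false , out) → refl }) (true , []) bs
  = trans (finish (foldl incStep (true , []) bs)) (cong bitsT (inc-fold true [] bs))
  where
  finish : ∀ s → eval {2 + 1} (caseᵗ (v 0) (call₁ reverseᵗ (v 1)) (call₁ reverseᵗ (nodeᵗ leafᵗ (v 3)))) (bitT (proj₁ s) ◂ bitsT (proj₂ s) ◂ ρ) ≡
                 bitsT (reverse (if proj₁ s then false ∷ proj₂ s else proj₂ s))
  finish (true , out)  = reverse-eval bitT (false ∷ out) (λ _ → bitsT (false ∷ out)) refl
  finish (false , out) = reverse-eval bitT out (λ _ → bitsT out) refl

-- Exhaustive search for a bit list accepted by a test

module _ (testᵗ : Tm 2) where

  searchᵗ : Tm 1
  searchᵗ = caseᵗ (v 0) leafᵗ (caseᵗ (ren testᵗ first₂) (nodeᵗ (call₁ incᵗ (v 0)) (v 1)) leafᵗ)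

  module _ (w : Tree) (test : List Bool → Bool) (test-eval : ∀ c ρ → ρ F.zero ≡ bitsT c → ρ (F.suc F.zero) ≡ w → eval testᵗ ρ ≡ bitT (test c)) where

    search-step : ∀ c → apply searchᵗ (node (bitsT c) w) ≡ (if test c then leaf else node (bitsT (inc c)) w)
    search-step c = trans
      (cong (λ t → caseT t (node (eval incᵗ (λ _ → bitsT c)) w) (λ _ _ → leaf)) (test-eval c ((bitsT c ◂ w ◂ (λ (_ : Fin 1) → node (bitsT c) w)) ∘ first₂) refl refl))
      (finish (test c))
      where
      finish : ∀ b → caseT (bitT b) (node (eval incᵗ (λ _ → bitsT c)) w) (λ _ _ → leaf) ≡ (if b then leaf else node (bitsT (inc c)) w)
      finish true  = refl
      finish false = cong (λ t → node t w) (inc-eval c (λ _ → bitsT c) refl)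

    search-sound : ∀ k c → iterate (apply searchᵗ) (node (bitsT c) w) k ≡ leaf → ∃[ c′ ] test c′ ≡ true
    search-sound zero c ()
    search-sound (suc k) c e rewrite search-step c with test c in eq
    ... | true  = c , eq
    ... | false = search-sound k (inc c) e

    -- Induction on the distance in rank to a known witness; an accepted list met earlier ends the
    -- search as well.
    search-complete : ∀ d c c′ → rank c + d ≡ rank c′ → test c′ ≡ true → ∃[ k ] iterate (apply searchᵗ) (node (bitsT c) w) k ≡ leaf
    search-complete d c c′ e t with test c in eq
    ... | true = 1 , trans (search-step c) (cong (λ b → if b then leaf else node (bitsT (inc c)) w) eq)
    search-complete zero c c′ e t | false with rank-injective c c′ (trans (sym (+-identityʳ _)) e)
    ... | refl = case trans (sym eq) t of λ ()
    search-complete (suc d) c c′ e t | false with search-complete d (inc c) c′ (trans (cong (_+ d) (rank-inc c)) (trans (sym (+-suc (rank c) d)) e)) t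
    ... | k , h = suc k , trans (cong (λ t → iterate (apply searchᵗ) t k) (trans (search-step c) (cong (λ b → if b then leaf else node (bitsT (inc c)) w) eq))) h

-- Parsing regular expressions

rxT : RegExp → Tree
rxT (lit b)  = node leaf (bitT b)
rxT eps      = node (node leaf leaf) leaf
rxT (E ∣∣ F) = node (node leaf (node leaf leaf)) (node (rxT E) (rxT F))
rxT (E ·· F) = node (node leaf (node leaf (node leaf leaf))) (node (rxT E) (rxT F))
rxT (star E) = node (node leaf (node leaf (node leaf (node leaf leaf)))) (rxT E)

unaryᵗ : ∀ {n} → ℕ → Tm n
unaryᵗ zero    = leafᵗ
unaryᵗ (suc k) = nodeᵗ leafᵗ (unaryᵗ k)

-- The code is read backwards: its tokens have three bits each, and in front of a token the operands are on the stack.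
parseStepᵗ : Tm 2
parseStepᵗ = caseᵗ (v 1) leafᵗ
  (caseᵗ (v 0) (nodeᵗ (nodeᵗ (v 2) leafᵗ) (v 1))
  (caseᵗ (v 1) (nodeᵗ (nodeᵗ (v 4) (nodeᵗ (v 0) leafᵗ)) (v 3))
  (caseᵗ (v 6)
    (caseᵗ (v 2)
      (pushed (nodeᵗ leafᵗ (v 0)) (v 5))
      (caseᵗ (v 2)
        (pushed (nodeᵗ (unaryᵗ 1) leafᵗ) (v 7))
        (caseᵗ (v 9) leafᵗ (caseᵗ (v 1) leafᵗ (pushed (nodeᵗ (unaryᵗ 2) (nodeᵗ (v 2) (v 0))) (v 1))))))
    (caseᵗ (v 2)
      (caseᵗ (v 7) leafᵗ (caseᵗ (v 1) leafᵗ (pushed (nodeᵗ (unaryᵗ 3) (nodeᵗ (v 2) (v 0))) (v 1))))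
      (caseᵗ (v 9) leafᵗ (pushed (nodeᵗ (unaryᵗ 4) (v 0)) (v 1)))))))
  where
  pushed : ∀ {n} → Tm n → Tm n → Tm n
  pushed r s = nodeᵗ leafᵗ (nodeᵗ r s)

noEnv : Env 0
noEnv ()

parseStep : Tree → Tree → Tree
parseStep x s = eval parseStepᵗ (x ◂ s ◂ noEnv)

unary-code : ∀ tok E rest → reverse (tok ++ encRegExp E) ++ rest ≡ reverse (encRegExp E) ++ reverse tok ++ rest
unary-code tok E rest = trans (cong (_++ rest) (reverse-++ tok (encRegExp E))) (++-assoc (reverse (encRegExp E)) (reverse tok) rest)

binary-code : ∀ tok E F rest → reverse (tok ++ encRegExp E ++ encRegExp F) ++ rest ≡
                               reverse (encRegExp F) ++ reverse (encRegExp E) ++ reverse tok ++ rest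
binary-code tok E F rest = begin
  reverse (tok ++ encRegExp E ++ encRegExp F) ++ rest          ≡⟨ cong (λ w → reverse w ++ rest) (++-assoc tok (encRegExp E) (encRegExp F)) ⟨
  reverse ((tok ++ encRegExp E) ++ encRegExp F) ++ rest        ≡⟨ unary-code (tok ++ encRegExp E) F rest ⟩
  reverse (encRegExp F) ++ reverse (tok ++ encRegExp E) ++ rest ≡⟨ cong (reverse (encRegExp F) ++_) (unary-code tok E rest) ⟩
  reverse (encRegExp F) ++ reverse (encRegExp E) ++ reverse tok ++ rest ∎
  where open ≡-Reasoning

-- Backwards, the prefix code is a postfix code, for which a stack suffices. The `leaf` in the first
-- component says that no token has been begun.
parse-rx : ∀ E rest stk → foldT parseStep (node leaf stk) (bitsT (reverse (encRegExp E) ++ rest)) ≡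
                          foldT parseStep (node leaf (node (rxT E) stk)) (bitsT rest)
parse-rx (lit false) rest stk = refl
parse-rx (lit true)  rest stk = refl
parse-rx eps         rest stk = refl
parse-rx (E ∣∣ F)    rest stk = trans (cong (λ w → foldT parseStep (node leaf stk) (bitsT w)) (binary-code (false ∷ true ∷ true ∷ []) E F rest))
                               (trans (parse-rx F _ stk) (parse-rx E _ (node (rxT F) stk)))
parse-rx (E ·· F)    rest stk = trans (cong (λ w → foldT parseStep (node leaf stk) (bitsT w)) (binary-code (true ∷ false ∷ false ∷ []) E F rest))
                               (trans (parse-rx F _ stk) (parse-rx E _ (node (rxT F) stk)))
parse-rx (star E)    rest stk = trans (cong (λ w → foldT parseStep (node leaf stk) (bitsT w)) (unary-code (true ∷ false ∷ true ∷ []) E rest))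
                               (parse-rx E _ stk)

-- Generation of words from a list of choices: the state consists of the expressions still to be generated, the current
-- word (reversed), the current group of finished words and the finished groups, the latter two with the newest first.
Gen : Set
Gen = List RegExp × List Bool × List (List Bool) × List (List (List Bool))

-- Every step consumes a bit, even where nothing is to be chosen. When a word is complete, the bit
-- decides whether the next one joins the group or opens a new one.
genStep : RegExp → Gen → Bool → Gen
genStep E ([] , cur , g , gs) false = E ∷ [] , [] , cur ∷ g , gs
genStep E ([] , cur , g , gs) true  = E ∷ [] , [] , [] , (cur ∷ g) ∷ gs
genStep E (lit a ∷ K    , cur , g , gs) _     = K , a ∷ cur , g , gs
genStep E (eps ∷ K      , cur , g , gs) _     = K , cur , g , gs
genStep E ((A ∣∣ B) ∷ K , cur , g , gs) false = A ∷ K , cur , g , gs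
genStep E ((A ∣∣ B) ∷ K , cur , g , gs) true  = B ∷ K , cur , g , gs
genStep E ((A ·· B) ∷ K , cur , g , gs) _     = A ∷ B ∷ K , cur , g , gs
genStep E (star A ∷ K   , cur , g , gs) false = K , cur , g , gs
genStep E (star A ∷ K   , cur , g , gs) true  = A ∷ star A ∷ K , cur , g , gs

genT : Gen → Tree
genT (K , cur , g , gs) = node (listT rxT K) (node (bitsT cur) (node (wordsT g) (listT wordsT gs)))

genᵐ : ∀ {n} → Tm n → Tm n → Tm n → Tm n → Tm n
genᵐ K cur g gs = nodeᵗ K (nodeᵗ cur (nodeᵗ g gs))

genStepᵗ : Tm 3
genStepᵗ = caseᵗ (v 1) leafᵗ (caseᵗ (v 1) leafᵗ (caseᵗ (v 1) leafᵗ (caseᵗ (v 4)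
  (caseᵗ (v 6) (genᵐ (nodeᵗ (v 8) leafᵗ) leafᵗ (nodeᵗ (v 2) (v 0)) (v 1))
               (genᵐ (nodeᵗ (v 10) leafᵗ) leafᵗ leafᵗ (nodeᵗ (nodeᵗ (v 4) (v 2)) (v 3))))
  (caseᵗ (v 0) leafᵗ
    (caseᵗ (v 0) (genᵐ (v 3) (nodeᵗ (v 1) (v 6)) (v 4) (v 5))
    (caseᵗ (v 1) (genᵐ (v 5) (v 8) (v 6) (v 7))
    (caseᵗ (v 1) (caseᵗ (v 5) leafᵗ (caseᵗ (v 16) (genᵐ (nodeᵗ (v 0) (v 9)) (v 12) (v 10) (v 11))
                                                  (genᵐ (nodeᵗ (v 3) (v 11)) (v 14) (v 12) (v 13))))
    (caseᵗ (v 1) (caseᵗ (v 7) leafᵗ (genᵐ (nodeᵗ (v 0) (nodeᵗ (v 1) (v 11))) (v 14) (v 12) (v 13)))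
                 (caseᵗ (v 18) (genᵐ (v 11) (v 14) (v 12) (v 13))
                               (genᵐ (nodeᵗ (v 11) (nodeᵗ (v 12) (v 13))) (v 16) (v 14) (v 15)))))))))))

bitStateRx : Fin 3 → Fin 4
bitStateRx F.zero                 = F.# 0
bitStateRx (F.suc F.zero)         = F.# 1
bitStateRx (F.suc (F.suc F.zero)) = F.# 3

genᵗ : Tm 2
genᵗ = foldᵗ (v 0) (genᵐ (nodeᵗ (v 1) leafᵗ) leafᵗ leafᵗ leafᵗ) (ren genStepᵗ bitStateRx)

genStep-eval : ∀ E x s → (∀ (ρ : Env 3) → ρ F.zero ≡ bitT x → ρ (F.suc F.zero) ≡ genT s → ρ (F.suc (F.suc F.zero)) ≡ rxT E →
               eval genStepᵗ ρ ≡ genT (genStep E s x))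
genStep-eval E false ([] , cur , g , gs) ρ e e′ e″ rewrite e | e′ | e″ = refl
genStep-eval E true  ([] , cur , g , gs) ρ e e′ e″ rewrite e | e′ | e″ = refl
genStep-eval E x     (lit a ∷ K , cur , g , gs) ρ e e′ e″ rewrite e′ = refl
genStep-eval E x     (eps ∷ K , cur , g , gs) ρ e e′ e″ rewrite e′ = refl
genStep-eval E false ((A ∣∣ B) ∷ K , cur , g , gs) ρ e e′ e″ rewrite e | e′ = refl
genStep-eval E true  ((A ∣∣ B) ∷ K , cur , g , gs) ρ e e′ e″ rewrite e | e′ = refl
genStep-eval E x     ((A ·· B) ∷ K , cur , g , gs) ρ e e′ e″ rewrite e′ = refl
genStep-eval E false (star A ∷ K , cur , g , gs) ρ e e′ e″ rewrite e | e′ = refl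
genStep-eval E true  (star A ∷ K , cur , g , gs) ρ e e′ e″ rewrite e | e′ = refl

generate : RegExp → List Bool → Gen
generate E = foldl (genStep E) (E ∷ [] , [] , [] , [])

gen-eval : ∀ E c ρ → ρ F.zero ≡ bitsT c → ρ (F.suc F.zero) ≡ rxT E → eval genᵗ ρ ≡ genT (generate E c)
gen-eval E c ρ e e′ = trans (cong₂ (λ w r → foldT g (node (node r leaf) (node leaf (node leaf leaf))) w) e e′)
  (foldT-listT {enc = bitT} {encY = genT} {f = genStep E} g
    (λ x s → genStep-eval E x s ((bitT x ◂ genT s ◂ ρ) ∘ bitStateRx) refl refl e′) (E ∷ [] , [] , [] , []) c)
  where
  g : Tree → Tree → Tree
  g x acc = eval genStepᵗ ((x ◂ acc ◂ ρ) ∘ bitStateRx)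

-- Comparing the rows with the transposed columns

Peel : Set
Peel = Maybe (List Bool × List (List Bool))

-- The state is the rest of the column and the reversed list of the tails of the rows passed.
peelStep : Peel → List Bool → Peel
peelStep (just (x ∷ col , tails)) (b ∷ r) = if does (b ≟ᵇ x) then just (col , r ∷ tails) else nothing
peelStep _                        _       = nothing

peeled : Peel → Maybe (List (List Bool))
peeled (just ([] , tails)) = just (reverse tails)
peeled _                   = nothing

colStep : Maybe (List (List Bool)) → List Bool → Maybe (List (List Bool))
colStep nothing     col = nothing
colStep (just rows) col = peeled (foldl peelStep (just (col , [])) rows)

emptyStep : Bool → List Bool → Bool
emptyStep b []      = b
emptyStep b (_ ∷ _) = false

allEmpty : Maybe (List (List Bool)) → Bool
allEmpty nothing     = false
allEmpty (just rows) = foldl emptyStep true rows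

-- Each column is compared with the first letters of the rows and removed with them; at the end all
-- rows must be used up. This checks the lengths of all lines too.
transposes : List (List Bool) → List (List Bool) → Bool
transposes rows cols = allEmpty (foldl colStep (just rows) cols)

peelT : Peel → Tree
peelT nothing              = leaf
peelT (just (col , tails)) = node (bitsT col) (wordsT tails)

rowsT : Maybe (List (List Bool)) → Tree
rowsT nothing     = leaf
rowsT (just rows) = node leaf (wordsT rows)

trueᵗ : ∀ {n} → Tm n
trueᵗ = nodeᵗ leafᵗ leafᵗ

peelStepᵗ : Tm 2
peelStepᵗ = caseᵗ (v 1) leafᵗ (caseᵗ (v 2) leafᵗ (caseᵗ (v 2) leafᵗ
  (caseᵗ (v 2) (caseᵗ (v 0) (nodeᵗ (v 1) (nodeᵗ (v 3) (v 5))) leafᵗ)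
               (caseᵗ (v 2) leafᵗ (nodeᵗ (v 5) (nodeᵗ (v 7) (v 9)))))))

colStepᵗ : Tm 2
colStepᵗ = caseᵗ (v 1) leafᵗ (caseᵗ (foldᵗ (v 1) (nodeᵗ (v 2) leafᵗ) (ren peelStepᵗ first₂)) leafᵗ
  (caseᵗ (v 0) (nodeᵗ leafᵗ (call₁ reverseᵗ (v 1))) leafᵗ))

transposesᵗ : Tm 2
transposesᵗ = caseᵗ (foldᵗ (v 1) (nodeᵗ leafᵗ (v 0)) (ren colStepᵗ first₂)) leafᵗ (foldᵗ (v 1) trueᵗ (caseᵗ (v 0) (v 1) leafᵗ))

peelStep-eval : ∀ r p (ρ : Env 2) → ρ F.zero ≡ bitsT r → ρ (F.suc F.zero) ≡ peelT p → eval peelStepᵗ ρ ≡ peelT (peelStep p r)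
peelStep-eval r nothing ρ e e′ rewrite e | e′ = refl
peelStep-eval [] (just ([] , tails)) ρ e e′ rewrite e | e′ = refl
peelStep-eval [] (just (x ∷ col , tails)) ρ e e′ rewrite e | e′ = refl
peelStep-eval (b ∷ r) (just ([] , tails)) ρ e e′ rewrite e | e′ = refl
peelStep-eval (false ∷ r) (just (false ∷ col , tails)) ρ e e′ rewrite e | e′ = refl
peelStep-eval (false ∷ r) (just (true ∷ col , tails)) ρ e e′ rewrite e | e′ = refl
peelStep-eval (true ∷ r) (just (false ∷ col , tails)) ρ e e′ rewrite e | e′ = refl
peelStep-eval (true ∷ r) (just (true ∷ col , tails)) ρ e e′ rewrite e | e′ = refl

colStep-eval : ∀ col s (ρ : Env 2) → ρ F.zero ≡ bitsT col → ρ (F.suc F.zero) ≡ rowsT s → eval colStepᵗ ρ ≡ rowsT (colStep s col)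
colStep-eval col nothing ρ e e′ rewrite e | e′ = refl
colStep-eval col (just rows) ρ e e′ rewrite e | e′
  | foldT-listT {enc = bitsT} {encY = peelT} {f = peelStep} (λ x acc → eval peelStepᵗ ((x ◂ acc ◂ leaf ◂ wordsT rows ◂ ρ) ∘ first₂))
      (λ r p → peelStep-eval r p ((bitsT r ◂ peelT p ◂ leaf ◂ wordsT rows ◂ ρ) ∘ first₂) refl refl) (just (col , [])) rows = finish (foldl peelStep (just (col , [])) rows)
  where
  finish : ∀ p → caseT (peelT p) leaf (λ a b → caseT a (node leaf (eval reverseᵗ (λ _ → b))) (λ _ _ → leaf)) ≡ rowsT (peeled p)
  finish nothing                  = refl
  finish (just (x ∷ col , tails)) = refl
  finish (just ([] , tails))      = cong (node leaf) (reverse-eval bitsT tails (λ _ → wordsT tails) refl)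

transposes-eval : ∀ rows cols (ρ : Env 2) → ρ F.zero ≡ wordsT rows → ρ (F.suc F.zero) ≡ wordsT cols →
                  eval transposesᵗ ρ ≡ bitT (transposes rows cols)
transposes-eval rows cols ρ e e′ rewrite e | e′
  | foldT-listT {enc = bitsT} {encY = rowsT} {f = colStep} (λ x acc → eval colStepᵗ ((x ◂ acc ◂ ρ) ∘ first₂))
      (λ col s → colStep-eval col s ((bitsT col ◂ rowsT s ◂ ρ) ∘ first₂) refl refl) (just rows) cols = finish (foldl colStep (just rows) cols)
  where
  finish : ∀ s → caseT (rowsT s) leaf (λ _ rs → foldT (λ x acc → caseT x acc (λ _ _ → leaf)) (node leaf leaf) rs) ≡ bitT (allEmpty s)
  finish nothing     = refl
  finish (just rows) = foldT-listT {enc = bitsT} {encY = bitT} {f = emptyStep} (λ x acc → caseT x acc (λ _ _ → leaf))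
                         (λ { [] b → refl ; (_ ∷ _) b → refl }) true rows

consReverse : List (List Bool) → List Bool → List (List Bool)
consReverse ws w = reverse w ∷ ws

reverseAll : List (List Bool) → List (List Bool)
reverseAll = foldl consReverse []

reverseAllᵗ : Tm 1
reverseAllᵗ = foldᵗ (v 0) leafᵗ (nodeᵗ (call₁ reverseᵗ (v 0)) (v 1))

reverseAll-eval : ∀ ws ρ → ρ F.zero ≡ wordsT ws → eval reverseAllᵗ ρ ≡ wordsT (reverseAll ws)
reverseAll-eval ws ρ e rewrite e =
  foldT-listT {enc = bitsT} {encY = wordsT} {f = consReverse} _
    (λ w us → cong (λ t → node t (wordsT us)) (reverse-eval bitT w (λ _ → bitsT w) refl)) [] ws

-- The one finished group holds the rows, the group under way with its last word `cur` the columns.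
-- Words and groups are both stored backwards.
accept : Gen → Bool
accept ([] , cur , g , G ∷ []) = transposes (reverseAll G) (reverseAll (cur ∷ g))
accept _                       = false

acceptᵗ : Tm 1
acceptᵗ = caseᵗ (v 0) leafᵗ (caseᵗ (v 0) (caseᵗ (v 1) leafᵗ (caseᵗ (v 1) leafᵗ (caseᵗ (v 1) leafᵗ
  (caseᵗ (v 1) (call₂ transposesᵗ (call₁ reverseAllᵗ (v 0)) (call₁ reverseAllᵗ (nodeᵗ (v 4) (v 2)))) leafᵗ)))) leafᵗ)

accept-eval : ∀ s (ρ : Env 1) → ρ F.zero ≡ genT s → eval acceptᵗ ρ ≡ bitT (accept s)
accept-eval (_ ∷ _ , cur , g , gs) ρ e rewrite e = refl
accept-eval ([] , cur , g , []) ρ e rewrite e = refl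
accept-eval ([] , cur , g , _ ∷ _ ∷ _) ρ e rewrite e = refl
accept-eval ([] , cur , g , G ∷ []) ρ e rewrite e =
  transposes-eval (reverseAll G) (reverseAll (cur ∷ g))
    ((eval reverseAllᵗ (λ _ → wordsT (cur ∷ g)) ◂ eval reverseAllᵗ (λ _ → wordsT G) ◂ noEnv) ∘ swap₂) (reverseAll-eval G (λ _ → wordsT G) refl)
    (reverseAll-eval (cur ∷ g) (λ _ → wordsT (cur ∷ g)) refl)

crosswordTestᵗ : Tm 2
crosswordTestᵗ = caseᵗ (foldᵗ (v 1) (nodeᵗ leafᵗ leafᵗ) (ren parseStepᵗ first₂)) leafᵗ
  (caseᵗ (v 1) leafᵗ (call₁ acceptᵗ (call₂ genᵗ (v 4) (v 0))))

crosswordTest : RegExp → List Bool → Bool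
crosswordTest E c = accept (generate E c)

crosswordTest-eval : ∀ E c (ρ : Env 2) → ρ F.zero ≡ bitsT c → ρ (F.suc F.zero) ≡ bitsT (reverse (encRegExp E)) →
                     eval crosswordTestᵗ ρ ≡ bitT (crosswordTest E c)
crosswordTest-eval E c ρ e e′ rewrite e | e′ = trans (cong (λ t → caseT t leaf λ a b → caseT b leaf (λ r _ →
    eval acceptᵗ (λ _ → eval genᵗ ((r ◂ bitsT c ◂ noEnv) ∘ swap₂)))) parsed)
  (accept-eval (generate E c) (λ _ → eval genᵗ ((rxT E ◂ bitsT c ◂ noEnv) ∘ swap₂)) (gen-eval E c ((rxT E ◂ bitsT c ◂ noEnv) ∘ swap₂) refl refl))
  where
  parsed : foldT parseStep (node leaf leaf) (bitsT (reverse (encRegExp E))) ≡ node leaf (node (rxT E) leaf)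
  parsed = trans (cong (λ w → foldT parseStep (node leaf leaf) (bitsT w)) (sym (++-identityʳ (reverse (encRegExp E))))) (parse-rx E [] leaf)

-- Correctness of the crossword search

data Matches : List RegExp → List Bool → Set where
  []  : Matches [] []
  _∷_ : ∀ {E K u w} → u ∈L E → Matches K w → Matches (E ∷ K) (u ++ w)

-- The invariant of the generation: whatever word is produced from the pending expressions, it
-- completes the current word to one of `E`.
Generated : RegExp → Gen → Set
Generated E (K , cur , g , gs) =
  (∀ w → Matches K w → (reverse cur ++ w) ∈L E) × All (λ u → reverse u ∈L E) g × All (All (λ u → reverse u ∈L E)) gs

matches-cat : ∀ {A B K w} → Matches (A ∷ B ∷ K) w → Matches ((A ·· B) ∷ K) w
matches-cat (_∷_ {u = u} x (_∷_ {u = u′} y ms)) = subst (Matches _) (++-assoc u u′ _) (m-cat x y ∷ ms)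

matches-star : ∀ {A K w} → Matches (A ∷ star A ∷ K) w → Matches (star A ∷ K) w
matches-star (_∷_ {u = u} x (_∷_ {u = u′} y ms)) = subst (Matches _) (++-assoc u u′ _) (m-starS x y ∷ ms)

generated-step : ∀ E s b → Generated E s → Generated E (genStep E s b)
generated-step E ([] , cur , g , gs) b (h , hg , hgs) = finished b
  where
  new : ∀ w → Matches (E ∷ []) w → w ∈L E
  new _ (_∷_ {u = u} x []) = subst (_∈L E) (sym (++-identityʳ u)) x
  current : reverse cur ∈L E
  current = subst (_∈L E) (++-identityʳ _) (h [] [])
  finished : ∀ b → Generated E (genStep E ([] , cur , g , gs) b)
  finished false = new , current ∷ hg , hgs
  finished true  = new , [] , (current ∷ hg) ∷ hgs
generated-step E (lit a ∷ K , cur , g , gs) b (h , hgs) =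
  (λ w m → subst (_∈L E) (trans (sym (++-assoc (reverse cur) (a ∷ []) w)) (cong (_++ w) (sym (unfold-reverse a cur)))) (h (a ∷ w) (m-lit a ∷ m))) , hgs
generated-step E (eps ∷ K , cur , g , gs) b (h , hgs) = (λ w m → h w (m-eps ∷ m)) , hgs
generated-step E ((A ∣∣ B) ∷ K , cur , g , gs) false (h , hgs) = (λ { w (x ∷ m) → h w (m-unionˡ x ∷ m) }) , hgs
generated-step E ((A ∣∣ B) ∷ K , cur , g , gs) true  (h , hgs) = (λ { w (x ∷ m) → h w (m-unionʳ x ∷ m) }) , hgs
generated-step E ((A ·· B) ∷ K , cur , g , gs) b (h , hgs) = (λ w m → h w (matches-cat m)) , hgs
generated-step E (star A ∷ K , cur , g , gs) false (h , hgs) = (λ w m → h w (m-star0 ∷ m)) , hgs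
generated-step E (star A ∷ K , cur , g , gs) true  (h , hgs) = (λ w m → h w (matches-star m)) , hgs

generated : ∀ E c s → Generated E s → Generated E (foldl (genStep E) s c)
generated E []      s h = h
generated E (b ∷ c) s h = generated E c (genStep E s b) (generated-step E s b h)

generate-sound : ∀ E c → Generated E (generate E c)
generate-sound E c = generated E c _ ((λ { _ (_∷_ {u = u} x []) → subst (_∈L E) (sym (++-identityʳ u)) x }) , [] , [])

reverseAll-matches : ∀ E ws {us} → All (_∈L E) us → All (λ w → reverse w ∈L E) ws → All (_∈L E) (foldl consReverse us ws)
reverseAll-matches E []       h []       = h
reverseAll-matches E (w ∷ ws) h (x ∷ xs) = reverseAll-matches E ws (x ∷ h) xs

-- The choices are read off the derivation of `w ∈L F`; the pending list `K` below `F` is arbitrary,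
-- so that the choices for factors can be concatenated.
generates-word : ∀ E {F w} → w ∈L F → ∀ K cur g gs → ∃[ c ] foldl (genStep E) (F ∷ K , cur , g , gs) c ≡ (K , w ʳ++ cur , g , gs)
generates-word E (m-lit b) K cur g gs = false ∷ [] , refl
generates-word E m-eps K cur g gs = false ∷ [] , refl
generates-word E (m-unionˡ x) K cur g gs with generates-word E x K cur g gs
... | c , e = false ∷ c , e
generates-word E (m-unionʳ x) K cur g gs with generates-word E x K cur g gs
... | c , e = true ∷ c , e
generates-word E (m-cat {u} {u′} {A} {B} x y) K cur g gs with generates-word E x (B ∷ K) cur g gs
... | c , e with generates-word E y K (u ʳ++ cur) g gs
... | c′ , e′ = false ∷ c ++ c′ , trans (foldl-++ (genStep E) _ c c′) (trans (cong (λ s → foldl (genStep E) s c′) e)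
                 (trans e′ (cong (λ z → K , z , g , gs) (sym (LP.++-ʳ++ u)))))
generates-word E m-star0 K cur g gs = false ∷ [] , refl
generates-word E (m-starS {u} {u′} {A} x y) K cur g gs with generates-word E x (star A ∷ K) cur g gs
... | c , e with generates-word E y K (u ʳ++ cur) g gs
... | c′ , e′ = true ∷ c ++ c′ , trans (foldl-++ (genStep E) _ c c′) (trans (cong (λ s → foldl (genStep E) s c′) e)
                 (trans e′ (cong (λ z → K , z , g , gs) (sym (LP.++-ʳ++ u)))))

generates-group : ∀ E w ws → w ∈L E → All (_∈L E) ws → ∀ g gs →
  ∃[ c ] ∃[ cur ] ∃[ g′ ] foldl (genStep E) (E ∷ [] , [] , g , gs) c ≡ ([] , cur , g′ , gs) × cur ∷ g′ ≡ foldl consReverse g (w ∷ ws)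
generates-group E w [] x [] g gs with generates-word E x [] [] g gs
... | c , e = c , reverse w , g , e , refl
generates-group E w (w′ ∷ ws) x (y ∷ ys) g gs with generates-word E x [] [] g gs | generates-group E w′ ws y ys (reverse w ∷ g) gs
... | c , e | c′ , cur , g′ , e′ , e″ = c ++ false ∷ c′ , cur , g′ ,
  trans (foldl-++ (genStep E) _ c (false ∷ c′)) (trans (cong (λ s → foldl (genStep E) s (false ∷ c′)) e) e′) , e″

reverseAll-≡ : ∀ (ws us : List (List Bool)) → foldl consReverse us ws ≡ map reverse ws ʳ++ us
reverseAll-≡ []       us = refl
reverseAll-≡ (w ∷ ws) us = reverseAll-≡ ws (reverse w ∷ us)

reverseAll-involutive : ∀ ws → reverseAll (reverseAll ws) ≡ ws
reverseAll-involutive ws = begin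
  reverseAll (reverseAll ws)                       ≡⟨ cong reverseAll (reverseAll-≡ ws []) ⟩
  reverseAll (reverse (map reverse ws))            ≡⟨ reverseAll-≡ (reverse (map reverse ws)) [] ⟩
  reverse (map reverse (reverse (map reverse ws))) ≡⟨ cong reverse (LP.reverse-map reverse (map reverse ws)) ⟩
  reverse (reverse (map reverse (map reverse ws))) ≡⟨ LP.reverse-involutive _ ⟩
  map reverse (map reverse ws)                     ≡⟨ twice-reversed ws ⟩
  ws                                               ∎
  where
  open ≡-Reasoning
  twice-reversed : ∀ (ws : List (List Bool)) → map reverse (map reverse ws) ≡ ws
  twice-reversed []       = refl
  twice-reversed (w ∷ ws) = cong₂ _∷_ (LP.reverse-involutive w) (twice-reversed ws)

peel-nothing : ∀ rows → foldl peelStep nothing rows ≡ nothing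
peel-nothing []         = refl
peel-nothing (r ∷ rows) = peel-nothing rows

colStep-nothing : ∀ cols → foldl colStep nothing cols ≡ nothing
colStep-nothing []         = refl
colStep-nothing (c ∷ cols) = colStep-nothing cols

zipRows : List Bool → List (List Bool) → List (List Bool)
zipRows (b ∷ col) (r ∷ rows) = (b ∷ r) ∷ zipRows col rows
zipRows _         _          = []

peel-sound : ∀ rows col acc out → foldl peelStep (just (col , acc)) rows ≡ just ([] , out) →
             ∃[ tails ] out ≡ tails ʳ++ acc × rows ≡ zipRows col tails × length col ≡ length tails
peel-sound [] [] acc out refl = [] , refl , refl , refl
peel-sound [] (x ∷ col) acc out ()
peel-sound ([] ∷ rows) [] acc out e = case trans (sym (peel-nothing rows)) e of λ ()
peel-sound ([] ∷ rows) (x ∷ col) acc out e = case trans (sym (peel-nothing rows)) e of λ ()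
peel-sound ((b ∷ r) ∷ rows) [] acc out e = case trans (sym (peel-nothing rows)) e of λ ()
peel-sound ((b ∷ r) ∷ rows) (x ∷ col) acc out e with b ≟ᵇ x
... | no _ = case trans (sym (peel-nothing rows)) e of λ ()
... | yes refl with peel-sound rows col (r ∷ acc) out e
... | tails , e₁ , e₂ , e₃ = r ∷ tails , e₁ , cong ((b ∷ r) ∷_) e₂ , cong suc e₃

zipRows-word : ∀ col m f → length col ≡ m → zipRows col (word m f) ≡ word m (λ i → nthB col i ∷ f i)
zipRows-word []        zero    f refl = refl
zipRows-word (b ∷ col) (suc m) f e    = cong ((b ∷ f 0) ∷_) (zipRows-word col m (f ∘ suc) (NP.suc-injective e))

length-zipRows : ∀ col rows → length col ≡ length rows → length (zipRows col rows) ≡ length rows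
length-zipRows []        []         e = refl
length-zipRows (b ∷ col) (r ∷ rows) e = cong suc (length-zipRows col rows (NP.suc-injective e))

emptyStep-false : ∀ rows → foldl emptyStep false rows ≡ false
emptyStep-false []               = refl
emptyStep-false ([] ∷ rows)      = emptyStep-false rows
emptyStep-false ((_ ∷ _) ∷ rows) = emptyStep-false rows

empty-rows : ∀ rows → foldl emptyStep true rows ≡ true → rows ≡ word (length rows) (λ _ → [])
empty-rows []               e = refl
empty-rows ([] ∷ rows)      e = cong ([] ∷_) (empty-rows rows e)
empty-rows ((_ ∷ _) ∷ rows) e = case trans (sym (emptyStep-false rows)) e of λ ()

entry-of : List (List Bool) → ℕ → ℕ → Bool
entry-of cols i j = nthB (nthW cols j) i

transposes-sound : ∀ cols rows → transposes rows cols ≡ true →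
                   All (λ c → length c ≡ length rows) cols × rows ≡ word (length rows) (λ i → word (length cols) (entry-of cols i))
transposes-sound [] rows e = [] , empty-rows rows e
transposes-sound (col ∷ cols) rows e with foldl peelStep (just (col , [])) rows in eq
... | nothing = case trans (sym (cong allEmpty (colStep-nothing cols))) e of λ ()
... | just (_ ∷ _ , _) = case trans (sym (cong allEmpty (colStep-nothing cols))) e of λ ()
... | just ([] , out) with peel-sound rows col [] out eq
... | tails , refl , refl , len with transposes-sound cols tails (subst (λ t → transposes t cols ≡ true) (LP.reverse-involutive tails) e)
... | lens , e′ = trans len (sym (length-zipRows col tails len)) ∷ All.map (λ x → trans x (sym (length-zipRows col tails len))) lens ,
    trans (cong (zipRows col) e′) (trans (zipRows-word col (length tails) (λ i → word (length cols) (entry-of cols i)) len)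
      (cong (λ m → word m (λ i → nthB col i ∷ word (length cols) (entry-of cols i))) (sym (length-zipRows col tails len))))

peel-complete : ∀ m (f : ℕ → Bool) (g : ℕ → List Bool) acc →
                foldl peelStep (just (word m f , acc)) (word m (λ i → f i ∷ g i)) ≡ just ([] , word m g ʳ++ acc)
peel-complete zero    f g acc = refl
peel-complete (suc m) f g acc with f 0 ≟ᵇ f 0
... | yes _ = peel-complete m (f ∘ suc) (g ∘ suc) (g 0 ∷ acc)
... | no ne = ⊥-elim (ne refl)

transposes-complete : ∀ n m (a : ℕ → ℕ → Bool) → transposes (word m (λ i → word n (a i))) (word n (λ j → word m (λ i → a i j))) ≡ true
transposes-complete zero    m a = empties m
  where
  empties : ∀ m → foldl emptyStep true (word m (λ _ → [])) ≡ true
  empties zero    = refl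
  empties (suc m) = empties m
transposes-complete (suc n) m a = trans (cong (λ p → allEmpty (foldl colStep (peeled p) (word n (λ j → word m (λ i → a i (suc j))))))
    (peel-complete m (λ i → a i 0) (λ i → word n (λ j → a i (suc j))) []))
  (trans (cong (λ rs → transposes rs (word n (λ j → word m (λ i → a i (suc j))))) (LP.reverse-involutive (word m (λ i → word n (λ j → a i (suc j))))))
         (transposes-complete n m (λ i j → a i (suc j))))

transposes⇒array : ∀ E rows cols → transposes rows cols ≡ true → All (_∈L E) rows → All (_∈L E) cols →
                   IsArray E (length rows) (length cols) (entry-of cols)
transposes⇒array E rows cols e hr hc with transposes-sound cols rows e
... | lens , e′ = (λ i lt → AllP.applyUpTo⁻ (λ i → word (length cols) (entry-of cols i)) (length rows) (subst (All (_∈L E)) e′ hr) lt) , columns cols lens hc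
  where
  columns : ∀ cols → All (λ c → length c ≡ length rows) cols → All (_∈L E) cols → ∀ j → j < length cols → word (length rows) (λ i → entry-of cols i j) ∈L E
  columns (c ∷ cols) (l ∷ ls) (h ∷ hs) zero    lt       = subst (_∈L E) (trans (sym (word-nthB c)) (cong (λ m → word m (nthB c)) l)) h
  columns (c ∷ cols) (l ∷ ls) (h ∷ hs) (suc j) (s≤s lt) = columns cols ls hs j lt

length-reverseAll : ∀ w ws → ∃[ n ] length (reverseAll (w ∷ ws)) ≡ suc n
length-reverseAll w ws = length ws , trans (cong length (reverseAll-≡ (w ∷ ws) []))
  (trans (LP.length-reverse (map reverse (w ∷ ws))) (cong suc (length-map reverse ws)))

-- A group is closed together with a word just completed. This guarantees at least one row.
NonemptyGroups : Gen → Set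
NonemptyGroups (_ , _ , _ , gs) = All (_≢ []) gs

nonempty-step : ∀ E s b → NonemptyGroups s → NonemptyGroups (genStep E s b)
nonempty-step E ([] , cur , g , gs) false h = h
nonempty-step E ([] , cur , g , gs) true  h = (λ ()) ∷ h
nonempty-step E (lit a ∷ K , cur , g , gs) b h = h
nonempty-step E (eps ∷ K , cur , g , gs) b h = h
nonempty-step E ((A ∣∣ B) ∷ K , cur , g , gs) false h = h
nonempty-step E ((A ∣∣ B) ∷ K , cur , g , gs) true h = h
nonempty-step E ((A ·· B) ∷ K , cur , g , gs) b h = h
nonempty-step E (star A ∷ K , cur , g , gs) false h = h
nonempty-step E (star A ∷ K , cur , g , gs) true h = h

nonempty-groups : ∀ E c s → NonemptyGroups s → NonemptyGroups (foldl (genStep E) s c)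
nonempty-groups E []      s h = h
nonempty-groups E (b ∷ c) s h = nonempty-groups E c (genStep E s b) (nonempty-step E s b h)

test-sound : ∀ E c → crosswordTest E c ≡ true → CrosswordExists E
test-sound E c e = from (generate E c) e (generate-sound E c) (nonempty-groups E c _ [])
  where
  from : ∀ s → accept s ≡ true → Generated E s → NonemptyGroups s → CrosswordExists E
  from ([] , cur , g , [] ∷ []) e h (ne ∷ _) = ⊥-elim (ne refl)
  from ([] , cur , g , (w ∷ ws) ∷ []) e (h , hg , (hG ∷ [])) _ with length-reverseAll w ws | length-reverseAll cur g
     | transposes⇒array E (reverseAll (w ∷ ws)) (reverseAll (cur ∷ g)) e (reverseAll-matches E (w ∷ ws) [] hG)
         (reverseAll-matches E (cur ∷ g) [] (subst (_∈L E) (++-identityʳ _) (h [] []) ∷ hg))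
  ... | m , em | n , en | arr = array⇒crossword m n (entry-of (reverseAll (cur ∷ g)))
         (subst₂ (λ m n → IsArray E m n (entry-of (reverseAll (cur ∷ g)))) em en arr)

test-complete : ∀ E → CrosswordExists E → ∃[ c ] crosswordTest E c ≡ true
test-complete E x with crossword⇒array x
... | m , n , a , hr , hc with all-word {P = _∈L E} (suc m) {λ i → word (suc n) (a i)} hr
                             | all-word {P = _∈L E} (suc n) {λ j → word (suc m) (λ i → a i j)} hc
... | r ∷ rs | k ∷ ks with generates-group E _ _ r rs [] []
... | c , cur , g , e , eg with generates-group E _ _ k ks [] ((cur ∷ g) ∷ [])
-- The bit `true` in between closes the group of rows and starts that of the columns.
... | c′ , cur′ , g′ , e′ , eg′ = c ++ true ∷ c′ , (begin
  accept (foldl (genStep E) (E ∷ [] , [] , [] , []) (c ++ true ∷ c′))  ≡⟨ cong accept (foldl-++ (genStep E) _ c (true ∷ c′)) ⟩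
  accept (foldl (genStep E) (foldl (genStep E) (E ∷ [] , [] , [] , []) c) (true ∷ c′))
                                                                       ≡⟨ cong (λ s → accept (foldl (genStep E) s (true ∷ c′))) e ⟩
  accept (foldl (genStep E) (E ∷ [] , [] , [] , (cur ∷ g) ∷ []) c′)    ≡⟨ cong accept e′ ⟩
  transposes (reverseAll (cur ∷ g)) (reverseAll (cur′ ∷ g′))           ≡⟨ cong₂ (λ u w → transposes (reverseAll u) (reverseAll w)) eg eg′ ⟩
  transposes (reverseAll (reverseAll rs₀)) (reverseAll (reverseAll cs₀))
                                                                       ≡⟨ cong₂ transposes (reverseAll-involutive rs₀) (reverseAll-involutive cs₀) ⟩
  transposes rs₀ cs₀                                                 ≡⟨ transposes-complete (suc n) (suc m) a ⟩
  true                                                                 ∎)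
  where
  open ≡-Reasoning
  rs₀ cs₀ : List (List Bool)
  rs₀ = word (suc m) (λ i → word (suc n) (a i))
  cs₀ = word (suc n) (λ j → word (suc m) (λ i → a i j))

crosswordSearch : Tm 1
crosswordSearch = searchᵗ crosswordTestᵗ

-- The tape shows a serialisation backwards, so the word is stored reversed in order to appear there
-- in its own order. The left leaf is the empty choice list of the search and, for the universal
-- program, the sign that nothing has been decoded yet.
initialTree : List Bool → Tree
initialTree w = node leaf (bitsT (reverse w))

search⇔crossword : ∀ E → (∃[ k ] iterate (apply crosswordSearch) (initialTree (encRegExp E)) k ≡ leaf) ⇔ CrosswordExists E
search⇔crossword E = mk⇔
  (λ (k , e) → let (c , t) = search-sound crosswordTestᵗ w (crosswordTest E) (crosswordTest-eval E) k [] e in test-sound E c t)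
  (λ x → let (c , t) = test-complete E x in search-complete crosswordTestᵗ w (crosswordTest E) (crosswordTest-eval E) (rank c) [] c refl t)
  where
  w : Tree
  w = bitsT (reverse (encRegExp E))

-- A universal program: the first round decodes a machine and its input, every later round makes one transition

natT : ℕ → Tree
natT zero    = leaf
natT (suc n) = node leaf (natT n)

symT : Sym → Tree
symT nothing  = leaf
symT (just b) = node leaf (bitT b)

dirT : Dir → Tree
dirT L = leaf
dirT R = node leaf leaf

entryT : ∀ {k} → Maybe (Fin k × Sym × Dir) → Tree
entryT nothing            = leaf
entryT (just (q , s , d)) = node (natT (toℕ q)) (node (symT s) (dirT d))

confT : ∀ {k} → Config k → Tree
confT (conf q l s r) = node (natT (toℕ q)) (node (listT symT l) (node (symT s) (listT symT r)))

runT : Tree → Tree → Tree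
runT table c = node (node leaf leaf) (node table c)

confᵗ : ∀ {n} → Tm n → Tm n → Tm n → Tm n → Tm n
confᵗ q l s r = nodeᵗ q (nodeᵗ l (nodeᵗ s r))

runᵗ : ∀ {n} → Tm n → Tm n → Tm n
runᵗ t c = nodeᵗ trueᵗ (nodeᵗ t c)

-- The state of the decoder: mode, number of entries to read, entries read (reversed), state and symbol of the current
-- entry, input word read (reversed).  Modes: 0 number of states, 1 start of an entry or of an input letter, 2 state,
-- 3 and 4 symbol, 5 direction, 6 input letter, 7 end.
decodeT : ℕ → Tree → Tree → Tree → Tree → Tree → Tree
decodeT m n table q s w = node (natT m) (node n (node table (node q (node s w))))

decodeᵗ : ∀ {n} → ℕ → Tm n → Tm n → Tm n → Tm n → Tm n → Tm n
decodeᵗ m n table q s w = nodeᵗ (unaryᵗ m) (nodeᵗ n (nodeᵗ table (nodeᵗ q (nodeᵗ s w))))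

-- In the branches for the modes, the variables are 0 symbol, 1 word, 2 state, 4 table, 6 number of entries, 10 bit.
mode₀ mode₁ mode₂ mode₃ mode₄ mode₅ mode₆ : Tm 12
mode₀ = caseᵗ (v 10) (decodeᵗ 1 (plus3 (v 6)) (v 4) (v 2) (v 0) (v 1)) (decodeᵗ 0 (plus3 (v 8)) (v 6) (v 4) (v 2) (v 3))
  where
  plus3 : ∀ {n} → Tm n → Tm n
  plus3 t = nodeᵗ leafᵗ (nodeᵗ leafᵗ (nodeᵗ leafᵗ t))
mode₁ = caseᵗ (v 6) (caseᵗ (v 10) (decodeᵗ 7 (v 6) (v 4) (v 2) (v 0) (v 1)) (decodeᵗ 6 (v 8) (v 6) (v 4) (v 2) (v 3)))
  (caseᵗ (v 12) (decodeᵗ 1 (v 1) (nodeᵗ leafᵗ (v 6)) leafᵗ leafᵗ (v 3)) (decodeᵗ 2 (v 10) (v 8) leafᵗ leafᵗ (v 5)))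
mode₂ = caseᵗ (v 10) (decodeᵗ 3 (v 6) (v 4) (v 2) (v 0) (v 1)) (decodeᵗ 2 (v 8) (v 6) (nodeᵗ leafᵗ (v 4)) (v 2) (v 3))
mode₃ = decodeᵗ 4 (v 6) (v 4) (v 2) (v 10) (v 1)
mode₄ = caseᵗ (v 0) (decodeᵗ 5 (v 6) (v 4) (v 2) leafᵗ (v 1)) (decodeᵗ 5 (v 8) (v 6) (v 4) (nodeᵗ leafᵗ (v 12)) (v 3))
mode₅ = caseᵗ (v 6) leafᵗ (decodeᵗ 1 (v 1) (nodeᵗ (nodeᵗ (v 4) (nodeᵗ (v 2) (v 12))) (v 6)) leafᵗ leafᵗ (v 3))
mode₆ = decodeᵗ 1 (v 6) (v 4) (v 2) (v 0) (nodeᵗ (v 10) (v 1))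

decodeStepᵗ : Tm 2
decodeStepᵗ = caseᵗ (v 1) leafᵗ (caseᵗ (v 1) leafᵗ (caseᵗ (v 1) leafᵗ (caseᵗ (v 1) leafᵗ (caseᵗ (v 1) leafᵗ
  (caseᵗ (v 8) mode₀ (caseᵗ (v 1) (ren mode₁ (2 F.↑ʳ_)) (caseᵗ (v 1) (ren mode₂ (4 F.↑ʳ_)) (caseᵗ (v 1) (ren mode₃ (6 F.↑ʳ_))
  (caseᵗ (v 1) (ren mode₄ (8 F.↑ʳ_)) (caseᵗ (v 1) (ren mode₅ (10 F.↑ʳ_)) (caseᵗ (v 1) (ren mode₆ (12 F.↑ʳ_)) leafᵗ)))))))))))

decodeStep : Tree → Tree → Tree
decodeStep x s = eval decodeStepᵗ (x ◂ s ◂ noEnv)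

decode : Tree → List Bool → Tree
decode s w = foldT decodeStep s (bitsT w)

-- Three table entries per state, one for each tape symbol; the accumulating form follows the
-- decoder.
add3 : ℕ → ℕ → ℕ
add3 zero    k = k
add3 (suc n) k = add3 n (3 + k)

decode-count : ∀ n k rest → decode (decodeT 0 (natT k) leaf leaf leaf leaf) (encℕ n ++ rest) ≡
                            decode (decodeT 1 (natT (add3 (suc n) k)) leaf leaf leaf leaf) rest
decode-count zero    k rest = refl
decode-count (suc n) k rest = decode-count n (3 + k) rest

decode-state : ∀ n k N table w rest → decode (decodeT 2 N table (natT k) leaf w) (encℕ n ++ rest) ≡
                                      decode (decodeT 3 N table (natT (n + k)) leaf w) rest
decode-state zero    k N table w rest = refl
decode-state (suc n) k N table w rest = trans (decode-state n (suc k) N table w rest)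
  (cong (λ m → decode (decodeT 3 N table (natT m) leaf w) rest) (+-suc n k))

decode-symbol : ∀ s d r table q w rest → decode (decodeT 3 (natT (suc r)) table q leaf w) (encSym s ++ encDir d ++ rest) ≡
                                         decode (decodeT 1 (natT r) (node (node q (node (symT s) (dirT d))) table) leaf leaf w) rest
decode-symbol nothing      L r table q w rest = refl
decode-symbol nothing      R r table q w rest = refl
decode-symbol (just false) L r table q w rest = refl
decode-symbol (just false) R r table q w rest = refl
decode-symbol (just true)  L r table q w rest = refl
decode-symbol (just true)  R r table q w rest = refl

decode-entry : ∀ {k} (e : Maybe (Fin (suc k) × Sym × Dir)) r table w rest →
               decode (decodeT 1 (natT (suc r)) table leaf leaf w) (encEntry e ++ rest) ≡
               decode (decodeT 1 (natT r) (node (entryT e) table) leaf leaf w) rest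
decode-entry nothing r table w rest = refl
decode-entry (just (q , s , d)) r table w rest = begin
  decode (decodeT 2 (natT (suc r)) table leaf leaf w) ((encℕ (toℕ q) ++ encSym s ++ encDir d) ++ rest)
    ≡⟨ cong (decode (decodeT 2 (natT (suc r)) table leaf leaf w))
         (trans (++-assoc (encℕ (toℕ q)) _ rest) (cong (encℕ (toℕ q) ++_) (++-assoc (encSym s) (encDir d) rest))) ⟩
  decode (decodeT 2 (natT (suc r)) table leaf leaf w) (encℕ (toℕ q) ++ encSym s ++ encDir d ++ rest)
    ≡⟨ decode-state (toℕ q) 0 (natT (suc r)) table w _ ⟩
  decode (decodeT 3 (natT (suc r)) table (natT (toℕ q + 0)) leaf w) (encSym s ++ encDir d ++ rest)
    ≡⟨ decode-symbol s d r table (natT (toℕ q + 0)) w rest ⟩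
  decode (decodeT 1 (natT r) (node (node (natT (toℕ q + 0)) (node (symT s) (dirT d))) table) leaf leaf w) rest
    ≡⟨ cong (λ m → decode (decodeT 1 (natT r) (node (node (natT m) (node (symT s) (dirT d))) table) leaf leaf w) rest) (+-identityʳ (toℕ q)) ⟩
  decode (decodeT 1 (natT r) (node (node (natT (toℕ q)) (node (symT s) (dirT d))) table) leaf leaf w) rest ∎
  where open ≡-Reasoning

decode-entries : ∀ {k} (es : List (Maybe (Fin (suc k) × Sym × Dir))) acc w rest →
                 decode (decodeT 1 (natT (length es)) (listT entryT acc) leaf leaf w) (concatMap encEntry es ++ rest) ≡
                 decode (decodeT 1 leaf (listT entryT (es ʳ++ acc)) leaf leaf w) rest
decode-entries []       acc w rest = refl
decode-entries (e ∷ es) acc w rest = trans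
  (cong (decode (decodeT 1 (natT (suc (length es))) (listT entryT acc) leaf leaf w)) (++-assoc (encEntry e) (concatMap encEntry es) rest))
  (trans (decode-entry e (length es) (listT entryT acc) w _) (decode-entries es (e ∷ acc) w rest))

decode-word : ∀ x acc table → decode (decodeT 1 leaf table leaf leaf (bitsT acc)) (encWord x) ≡ decodeT 7 leaf table leaf leaf (bitsT (x ʳ++ acc))
decode-word []      acc table = refl
decode-word (b ∷ x) acc table = decode-word x (b ∷ acc) table

rowOf : ∀ M → Fin (suc (nStates M)) → List (Maybe (Fin (suc (nStates M)) × Sym × Dir))
rowOf M q = map (δ M q) allSyms

entries : ∀ M → List (Maybe (Fin (suc (nStates M)) × Sym × Dir))
entries M = concatMap (rowOf M) (allFin (suc (nStates M)))

enc-entries : ∀ M → encTM M ≡ encℕ (nStates M) ++ concatMap encEntry (entries M)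
enc-entries M = cong (encℕ (nStates M) ++_) (nested (allFin (suc (nStates M))))
  where
  row-code : ∀ q ss → concatMap (λ s → encEntry {nStates M} (δ M q s)) ss ≡ concatMap encEntry (map (δ M q) ss)
  row-code q []       = refl
  row-code q (s ∷ ss) = cong (encEntry (δ M q s) ++_) (row-code q ss)
  nested : ∀ qs → concatMap (λ q → concatMap (λ s → encEntry {nStates M} (δ M q s)) allSyms) qs ≡ concatMap encEntry (concatMap (rowOf M) qs)
  nested []       = refl
  nested (q ∷ qs) = trans (cong₂ _++_ (row-code q allSyms) (nested qs)) (sym (LP.concatMap-++ encEntry (rowOf M q) (concatMap (rowOf M) qs)))

length-entries : ∀ M → length (entries M) ≡ add3 (suc (nStates M)) 0
length-entries M = count (suc (nStates M)) id
  where
  add3-suc : ∀ n k → add3 n (3 + k) ≡ 3 + add3 n k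
  add3-suc zero    k = refl
  add3-suc (suc n) k = add3-suc n (3 + k)
  count : ∀ n (h : Fin n → Fin (suc (nStates M))) → length (concatMap (rowOf M) (tabulate h)) ≡ add3 n 0
  count zero    h = refl
  count (suc n) h = trans (cong (3 +_) (count n (h ∘ F.suc))) (sym (add3-suc n 0))

-- Loading the decoded machine and simulating a transition

loadᵗ : Tm 1
loadᵗ = caseᵗ (v 0) leafᵗ (caseᵗ (v 1) leafᵗ (caseᵗ (v 1) leafᵗ (caseᵗ (v 1) leafᵗ (caseᵗ (v 1) leafᵗ
  (letᵗ (call₁ reverseᵗ (v 4)) (caseᵗ (foldᵗ (v 2) leafᵗ (nodeᵗ (nodeᵗ leafᵗ (v 0)) (v 1)))
    (runᵗ (v 0) (confᵗ leafᵗ leafᵗ leafᵗ leafᵗ))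
    (runᵗ (v 2) (confᵗ leafᵗ leafᵗ (v 0) (v 1)))))))))

startᵗ : Tm 1
startᵗ = call₁ loadᵗ (foldᵗ (call₁ reverseᵗ (v 0)) (decodeᵗ 0 leafᵗ leafᵗ leafᵗ leafᵗ leafᵗ) (ren decodeStepᵗ first₂))

-- Folded along a state number in unary, this step leads to the part of the table that begins with
-- the three entries of that state.
drop3ᵗ : Tm 2
drop3ᵗ = caseᵗ (v 1) leafᵗ (caseᵗ (v 1) leafᵗ (caseᵗ (v 1) leafᵗ (v 1)))

entryᵗ : Tm 3
entryᵗ = caseᵗ (foldᵗ (v 1) (v 0) (ren drop3ᵗ first₂)) leafᵗ (caseᵗ (v 4) (v 0)
  (caseᵗ (v 3) leafᵗ (caseᵗ (v 3) (v 0) (caseᵗ (v 3) leafᵗ (v 0)))))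

-- Variables: 0 entry, 1 symbol, 2 right, 3 left, 7 table.
moveᵗ : Tm 9
moveᵗ = caseᵗ (v 0) leafᵗ (caseᵗ (v 1) leafᵗ (caseᵗ (v 1)
  (caseᵗ (v 7) (runᵗ (v 11) (confᵗ (v 2) leafᵗ leafᵗ (nodeᵗ (v 0) (v 6))))
               (runᵗ (v 13) (confᵗ (v 4) (v 1) (v 0) (nodeᵗ (v 2) (v 8)))))
  (caseᵗ (v 8) (runᵗ (v 13) (confᵗ (v 4) (nodeᵗ (v 2) (v 9)) leafᵗ leafᵗ))
               (runᵗ (v 15) (confᵗ (v 6) (nodeᵗ (v 4) (v 11)) (v 0) (v 1))))))

stepᵗ : Tm 2
stepᵗ = caseᵗ (v 1) leafᵗ (caseᵗ (v 1) leafᵗ (caseᵗ (v 1) leafᵗ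
  (letᵗ (ren entryᵗ (F.# 6 ◂ F.# 4 ◂ F.# 0 ◂ λ ())) moveᵗ)))

universalᵗ : Tm 1
universalᵗ = caseᵗ (v 0) leafᵗ (caseᵗ (v 0) (ren startᵗ (λ _ → F.# 1)) (caseᵗ (v 3) leafᵗ (ren stepᵗ first₂)))

module _ (M : TM) where

  tableT : Tree
  tableT = listT entryT (entries M)

  start-eval : ∀ x → eval startᵗ (λ _ → bitsT (reverse (encTM M ++ encWord x))) ≡ runT tableT (confT (initConf {nStates M} x))
  start-eval x = trans (cong (λ t → eval loadᵗ (λ _ → foldT decodeStep (decodeT 0 leaf leaf leaf leaf leaf) t)) reversed)
    (trans (cong (λ t → eval loadᵗ (λ _ → t)) decoded) finish)
    where
    w : List Bool
    w = encTM M ++ encWord x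
    reversed : eval reverseᵗ (λ _ → bitsT (reverse w)) ≡ bitsT w
    reversed = trans (reverse-eval bitT (reverse w) (λ _ → bitsT (reverse w)) refl) (cong bitsT (LP.reverse-involutive w))
    decoded : decode (decodeT 0 leaf leaf leaf leaf leaf) w ≡ decodeT 7 leaf (listT entryT (reverse (entries M))) leaf leaf (bitsT (reverse x))
    decoded = trans (cong (λ u → decode (decodeT 0 leaf leaf leaf leaf leaf) (u ++ encWord x)) (enc-entries M))
      (trans (cong (decode (decodeT 0 leaf leaf leaf leaf leaf)) (++-assoc (encℕ (nStates M)) (concatMap encEntry (entries M)) (encWord x)))
      (trans (decode-count (nStates M) 0 _)
      (trans (cong (λ n → decode (decodeT 1 (natT n) leaf leaf leaf leaf) (concatMap encEntry (entries M) ++ encWord x)) (sym (length-entries M)))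
      (trans (decode-entries (entries M) [] leaf (encWord x)) (decode-word x [] (listT entryT (reverse (entries M))))))))
    symbols : foldT (λ b acc → node (node leaf b) acc) leaf (bitsT (reverse x)) ≡ listT symT (map just x)
    symbols = trans (foldT-listT {enc = bitT} {encY = listT symT} {f = λ acc b → just b ∷ acc} (λ b acc → node (node leaf b) acc) (λ _ _ → refl) [] (reverse x))
      (cong (listT symT) (trans (pushes-just (reverse x) []) (trans (++-identityʳ _) (cong (map just) (LP.reverse-involutive x)))))
      where
      pushes-just : ∀ (y : List Bool) acc → foldl (λ acc b → just b ∷ acc) acc y ≡ map just (reverse y) ++ acc
      pushes-just []      acc = refl
      pushes-just (b ∷ y) acc = trans (pushes-just y (just b ∷ acc))
        (trans (sym (++-assoc (map just (reverse y)) (just b ∷ []) acc))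
               (cong (_++ acc) (trans (sym (map-++ just (reverse y) (b ∷ []))) (cong (map just) (sym (unfold-reverse b y))))))
    finish : eval loadᵗ (λ _ → decodeT 7 leaf (listT entryT (reverse (entries M))) leaf leaf (bitsT (reverse x))) ≡ runT tableT (confT (initConf {nStates M} x))
    finish = trans (cong₂ (λ t ws → caseT ws (runT t (node leaf (node leaf (node leaf leaf)))) (λ h r → runT t (node leaf (node leaf (node h r)))))
        (trans (reverse-eval entryT (reverse (entries M)) (λ _ → listT entryT (reverse (entries M))) refl) (cong (listT entryT) (LP.reverse-involutive (entries M)))) symbols)
      (loaded x)
      where
      loaded : ∀ x → caseT (listT symT (map just x)) (runT tableT (node leaf (node leaf (node leaf leaf)))) (λ h r → runT tableT (node leaf (node leaf (node h r)))) ≡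
                      runT tableT (confT (initConf {nStates M} x))
      loaded []      = refl
      loaded (b ∷ x) = refl

  drop3 : Tree → Tree → Tree
  drop3 x t = eval drop3ᵗ (x ◂ t ◂ noEnv)

  drop-rows : ∀ n (h : Fin n → Fin (suc (nStates M))) i → ∃[ rest ]
              foldT drop3 (listT entryT (concatMap (rowOf M) (tabulate h))) (natT (toℕ i)) ≡
              listT entryT (rowOf M (h i) ++ rest)
  drop-rows (suc n) h F.zero    = concatMap (rowOf M) (tabulate (h ∘ F.suc)) , refl
  drop-rows (suc n) h (F.suc i) = drop-rows n (h ∘ F.suc) i

  entry-eval : ∀ q s → eval entryᵗ (tableT ◂ natT (toℕ q) ◂ symT s ◂ noEnv) ≡ entryT (δ M q s)
  entry-eval q s with drop-rows (suc (nStates M)) id q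
  ... | rest , e rewrite e = select s
    where
    select : ∀ s → caseT (listT entryT (rowOf M q ++ rest)) leaf (λ e₀ t → caseT (symT s) e₀ (λ _ b → caseT t leaf (λ e₁ t₁ →
                   caseT b e₁ (λ _ _ → caseT t₁ leaf (λ e₂ _ → e₂))))) ≡ entryT (δ M q s)
    select nothing      = refl
    select (just false) = refl
    select (just true)  = refl

  -- Halting becomes the leaf, the value on which the iteration stops.
  stepT : Maybe (Config (nStates M)) → Tree
  stepT nothing  = leaf
  stepT (just c) = runT tableT (confT c)

  universal-step : ∀ c → apply universalᵗ (runT tableT (confT c)) ≡ stepT (step M c)
  universal-step (conf q l s r) = trans (cong (λ t → eval moveᵗ (t ◂ symT s ◂ listT symT r ◂ listT symT l ◂ leaf ◂ leaf ◂ leaf ◂ tableT ◂ leaf ◂ noEnv)) (entry-eval q s))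
    (moved-to l r (δ M q s) refl)
    where
    moved-to : ∀ l r e → δ M q s ≡ e → eval moveᵗ (entryT e ◂ symT s ◂ listT symT r ◂ listT symT l ◂ leaf ◂ leaf ◂ leaf ◂ tableT ◂ leaf ◂ noEnv) ≡
               stepT (step M (conf q l s r))
    moved-to l       r       nothing              d rewrite d = refl
    moved-to []      r       (just (q′ , s′ , L)) d rewrite d = refl
    moved-to (_ ∷ _) r       (just (q′ , s′ , L)) d rewrite d = refl
    moved-to l       []      (just (q′ , s′ , R)) d rewrite d = refl
    moved-to l       (_ ∷ _) (just (q′ , s′ , R)) d rewrite d = refl

  universal-halts : ∀ k c → iterate (apply universalᵗ) (runT tableT (confT c)) k ≡ leaf → Halts (step M) c
  universal-halts zero    c ()
  universal-halts (suc k) c e rewrite universal-step c with step M c in eq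
  ... | nothing = 0 , c , done , eq
  ... | just c′ with universal-halts k c′ e
  ... | n , c″ , r , h = suc n , c″ , next eq r , h

  halts-universal : ∀ {n c c′} → Reach (step M) n c c′ → step M c′ ≡ nothing → ∃[ k ] iterate (apply universalᵗ) (runT tableT (confT c)) k ≡ leaf
  halts-universal {c = c} done h = 1 , trans (universal-step c) (cong stepT h)
  halts-universal {c = c} (next e r) h with halts-universal r h
  ... | k , eq = suc k , trans (cong (λ t → iterate (apply universalᵗ) t k) (trans (universal-step c) (cong stepT e))) eq

  universal⇔halts : ∀ x → (∃[ k ] iterate (apply universalᵗ) (initialTree (encTM M ++ encWord x)) k ≡ leaf) ⇔ HaltsOn M x
  universal⇔halts x = mk⇔ to from
    where
    first-round : apply universalᵗ (initialTree (encTM M ++ encWord x)) ≡ runT tableT (confT (initConf {nStates M} x))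
    first-round = start-eval x
    to : (∃[ k ] iterate (apply universalᵗ) (initialTree (encTM M ++ encWord x)) k ≡ leaf) → HaltsOn M x
    to (suc k , e) = halts⇒haltsOn M x (universal-halts k (initConf x) (trans (cong (λ t → iterate (apply universalᵗ) t k) (sym first-round)) e))
    from : HaltsOn M x → ∃[ k ] iterate (apply universalᵗ) (initialTree (encTM M ++ encWord x)) k ≡ leaf
    from h with haltsOn⇒halts M x h
    ... | n , c , r , e with halts-universal r e
    ... | k , eq = suc k , trans (cong (λ t → iterate (apply universalᵗ) t k) first-round) eq

-- The reductions

concatMap-hom : ∀ (g f : Bool → List Bool) pre w suf →
                concatMap g (pre ++ concatMap f w ++ suf) ≡ concatMap g pre ++ concatMap (concatMap g ∘ f) w ++ concatMap g suf
concatMap-hom g f pre w suf = trans (LP.concatMap-++ g pre _) (cong (concatMap g pre ++_)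
  (trans (LP.concatMap-++ g (concatMap f w) suf) (cong (_++ concatMap g suf) (nested w))))
  where
  nested : ∀ w → concatMap g (concatMap f w) ≡ concatMap (concatMap g ∘ f) w
  nested []      = refl
  nested (b ∷ w) = trans (LP.concatMap-++ g (f b) (concatMap f w)) (cong (concatMap g (f b) ++_) (nested w))

bitCode : Bool → List Bool
bitCode b = reverse (true ∷ ser (bitT b))

-- A list is serialised cell by cell and closed by a 0; in reverse the closing bit comes first and
-- the remainder is a letterwise substitution.
reverse-bitsT : ∀ w → reverse (ser (bitsT w)) ≡ false ∷ concatMap bitCode (reverse w)
reverse-bitsT []      = refl
reverse-bitsT (b ∷ w) = begin
  reverse ((true ∷ ser (bitT b)) ++ ser (bitsT w))                 ≡⟨ reverse-++ (true ∷ ser (bitT b)) (ser (bitsT w)) ⟩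
  reverse (ser (bitsT w)) ++ bitCode b                             ≡⟨ cong (_++ bitCode b) (reverse-bitsT w) ⟩
  false ∷ concatMap bitCode (reverse w) ++ bitCode b               ≡⟨ cong (λ u → false ∷ concatMap bitCode (reverse w) ++ u) (++-identityʳ (bitCode b)) ⟨
  false ∷ concatMap bitCode (reverse w) ++ concatMap bitCode (b ∷ []) ≡⟨ cong (false ∷_) (LP.concatMap-++ bitCode (reverse w) (b ∷ [])) ⟨
  false ∷ concatMap bitCode (reverse w ++ b ∷ [])                  ≡⟨ cong (λ u → false ∷ concatMap bitCode u) (unfold-reverse b w) ⟨
  false ∷ concatMap bitCode (reverse (b ∷ w))                      ∎
  where open ≡-Reasoning

reverse-initialTree : ∀ w → reverse (ser (initialTree w)) ≡ (false ∷ []) ++ concatMap bitCode w ++ (false ∷ true ∷ [])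
reverse-initialTree w = trans (reverse-++ (true ∷ false ∷ []) (ser (bitsT (reverse w))))
  (cong (_++ false ∷ true ∷ []) (trans (reverse-bitsT (reverse w)) (cong (λ u → false ∷ concatMap bitCode u) (LP.reverse-involutive w))))

encLetter : Bool → List Bool
encLetter b = true ∷ b ∷ []

encWord-letters : ∀ w → encWord w ≡ concatMap encLetter w ++ false ∷ []
encWord-letters []      = refl
encWord-letters (b ∷ w) = cong (λ u → true ∷ b ∷ u) (encWord-letters w)

module _ (F : Tm 1) where

  -- The prefix is the home block without its leading 1, followed by the block of the bit that
  -- closes the list; the suffix holds the left leaf and the root of the initial tree.
  wordPrefix wordSuffix : List Bool
  wordPrefix = replicate (stacks F + stacks F) false ++ concatMap (block F) (false ∷ [])
  wordSuffix = concatMap (block F) (false ∷ true ∷ [])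

  wordLetter : Bool → List Bool
  wordLetter = concatMap (block F) ∘ bitCode

  treeWord-hom : ∀ w → treeWord F (initialTree w) ≡ true ∷ wordPrefix ++ concatMap wordLetter w ++ wordSuffix
  treeWord-hom w = cong (true ∷_) (begin
    zeros ++ concatMap (block F) (reverse (ser (initialTree w)))  ≡⟨ cong (λ u → zeros ++ concatMap (block F) u) (reverse-initialTree w) ⟩
    zeros ++ concatMap (block F) ((false ∷ []) ++ concatMap bitCode w ++ (false ∷ true ∷ []))
      ≡⟨ cong (zeros ++_) (concatMap-hom (block F) bitCode (false ∷ []) w (false ∷ true ∷ [])) ⟩
    zeros ++ concatMap (block F) (false ∷ []) ++ concatMap wordLetter w ++ wordSuffix
      ≡⟨ ++-assoc zeros _ (concatMap wordLetter w ++ wordSuffix) ⟨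
    wordPrefix ++ concatMap wordLetter w ++ wordSuffix ∎)
    where
    open ≡-Reasoning
    zeros : List Bool
    zeros = replicate (stacks F + stacks F) false

  iteration⇔halts : ∀ w → (∃[ k ] iterate (apply F) (initialTree w) k ≡ leaf) ⇔
                          HaltsOn (iterTM F) (true ∷ wordPrefix ++ concatMap wordLetter w ++ wordSuffix)
  iteration⇔halts w = mk⇔ (λ (k , e) → subst (HaltsOn (iterTM F)) (treeWord-hom w) (iterTM-halts F k (initialTree w) e))
                          (λ h → iterTM-halts⁻¹ F (initialTree w) (subst (HaltsOn (iterTM F)) (sym (treeWord-hom w)) h))

module _ (M : TM) (p s : List Bool) (l : Bool → List Bool) where

  private
    substituted : List Bool → List Bool
    substituted w = p ++ concatMap l w ++ s

  enc-halting : ∀ w → encTM M ++ encWord (true ∷ substituted w) ≡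
    (encTM M ++ encLetter true ++ concatMap encLetter p) ++ concatMap (concatMap encLetter ∘ l) w ++ (concatMap encLetter s ++ false ∷ [])
  enc-halting w = begin
    m ++ encWord (true ∷ substituted w)                                 ≡⟨ cong (m ++_) (encWord-letters (true ∷ substituted w)) ⟩
    m ++ t ++ concatMap encLetter (substituted w) ++ false ∷ []         ≡⟨ cong (λ u → m ++ t ++ u ++ false ∷ []) (concatMap-hom encLetter l p w s) ⟩
    m ++ t ++ (a ++ b ++ c) ++ false ∷ []                               ≡⟨ cong (λ u → m ++ t ++ u) (++-assoc a (b ++ c) (false ∷ [])) ⟩
    m ++ t ++ a ++ (b ++ c) ++ false ∷ []                               ≡⟨ cong (λ u → m ++ t ++ a ++ u) (++-assoc b c (false ∷ [])) ⟩
    m ++ t ++ a ++ b ++ c ++ false ∷ []                                 ≡⟨ cong (m ++_) (++-assoc t a (b ++ c ++ false ∷ [])) ⟨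
    m ++ (t ++ a) ++ b ++ c ++ false ∷ []                               ≡⟨ ++-assoc m (t ++ a) (b ++ c ++ false ∷ []) ⟨
    (m ++ t ++ a) ++ b ++ c ++ false ∷ []                               ∎
    where
    open ≡-Reasoning
    m t a b c : List Bool
    m = encTM M
    t = encLetter true
    a = concatMap encLetter p
    b = concatMap (concatMap encLetter ∘ l) w
    c = concatMap encLetter s

  enc-crossword : ∀ w → encRegExp (machineRx M (substituted w)) ≡
    (rxPrefix M ++ concatMap (letterCode M) p) ++ concatMap (concatMap (letterCode M) ∘ l) w ++ (concatMap (letterCode M) s ++ encRegExp (blankRx M))
  enc-crossword w = trans (enc-machineRx M (substituted w))
    (rearrange (rxPrefix M) (encRegExp (blankRx M)) (concatMap (letterCode M) p) (concatMap (concatMap (letterCode M) ∘ l) w)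
               (concatMap (letterCode M) s) (concatMap-hom (letterCode M) l p w s))
    where
    rearrange : ∀ (q z a b c : List Bool) {u} → u ≡ a ++ b ++ c → q ++ u ++ z ≡ (q ++ a) ++ b ++ (c ++ z)
    rearrange q z a b c refl = begin
      q ++ (a ++ b ++ c) ++ z ≡⟨ cong (q ++_) (++-assoc a (b ++ c) z) ⟩
      q ++ a ++ (b ++ c) ++ z ≡⟨ cong (λ u → q ++ a ++ u) (++-assoc b c z) ⟩
      q ++ a ++ b ++ c ++ z   ≡⟨ ++-assoc q a (b ++ c ++ z) ⟨
      (q ++ a) ++ b ++ c ++ z ∎
      where open ≡-Reasoning

  -- A problem semidecided by a fixed machine on a letterwise substitution of the code reduces to
  -- both problems. The first reduction serves crosswords with the searching machine, the second the
  -- Halting Problem with the universal one.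
  module _ {X : Set} (encX : X → List Bool) (A : X → Set) (semidecides : ∀ x → A x ⇔ HaltsOn M (true ∷ substituted (encX x))) where

    reduce-to-halting : ManyOneReducible encX encTMInput A HALT
    reduce-to-halting = homTM pre f suf , λ x → (M , true ∷ substituted (encX x)) ,
      subst (HaltsWithOutput (homTM pre f suf) (encX x)) (sym (enc-halting (encX x))) (homTM-computes pre f suf (encX x)) , semidecides x
      where
      pre suf : List Bool
      pre = encTM M ++ encLetter true ++ concatMap encLetter p
      suf = concatMap encLetter s ++ false ∷ []
      f : Bool → List Bool
      f = concatMap encLetter ∘ l

    reduce-to-crossword : ManyOneReducible encX encPosRegExp A CROSSWORD
    reduce-to-crossword = homTM pre f suf , λ x →
      (machineRx M (substituted (encX x)) , crosswordRx-positive (rowRx M (substituted (encX x))) colRx) ,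
      subst (HaltsWithOutput (homTM pre f suf) (encX x)) (sym (enc-crossword (encX x))) (homTM-computes pre f suf (encX x)) ,
      mk⇔ (λ a → Equivalence.from (crossword⇔halts M (substituted (encX x))) (Equivalence.to (semidecides x) a))
          (λ c → Equivalence.from (semidecides x) (Equivalence.to (crossword⇔halts M (substituted (encX x))) c))
      where
      pre suf : List Bool
      pre = rxPrefix M ++ concatMap (letterCode M) p
      suf = concatMap (letterCode M) s ++ encRegExp (blankRx M)
      f : Bool → List Bool
      f = concatMap (letterCode M) ∘ l

semidecided : ∀ {X : Set} (encX : X → List Bool) (A : X → Set) F →
              (∀ x → (∃[ k ] iterate (apply F) (initialTree (encX x)) k ≡ leaf) ⇔ A x) →
              ∀ x → A x ⇔ HaltsOn (iterTM F) (true ∷ wordPrefix F ++ concatMap (wordLetter F) (encX x) ++ wordSuffix F)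
semidecided encX A F search x = mk⇔ (λ a → Equivalence.to (iteration⇔halts F (encX x)) (Equivalence.from (search x) a))
                                    (λ h → Equivalence.to (search x) (Equivalence.from (iteration⇔halts F (encX x)) h))

theorem4p3 : MEquivalent encPosRegExp encTMInput CROSSWORD HALT
theorem4p3 =
  reduce-to-halting (iterTM crosswordSearch) (wordPrefix crosswordSearch) (wordSuffix crosswordSearch) (wordLetter crosswordSearch)
    encPosRegExp CROSSWORD (semidecided encPosRegExp CROSSWORD crosswordSearch (λ (E , _) → search⇔crossword E)) ,
  reduce-to-crossword (iterTM universalᵗ) (wordPrefix universalᵗ) (wordSuffix universalᵗ) (wordLetter universalᵗ)
    encTMInput HALT (semidecided encTMInput HALT universalᵗ (λ (M , x) → universal⇔halts M x))
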